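{- Let $X,Y,A,B$ be formal variables. Define the sequences $$g_n = BY\left[(1+AY)^n + (AY)^n\,(Y^{ -2}-1)\right],\qquad h_n=(AY)^{n-1}\qquad (n\ge 1),$$ let $\hat g_n=\sum_{\sigma\in \mathrm{NC}(n)}\prod_{c\in\sigma} g_{|c|}$ (product over the blocks $c$ of $\sigma$), $\hat g(X)=\sum_{n\ge1}\hat g_nX^n$ and $h(X)=\sum_{n\ge1}h_nX^n$. Let $$K(X,Y,A,B)=\sum_{n=1}^\infty X^n \sum_{\substack{\alpha\in \mathrm{KrInt}(n),\ \beta\in \mathrm{NC}(n)\\ \alpha\wedge_{\mathrm{KrInt}}\beta=0_n}} Y^{\|\alpha^{ -1}\beta\|}A^{\|\alpha^{ -1}\gamma_n\|}B^{\|\beta^{ -1}\gamma_n\|}.$$ Then, as formal power series in $X$, $$K(X,Y,A,B)=h\big(X(1+\hat g(X))\big)=\sum_{s=1}^\infty h_sX^s\big(1+\hat g(X)\big)^s ,$$ and the generating function of meandric systems with shallow top, $$M(X,Y,A,B)=\sum_{n=1}^\infty X^n\sum_{\alpha\in\mathrm{Int}(n),\ \beta\in\mathrm{NC}(n)}Y^{\|\alpha^{ -1}\beta\|}A^{\|\alpha\|}B^{\|\beta\|},$$ satisfies $M=\dfrac{K}{1-K}$.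
   Context: $\mathcal S_n$ is the symmetric group on $[n]=\{1,\dots,n\}$; $\#\alpha$ is the number of cycles of $\alpha\in\mathcal S_n$ and $\|\alpha\|=n-\#\alpha$ its length (minimal number of transpositions). $\gamma_n=(1\,2\,\cdots\,n)$ is the full cycle, also denoted $1_n$, and $0_n$ is the identity permutation. A partition of $[n]$ is non-crossing if there are no distinct blocks $B_i,B_j$ and $a,b\in B_i$, $c,d\in B_j$ with $a<c<b<d$; $\mathrm{NC}(n)$ is the set of non-crossing partitions of $[n]$, and each is identified with the permutation whose cycles are its blocks, each cycle listing its elements in increasing order. $\mathrm{Int}(n)\subseteq\mathrm{NC}(n)$ is the set of interval partitions (every block consists of consecutive integers). $\mathrm{NC}(n)$ is partially ordered by $\rho\le\sigma$ iff every block of $\rho$ is contained in a block of $\sigma$. The Kreweras complement of $\alpha\in\mathrm{NC}(n)$ is the permutation $\alpha^{\mathrm{Kr}}=\alpha^{ -1}\gamma_n$, which again belongs to $\mathrm{NC}(n)$; $\mathrm{KrInt}(n)=\{\alpha^{\mathrm{Kr}}:\alpha\in\mathrm{Int}(n)\}$. For $\alpha,\beta\in\mathrm{NC}(n)$, $\alpha\wedge_{\mathrm{KrInt}}\beta=\max\{\rho\in\mathrm{KrInt}(n):\rho\le\alpha,\ \rho\le\beta\}$. -}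

module Defs where

open import Level using (Level)
open import Data.Bool using (Bool; true; false; not; _∧_; _∨_; if_then_else_)
open import Data.Nat using (ℕ; zero; suc; _∸_; _≡ᵇ_; _<ᵇ_) renaming (_+_ to _+ℕ_)
open import Data.List using (List; []; _∷_; map; concatMap; upTo; foldr; length)
open import Data.Bool.ListAction using (all; any)
open import Algebra.Bundles using (CommutativeRing)

-- Conventions: [n] is encoded 0-indexed as {0,…,n-1}.  A permutation of
-- [n] is a function ℕ → ℕ (only its values on 0,…,n-1 matter);
-- composition is functional: (π ∘ σ)(i) = π (σ i).

firstOr : ℕ → (ℕ → Bool) → List ℕ → ℕ
firstOr d P []       = d
firstOr d P (x ∷ xs) = if P x then x else firstOr d P xs

countB : (ℕ → Bool) → List ℕ → ℕ
countB P []       = 0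
countB P (x ∷ xs) = if P x then suc (countB P xs) else countB P xs

at : List ℕ → ℕ → ℕ
at []       _       = 0
at (x ∷ xs) zero    = x
at (x ∷ xs) (suc i) = at xs i

-- Set partitions of [n], each represented exactly once by its restricted
-- growth string p (p i = label of the block of i, blocks labelled in order
-- of their first element).

private
  rgsGo : ℕ → ℕ → List (List ℕ)
  rgsGo zero    m = [] ∷ []
  rgsGo (suc k) m =
    concatMap (λ l → map (l ∷_) (rgsGo k (if l ≡ᵇ m then suc m else m))) (upTo (suc m))

Partitions : ℕ → List (List ℕ)
Partitions n = rgsGo n 0

blockLabels : ℕ → List ℕ → List ℕ
blockLabels n p = Data.List.filterᵇ (λ l → any (λ i → at p i ≡ᵇ l) (upTo n)) (upTo n)

blockSize : ℕ → List ℕ → ℕ → ℕ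
blockSize n p l = countB (λ i → at p i ≡ᵇ l) (upTo n)

isNC : ℕ → List ℕ → Bool
isNC n p =
  all (λ a → all (λ b → all (λ c → all (λ d →
    not ((a <ᵇ c) ∧ (c <ᵇ b) ∧ (b <ᵇ d)
         ∧ (at p a ≡ᵇ at p b) ∧ (at p c ≡ᵇ at p d)
         ∧ not (at p a ≡ᵇ at p c)))
    (upTo n)) (upTo n)) (upTo n)) (upTo n)

isInt : ℕ → List ℕ → Bool
isInt n p =
  all (λ a → all (λ b → all (λ c →
    not ((a <ᵇ c) ∧ (c <ᵇ b) ∧ (at p a ≡ᵇ at p b)) ∨ (at p c ≡ᵇ at p a))
    (upTo n)) (upTo n)) (upTo n)

NC : ℕ → List (List ℕ)
NC n = Data.List.filterᵇ (isNC n) (Partitions n)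

Int : ℕ → List (List ℕ)
Int n = Data.List.filterᵇ (isInt n) (Partitions n)

-- the permutation of a partition: each block is a cycle listing its
-- elements in increasing order
toPerm : ℕ → List ℕ → ℕ → ℕ
toPerm n p i =
  firstOr (firstOr i same (upTo n)) same (map (λ k → suc (i +ℕ k)) (upTo (n ∸ suc i)))
  where
  same : ℕ → Bool
  same j = at p j ≡ᵇ at p i

idPerm : ℕ → ℕ
idPerm i = i

γ : ℕ → ℕ → ℕ
γ n i = if suc i <ᵇ n then suc i else 0

inv : ℕ → (ℕ → ℕ) → ℕ → ℕ
inv n π j = firstOr j (λ i → π i ≡ᵇ j) (upTo n)

_∘ₚ_ : (ℕ → ℕ) → (ℕ → ℕ) → ℕ → ℕ
(π ∘ₚ σ) i = π (σ i)

iter : (ℕ → ℕ) → ℕ → ℕ → ℕ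
iter π zero    i = i
iter π (suc k) i = π (iter π k i)

-- #π : number of cycles of π on [n], counted by their minimal elements
-- (i is the least element of its cycle iff no π^k(i), 1 ≤ k ≤ n, is < i)
#cyc : ℕ → (ℕ → ℕ) → ℕ
#cyc n π = countB (λ i → all (λ k → not (iter π (suc k) i <ᵇ i)) (upTo n)) (upTo n)

∥_∥[_] : (ℕ → ℕ) → ℕ → ℕ
∥ π ∥[ n ] = n ∸ #cyc n π

Kr : ℕ → (ℕ → ℕ) → ℕ → ℕ
Kr n α = inv n α ∘ₚ γ n

KrInt : ℕ → List (ℕ → ℕ)
KrInt n = map (λ p → Kr n (toPerm n p)) (Int n)

sameCycle : ℕ → (ℕ → ℕ) → ℕ → ℕ → Bool
sameCycle n π i j = any (λ k → iter π k i ≡ᵇ j) (upTo (suc n))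

-- ρ ≤ σ (partitions given by their cycles): every cycle of ρ is contained
-- in a cycle of σ
_≤ₚ[_]_ : (ℕ → ℕ) → ℕ → (ℕ → ℕ) → Bool
ρ ≤ₚ[ n ] σ = all (λ i → sameCycle n σ i (ρ i)) (upTo n)

-- α ∧_KrInt β = 0_n : 0_n is the maximum of
-- { ρ ∈ KrInt(n) : ρ ≤ α, ρ ≤ β }   (0_n always belongs to this set,
-- since 0_n = (1_n)^Kr with 1_n ∈ Int(n)); i.e. every such ρ is ≤ 0_n.
meetKrIntIsZero : ℕ → (ℕ → ℕ) → (ℕ → ℕ) → Bool
meetKrIntIsZero n α β =
  all (λ ρ → not ((ρ ≤ₚ[ n ] α) ∧ (ρ ≤ₚ[ n ] β)) ∨ (ρ ≤ₚ[ n ] idPerm)) (KrInt n)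

-- Generating functions.  Y, A, B are formal variables: we work in an
-- arbitrary commutative ring R with elements y, a, b, where y has an
-- inverse yi (Y^{-2} occurs in g_n).  A formal power series in X over R
-- is its coefficient sequence ℕ → R.

module Series {c ℓ : Level} (R : CommutativeRing c ℓ)
               (y yi a b : CommutativeRing.Carrier R) where
  open CommutativeRing R

  PS : Set c
  PS = ℕ → Carrier

  sumL : {A : Set} → List A → (A → Carrier) → Carrier
  sumL xs f = foldr (λ x r → f x + r) 0# xs

  prodL : {A : Set} → List A → (A → Carrier) → Carrier
  prodL xs f = foldr (λ x r → f x * r) 1# xs

  pow : Carrier → ℕ → Carrier
  pow x zero    = 1#
  pow x (suc k) = x * pow x k

  oneS : PS
  oneS zero    = 1#
  oneS (suc _) = 0#

  _⊛_ : PS → PS → PS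
  (f ⊛ g) n = sumL (upTo (suc n)) (λ i → f i * g (n ∸ i))

  powS : PS → ℕ → PS
  powS f zero    = oneS
  powS f (suc k) = f ⊛ powS f k

  g : ℕ → Carrier
  g n = b * y * (pow (1# + a * y) n + pow (a * y) n * (yi * yi + - 1#))

  h : ℕ → Carrier
  h n = pow (a * y) (n ∸ 1)

  ĝ : ℕ → Carrier
  ĝ n = sumL (NC n) (λ σ → prodL (blockLabels n σ) (λ l → g (blockSize n σ l)))

  onePlusĝ : PS
  onePlusĝ zero    = 1#
  onePlusĝ (suc n) = ĝ (suc n)

  -- h(X(1 + ĝ(X))) = Σ_{s≥1} h_s X^s (1 + ĝ(X))^s ; the coefficient of
  -- X^n only receives contributions from s = 1, …, n
  hComp : PS
  hComp n = sumL (upTo n) (λ j → h (suc j) * powS onePlusĝ (suc j) (n ∸ suc j))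

  K : PS
  K zero    = 0#
  K (suc m) = sumL (KrInt n) (λ α → sumL (NC n) (λ β′ →
      let β = toPerm n β′ in
      if meetKrIntIsZero n α β
      then pow y ∥ inv n α ∘ₚ β ∥[ n ] * pow a ∥ inv n α ∘ₚ γ n ∥[ n ]
             * pow b ∥ inv n β ∘ₚ γ n ∥[ n ]
      else 0#))
    where n = suc m

  M : PS
  M zero    = 0#
  M (suc m) = sumL (Int n) (λ α′ → sumL (NC n) (λ β′ →
      let α = toPerm n α′ ; β = toPerm n β′ in
      pow y ∥ inv n α ∘ₚ β ∥[ n ] * pow a ∥ α ∥[ n ] * pow b ∥ β ∥[ n ]))
    where n = suc m

  oneMinusK : PS
  oneMinusK n = oneS n + - K n

{-# OPTIONS --safe #-}
module Submission where

-- Fattening a non-crossing partition gives a plane forest in which blocks and gaps alternate, i.e. a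
-- rose tree, and in this picture the Kreweras complement rotates the first bracket to the end. Write
-- α ∈ KrInt(n) as the long cycle on a set S of ends of intervals, n ∈ S. Removing elements one at a time
-- from the product shows that α⁻¹β has weight multiplicative over the blocks of β: a block with s elements,
-- k of them in S, contributes A^(s-k) Y^(s-k+1) if k ≥ 1 and A^s Y^(s-1) if k = 0, up to a correction for
-- the block V of n. The condition on the meet says V ∩ S = {n}. Summing over S gives g_s for a block of
-- size s, and (AY)^(s-1) for V in K, (1+AY)^(s-1) for V in M. With T = X (1 + ĝ(X)), splitting off V
-- yields K = T / (1 - AYT) = h(T) and M = T / (1 - (1+AY) T) = K / (1 - K).

open import Defs
open import Algebra.Bundles using (CommutativeRing)
open import Data.Bool using (Bool; true; false; not; _∧_; _∨_; if_then_else_; T)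
open import Data.Bool.ListAction using (all; any)
open import Data.Empty using (⊥; ⊥-elim)
open import Data.Fin using (toℕ; fromℕ<)
import Data.Fin.Properties as Fin
open import Data.List using (List; []; _∷_; _++_; _∷ʳ_; drop; initLast; _∷ʳ′_; cartesianProductWith; map; concatMap; upTo; applyUpTo; length; filterᵇ; [_])
import Data.List.Properties as List
open import Data.List.Membership.Propositional using (_∈_; _∉_)
open import Data.List.Membership.Propositional.Properties using (∈-upTo⁺; ∈-upTo⁻; ∈-map⁺; ∈-map⁻; ∈-concat⁺′; ∈-concat⁻′; ∈-++⁺ˡ; ∈-++⁺ʳ; ∈-++⁻; ∈-filter⁺; ∈-filter⁻; ∈-cartesianProductWith⁺; ∈-cartesianProductWith⁻)
open import Data.List.Membership.Propositional.Properties.WithK using (unique∧set⇒bag)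
open import Data.List.Relation.Binary.BagAndSetEquality using (∼bag⇒↭)
open import Data.List.Relation.Binary.Disjoint.Propositional using (Disjoint)
open import Data.List.Relation.Binary.Permutation.Propositional using (_↭_)
import Data.List.Relation.Binary.Permutation.Propositional as Perm
open import Data.List.Relation.Binary.Permutation.Propositional.Properties using (↭-length)
open import Data.List.Relation.Unary.All using (All; []; _∷_)
import Data.List.Relation.Unary.All as All
import Data.List.Relation.Unary.All.Properties as Allₚ
open import Data.List.Relation.Unary.AllPairs using ([]; _∷_)
open import Data.List.Relation.Unary.Any using (here; there; any?)
open import Data.List.Relation.Unary.Unique.Propositional using (Unique)
import Data.List.Relation.Unary.Unique.Propositional.Properties as Unique
open import Data.Nat using (ℕ; zero; suc; pred; _+_; _∸_; _≤_; _<_; _≡ᵇ_; _<ᵇ_; z≤n; s≤s; z<s; s<s)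
open import Data.Nat.Induction using (<-wellFounded)
import Data.Nat.Properties as ℕ
open import Data.Product using (∃; _×_; _,_; proj₁; proj₂)
open import Data.Sum using (_⊎_; inj₁; inj₂; [_,_]′)
open import Function using (_∘_; id; mk⇔)
open import Induction.WellFounded using (Acc; acc)
open import Relation.Binary.PropositionalEquality using (_≡_; _≢_; refl; sym; trans; cong; cong₂; subst; subst₂; module ≡-Reasoning)
open import Relation.Nullary using (¬_; yes; no)
open import Relation.Binary.Definitions using (tri<; tri≈; tri>)
open import Data.List.Relation.Binary.Sublist.Propositional using (_⊆_; []; _∷_; ⊆-refl; ⊆-trans) renaming (_∷ʳ_ to _skip∷_)
import Data.List.Relation.Binary.Sublist.Propositional.Properties as Subₚ
import Algebra.Properties.Ring
import Algebra.Solver.Ring.NaturalCoefficients.Default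
import Relation.Binary.Reasoning.Setoid

-- One binary tree has two readings: `labels R` on `size R` points, as a list of outer blocks, and
-- `block R` on one point more, as the list of gaps of one block. A Kreweras complement links their
-- permutations: the second is the long cycle times the inverse of the first with a fixed point
-- appended. This is why `perm` and `inverse` alternate, and why complementing becomes a move on
-- trees, from `cons u v` to `node u v`. The product `α⁻¹β` is in general not the permutation of a
-- non-crossing partition, so its cycles cannot be read off a tree. But the inverse of an interval
-- partition is a product of transpositions of neighbours, and removing the greatest point together
-- with its transposition, if there is one, leaves the permutation of a smaller tree as the other
-- factor. This allows an induction. The resulting weight is not a product over elements, as the
-- exponent of Y depends on whether a block meets S. It is a sum of two such products, the second
-- with coefficient 1/Y - Y = Y (Y^-2 - 1), the origin of Y^-2 - 1 in g.

true≢false : ∀ {b} → b ≡ true → b ≡ false → ⊥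
true≢false refl ()

bool-iff : ∀ {b c : Bool} → (b ≡ true → c ≡ true) → (c ≡ true → b ≡ true) → b ≡ c
bool-iff {false} {false} _ _ = refl
bool-iff {false} {true}  _ g = g refl
bool-iff {true}  {false} f _ = sym (f refl)
bool-iff {true}  {true}  _ _ = refl

¬true⇒false : ∀ {b} → ¬ (b ≡ true) → b ≡ false
¬true⇒false {false} _ = refl
¬true⇒false {true}  h = ⊥-elim (h refl)

not-true⁻ : ∀ {b} → not b ≡ true → b ≡ false
not-true⁻ {false} _ = refl

not-true⁺ : ∀ {b} → b ≡ false → not b ≡ true
not-true⁺ refl = refl

∧-true⁺ : ∀ {b c} → b ≡ true → c ≡ true → (b ∧ c) ≡ true
∧-true⁺ refl refl = refl

∧-true⁻ : ∀ {b c} → (b ∧ c) ≡ true → b ≡ true × c ≡ true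
∧-true⁻ {true} h = refl , h

true⇒T : ∀ {b} → b ≡ true → T b
true⇒T refl = _

T⇒true : ∀ {b} → T b → b ≡ true
T⇒true {true} _ = refl

≡ᵇ⁺ : ∀ {m n} → m ≡ n → (m ≡ᵇ n) ≡ true
≡ᵇ⁺ {m} {n} e = T⇒true (ℕ.≡⇒≡ᵇ m n e)

≡ᵇ⁻ : ∀ {m n} → (m ≡ᵇ n) ≡ true → m ≡ n
≡ᵇ⁻ {m} {n} e = ℕ.≡ᵇ⇒≡ m n (true⇒T e)

≢ᵇ⁺ : ∀ {m n} → m ≢ n → (m ≡ᵇ n) ≡ false
≢ᵇ⁺ h = ¬true⇒false (λ e → h (≡ᵇ⁻ e))

≢ᵇ⁻ : ∀ {m n} → (m ≡ᵇ n) ≡ false → m ≢ n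
≢ᵇ⁻ h e = true≢false (≡ᵇ⁺ e) h

<ᵇ⁺ : ∀ {m n} → m < n → (m <ᵇ n) ≡ true
<ᵇ⁺ h = T⇒true (ℕ.<⇒<ᵇ h)

<ᵇ⁻ : ∀ {m n} → (m <ᵇ n) ≡ true → m < n
<ᵇ⁻ {m} {n} e = ℕ.<ᵇ⇒< m n (true⇒T e)

≮ᵇ⁺ : ∀ {m n} → n ≤ m → (m <ᵇ n) ≡ false
≮ᵇ⁺ h = ¬true⇒false (λ e → ℕ.<⇒≱ (<ᵇ⁻ e) h)

≮ᵇ⁻ : ∀ {m n} → (m <ᵇ n) ≡ false → n ≤ m
≮ᵇ⁻ h = ℕ.≮⇒≥ (λ l → true≢false (<ᵇ⁺ l) h)

-- Boolean quantifiers, counting and searching in lists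

module _ {A : Set} {P : A → Bool} where

  all⁺ : ∀ xs → (∀ {x} → x ∈ xs → P x ≡ true) → all P xs ≡ true
  all⁺ []       h = refl
  all⁺ (x ∷ xs) h = ∧-true⁺ (h (here refl)) (all⁺ xs (h ∘ there))

  all⁻ : ∀ {xs} → all P xs ≡ true → ∀ {x} → x ∈ xs → P x ≡ true
  all⁻ {_ ∷ _} h (here refl) = proj₁ (∧-true⁻ h)
  all⁻ {_ ∷ _} h (there m)   = all⁻ (proj₂ (∧-true⁻ h)) m

  all-false⁻ : ∀ xs → all P xs ≡ false → ∃ λ x → x ∈ xs × P x ≡ false
  all-false⁻ (x ∷ xs) h with P x in e
  ... | false = x , here refl , e
  ... | true with all-false⁻ xs h
  ...   | z , m , q = z , there m , q

  any⁺ : ∀ {xs x} → x ∈ xs → P x ≡ true → any P xs ≡ true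
  any⁺ {_ ∷ _} (here refl) e rewrite e = refl
  any⁺ {y ∷ _} (there m)   e with P y
  ... | true  = refl
  ... | false = any⁺ m e

  any⁻ : ∀ xs → any P xs ≡ true → ∃ λ x → x ∈ xs × P x ≡ true
  any⁻ (x ∷ xs) h with P x in e
  ... | true  = x , here refl , e
  ... | false with any⁻ xs h
  ...   | z , m , q = z , there m , q

module _ {P : ℕ → Bool} {n : ℕ} where

  allUpTo⁺ : (∀ {i} → i < n → P i ≡ true) → all P (upTo n) ≡ true
  allUpTo⁺ h = all⁺ (upTo n) (λ m → h (∈-upTo⁻ m))

  allUpTo⁻ : all P (upTo n) ≡ true → ∀ {i} → i < n → P i ≡ true
  allUpTo⁻ h l = all⁻ h (∈-upTo⁺ l)

  allUpTo-false⁻ : all P (upTo n) ≡ false → ∃ λ i → i < n × P i ≡ false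
  allUpTo-false⁻ h with all-false⁻ (upTo n) h
  ... | i , m , e = i , ∈-upTo⁻ m , e

  anyUpTo⁺ : ∀ {i} → i < n → P i ≡ true → any P (upTo n) ≡ true
  anyUpTo⁺ l e = any⁺ (∈-upTo⁺ l) e

  anyUpTo⁻ : any P (upTo n) ≡ true → ∃ λ i → i < n × P i ≡ true
  anyUpTo⁻ h with any⁻ (upTo n) h
  ... | i , m , e = i , ∈-upTo⁻ m , e

countB-cong : ∀ {P Q : ℕ → Bool} xs → (∀ {x} → x ∈ xs → P x ≡ Q x) → countB P xs ≡ countB Q xs
countB-cong []       h = refl
countB-cong {P} {Q} (x ∷ xs) h rewrite h (here refl) | countB-cong {P} {Q} xs (h ∘ there) = refl

𝟙 : Bool → ℕ
𝟙 b = if b then 1 else 0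

countB-++ : ∀ (P : ℕ → Bool) xs ys → countB P (xs ++ ys) ≡ countB P xs + countB P ys
countB-++ P []       ys = refl
countB-++ P (x ∷ xs) ys with P x
... | true  = cong suc (countB-++ P xs ys)
... | false = countB-++ P xs ys

countB-suc : ∀ P n → countB P (upTo (suc n)) ≡ countB P (upTo n) + 𝟙 (P n)
countB-suc P n = trans (cong (countB P) (sym (List.upTo-∷ʳ n)))
  (trans (countB-++ P (upTo n) [ n ]) (cong (countB P (upTo n) +_) last))
  where
  last : countB P [ n ] ≡ 𝟙 (P n)
  last with P n
  ... | true  = refl
  ... | false = refl

countB≤length : ∀ P xs → countB P xs ≤ length xs
countB≤length P []       = z≤n
countB≤length P (x ∷ xs) with P x
... | true  = s≤s (countB≤length P xs)
... | false = ℕ.m≤n⇒m≤1+n (countB≤length P xs)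

countB≡length-filterᵇ : ∀ P xs → countB P xs ≡ length (filterᵇ P xs)
countB≡length-filterᵇ P []       = refl
countB≡length-filterᵇ P (x ∷ xs) with P x
... | true  = cong suc (countB≡length-filterᵇ P xs)
... | false = countB≡length-filterᵇ P xs

firstOr-hit : ∀ {P : ℕ → Bool} d xs {x} → x ∈ xs → P x ≡ true → P (firstOr d P xs) ≡ true × firstOr d P xs ∈ xs
firstOr-hit {P} d (y ∷ xs) m e with P y in q
... | true = q , here refl
... | false with m
...   | here refl = ⊥-elim (true≢false e q)
...   | there m′ with firstOr-hit {P} d xs m′ e
...     | a , b = a , there b

firstOr-miss : ∀ {P : ℕ → Bool} d xs → (∀ {x} → x ∈ xs → P x ≡ false) → firstOr d P xs ≡ d
firstOr-miss d []       h = refl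
firstOr-miss d (x ∷ xs) h rewrite h (here refl) = firstOr-miss d xs (h ∘ there)

∈-filterᵇ⁺ : ∀ {A : Set} (P : A → Bool) {x xs} → x ∈ xs → P x ≡ true → x ∈ filterᵇ P xs
∈-filterᵇ⁺ P m e = ∈-filter⁺ _ m (true⇒T e)

∈-filterᵇ⁻ : ∀ {A : Set} (P : A → Bool) {x xs} → x ∈ filterᵇ P xs → x ∈ xs × P x ≡ true
∈-filterᵇ⁻ P {xs = xs} m with ∈-filter⁻ _ {xs = xs} m
... | a , b = a , T⇒true b

unique-map⁺ : ∀ {A B : Set} (f : A → B) xs → (∀ {x y} → x ∈ xs → y ∈ xs → f x ≡ f y → x ≡ y) →
              Unique xs → Unique (map f xs)
unique-map⁺ f []       inj u        = []
unique-map⁺ f (x ∷ xs) inj (px ∷ u) =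
  Allₚ.map⁺ (All.tabulate λ m e → All.lookup px m (inj (here refl) (there m) e))
  ∷ unique-map⁺ f xs (λ m m′ → inj (there m) (there m′)) u

-- Lists without repetition that have the same elements are permutations of each other. All
-- reindexings of sums, and the comparison of cycle counts of conjugates, go through this.
bijection⇒↭ : ∀ {A B : Set} {xs : List A} {ys : List B} (f : A → B) → Unique xs → Unique ys →
              (∀ {x} → x ∈ xs → f x ∈ ys) →
              (∀ {x y} → x ∈ xs → y ∈ xs → f x ≡ f y → x ≡ y) →
              (∀ {y} → y ∈ ys → ∃ λ x → x ∈ xs × f x ≡ y) → map f xs ↭ ys
bijection⇒↭ {xs = xs} {ys} f ux uy into inj onto =
  ∼bag⇒↭ (unique∧set⇒bag (unique-map⁺ f xs inj ux) uy (mk⇔ to from))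
  where
  to : ∀ {y} → y ∈ map f xs → y ∈ ys
  to m with ∈-map⁻ f m
  ... | _ , m′ , refl = into m′
  from : ∀ {y} → y ∈ ys → y ∈ map f xs
  from m with onto m
  ... | _ , m′ , refl = ∈-map⁺ f m′

-- Cycle counts of permutations of {0,…,n-1}

record IsPerm (n : ℕ) (π : ℕ → ℕ) : Set where
  constructor isPerm
  field
    bounded   : ∀ {i} → i < n → π i < n
    injective : ∀ {i j} → i < n → j < n → π i ≡ π j → i ≡ j

open IsPerm

iter-+ : ∀ π a b i → iter π (a + b) i ≡ iter π a (iter π b i)
iter-+ π zero    b i = refl
iter-+ π (suc a) b i = cong π (iter-+ π a b i)

iter-suc : ∀ π k i → iter π (suc k) i ≡ iter π k (π i)
iter-suc π zero    i = refl
iter-suc π (suc k) i = cong π (iter-suc π k i)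

iter-fix : ∀ π k {i} → π i ≡ i → iter π k i ≡ i
iter-fix π zero    e = refl
iter-fix π (suc k) e = trans (cong π (iter-fix π k e)) e

iter-cong : ∀ {n π ρ} → (∀ {i} → i < n → π i < n) → (∀ {i} → i < n → π i ≡ ρ i) →
            ∀ k {i} → i < n → iter π k i ≡ iter ρ k i × iter π k i < n
iter-cong b h zero    l = refl , l
iter-cong {ρ = ρ} b h (suc k) l with iter-cong {ρ = ρ} b h k l
... | e , l′ = trans (h l′) (cong ρ e) , b l′

module _ {n : ℕ} {π : ℕ → ℕ} (P : IsPerm n π) where

  iter-bounded : ∀ k {i} → i < n → iter π k i < n
  iter-bounded zero    l = l
  iter-bounded (suc k) l = bounded P (iter-bounded k l)

  iter-cancel : ∀ k {i j} → i < n → j < n → iter π k i ≡ iter π k j → i ≡ j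
  iter-cancel zero    li lj e = e
  iter-cancel (suc k) li lj e =
    iter-cancel k li lj (injective P (iter-bounded k li) (iter-bounded k lj) e)

  -- By the pigeonhole principle two of the iterates number 0 to `n` agree, and injectivity cancels
  -- the earlier one.
  period : ∀ {i} → i < n → ∃ λ q → q < n × iter π (suc q) i ≡ i
  period {i} l
    with Fin.pigeonhole (ℕ.n<1+n n) (λ k → fromℕ< (iter-bounded (toℕ k) l))
  ... | j , k , j<k , e = q , q<n , sym (iter-cancel (toℕ j) l (iter-bounded (suc q) l) e′)
    where
    q : ℕ
    q = toℕ k ∸ suc (toℕ j)
    k≡ : toℕ k ≡ toℕ j + suc q
    k≡ = trans (sym (ℕ.m+[n∸m]≡n j<k)) (sym (ℕ.+-suc (toℕ j) q))
    q<n : q < n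
    q<n = ℕ.≤-trans (ℕ.m≤n+m (suc q) (toℕ j)) (ℕ.≤-trans (ℕ.≤-reflexive (sym k≡)) (ℕ.≤-pred (Fin.toℕ<n k)))
    e′ : iter π (toℕ j) i ≡ iter π (toℕ j) (iter π (suc q) i)
    e′ = trans (Fin.fromℕ<-injective _ _ _ _ e)
         (trans (cong (λ z → iter π z i) k≡) (iter-+ π (toℕ j) (suc q) i))

  -- The Boolean tests `#cyc` and `sameCycle` inspect boundedly many iterates only; this brings an
  -- arbitrary iterate into their range.
  iter-reduce : ∀ k {i} → i < n → ∃ λ k′ → k′ < n × iter π k′ i ≡ iter π k i
  iter-reduce k {i} l with period l
  ... | q , q<n , e = go k (<-wellFounded k)
    where
    go : ∀ k → Acc _<_ k → ∃ λ k′ → k′ < n × iter π k′ i ≡ iter π k i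
    go k (acc rs) with ℕ.≤-<-connex k q
    ... | inj₁ k≤q = k , ℕ.≤-<-trans k≤q q<n , refl
    ... | inj₂ q<k with go (k ∸ suc q) (rs (ℕ.∸-monoʳ-< z<s q<k))
    ...   | k′ , l′ , e′ = k′ , l′ , trans e′
            (trans (cong (iter π (k ∸ suc q)) (sym e))
            (trans (sym (iter-+ π (k ∸ suc q) (suc q) i))
                   (cong (λ z → iter π z i) (ℕ.m∸n+n≡m q<k))))

  orbit-sym : ∀ k {i} → i < n → ∃ λ k′ → iter π k′ (iter π k i) ≡ i
  orbit-sym zero    l = 0 , refl
  orbit-sym (suc k) {i} l with orbit-sym k l | period (iter-bounded k l)
  ... | k′ , e | q , _ , e′ = k′ + q , (begin
    iter π (k′ + q) (π x)      ≡⟨ iter-+ π k′ q (π x) ⟩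
    iter π k′ (iter π q (π x)) ≡⟨ cong (iter π k′) (trans (sym (iter-suc π q x)) e′) ⟩
    iter π k′ x                ≡⟨ e ⟩
    i ∎)
    where
    open ≡-Reasoning
    x : ℕ
    x = iter π k i

  preimage : ∀ {i} → i < n → ∃ λ j → j < n × π j ≡ i
  preimage l with period l
  ... | q , _ , e = iter π q _ , iter-bounded q l , e

-- The test inside `#cyc` without its bound, so that permutations of sets of different sizes can be
-- compared.
Minimal : (ℕ → ℕ) → ℕ → Set
Minimal π i = ∀ k → i ≤ iter π k i

minimalᵇ : ℕ → (ℕ → ℕ) → ℕ → Bool
minimalᵇ n π i = all (λ k → not (iter π (suc k) i <ᵇ i)) (upTo n)

module _ {n : ℕ} {π : ℕ → ℕ} (P : IsPerm n π) where

  minimalᵇ⁺ : ∀ {i} → Minimal π i → minimalᵇ n π i ≡ true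
  minimalᵇ⁺ m = allUpTo⁺ {n = n} λ {k} _ → not-true⁺ (≮ᵇ⁺ (m (suc k)))

  minimalᵇ⁻ : ∀ {i} → i < n → minimalᵇ n π i ≡ true → Minimal π i
  minimalᵇ⁻ l h k with iter-reduce P k l
  ... | zero , _ , e = ℕ.≤-reflexive e
  ... | suc k′ , l′ , e =
    subst (_ ≤_) e (≮ᵇ⁻ (not-true⁻ (allUpTo⁻ {n = n} h (ℕ.<-trans (ℕ.n<1+n k′) l′))))

minimalᵇ-⇔ : ∀ {n m π ρ i} → IsPerm n π → IsPerm m ρ → i < n → i < m →
             (Minimal π i → Minimal ρ i) → (Minimal ρ i → Minimal π i) →
             minimalᵇ n π i ≡ minimalᵇ m ρ i
minimalᵇ-⇔ P R ln lm f g =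
  bool-iff (λ e → minimalᵇ⁺ R (f (minimalᵇ⁻ P ln e))) (λ e → minimalᵇ⁺ P (g (minimalᵇ⁻ R lm e)))

#cyc≤n : ∀ n π → #cyc n π ≤ n
#cyc≤n n π = subst (#cyc n π ≤_) (List.length-upTo n) (countB≤length _ (upTo n))

IsPerm-cong : ∀ {n π ρ} → (∀ {i} → i < n → π i ≡ ρ i) → IsPerm n π → IsPerm n ρ
IsPerm-cong h (isPerm b inj) = isPerm
  (λ l → subst (_< _) (h l) (b l))
  (λ li lj e → inj li lj (trans (h li) (trans e (sym (h lj)))))

IsPerm-∘ : ∀ {n π ρ} → IsPerm n π → IsPerm n ρ → IsPerm n (π ∘ₚ ρ)
IsPerm-∘ (isPerm b inj) (isPerm b′ inj′) =
  isPerm (b ∘ b′) (λ li lj e → inj′ li lj (inj (b′ li) (b′ lj) e))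

leftInverse⇒IsPerm : ∀ {n π} σ → (∀ {i} → i < n → π i < n) → (∀ {i} → i < n → σ (π i) ≡ i) → IsPerm n π
leftInverse⇒IsPerm σ b h = isPerm b (λ li lj e → trans (sym (h li)) (trans (cong σ e) (h lj)))

#cyc-cong : ∀ {n π ρ} → IsPerm n π → (∀ {i} → i < n → π i ≡ ρ i) → #cyc n π ≡ #cyc n ρ
#cyc-cong {n} {π} {ρ} P h = countB-cong (upTo n) λ m → let l = ∈-upTo⁻ m in
  minimalᵇ-⇔ P (IsPerm-cong h P) l l
    (λ f k → subst (_ ≤_) (proj₁ (iter-cong (bounded P) h k l)) (f k))
    (λ f k → subst (_ ≤_) (sym (proj₁ (iter-cong (bounded P) h k l))) (f k))

-- The permutation of {0,…,n-1} obtained from one of {0,…,n} by deleting n from its cycle.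
skip : ℕ → (ℕ → ℕ) → ℕ → ℕ
skip n π i = if π i ≡ᵇ n then π n else π i

module _ {n : ℕ} {π : ℕ → ℕ} (P : IsPerm (suc n) π) where

  private
    n<1+n : n < suc n
    n<1+n = ℕ.n<1+n n

    up : ∀ {i} → i < n → i < suc n
    up = ℕ.m<n⇒m<1+n

  skip-≡ : ∀ {i} → π i ≡ n → skip n π i ≡ π n
  skip-≡ e rewrite ≡ᵇ⁺ e = refl

  skip-≢ : ∀ {i} → π i ≢ n → skip n π i ≡ π i
  skip-≢ h rewrite ≢ᵇ⁺ h = refl

  private
    <n : ∀ {i} → i < suc n → i ≢ n → i < n
    <n l h = ℕ.≤∧≢⇒< (ℕ.≤-pred l) h

    notfix : ∀ {i} → i < n → π i ≡ n → π n ≢ n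
    notfix l e e′ = ℕ.<⇒≢ l (injective P (up l) n<1+n (trans e (sym e′)))

    skip-bounded : ∀ {i} → i < n → skip n π i < n
    skip-bounded {i} l with π i ℕ.≟ n
    ... | yes e = subst (_< n) (sym (skip-≡ e)) (<n (bounded P n<1+n) (notfix l e))
    ... | no h  = subst (_< n) (sym (skip-≢ h)) (<n (bounded P (up l)) h)

    skip-injective : ∀ {i j} → i < n → j < n → skip n π i ≡ skip n π j → i ≡ j
    skip-injective {i} {j} li lj e with π i ℕ.≟ n | π j ℕ.≟ n
    ... | yes a | yes b = injective P (up li) (up lj) (trans a (sym b))
    ... | yes a | no b  = ⊥-elim (ℕ.<⇒≢ lj (sym (injective P n<1+n (up lj)
                            (trans (sym (skip-≡ a)) (trans e (skip-≢ b))))))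
    ... | no a  | yes b = ⊥-elim (ℕ.<⇒≢ li (injective P (up li) n<1+n
                            (trans (sym (skip-≢ a)) (trans e (skip-≡ b)))))
    ... | no a  | no b  = injective P (up li) (up lj) (trans (sym (skip-≢ a)) (trans e (skip-≢ b)))

  IsPerm-skip : IsPerm n (skip n π)
  IsPerm-skip = isPerm skip-bounded skip-injective

  private
    fromSkip : ∀ k {i} → i < n → ∃ λ k′ → iter π k′ i ≡ iter (skip n π) k i
    fromSkip zero    l = 0 , refl
    fromSkip (suc k) {i} l with fromSkip k l | π (iter (skip n π) k i) ℕ.≟ n
    ... | k′ , e | yes q = suc (suc k′) , trans (cong π (trans (cong π e) q)) (sym (skip-≡ q))
    ... | k′ , e | no q  = suc k′ , trans (cong π e) (sym (skip-≢ q))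

    -- An orbit of `π` may stand on `n`, where the shortened orbit has no point. The second
    -- alternative then records the point from which `n` was entered.
    toSkip : ∀ k {i} → i < n →
             (∃ λ k′ → iter (skip n π) k′ i ≡ iter π k i) ⊎
             (iter π k i ≡ n × ∃ λ k′ → π (iter (skip n π) k′ i) ≡ n)
    toSkip zero    l = inj₁ (0 , refl)
    toSkip (suc k) {i} l with toSkip k l
    ... | inj₂ (e , k′ , q) = inj₁ (suc k′ , trans (skip-≡ q) (cong π (sym e)))
    ... | inj₁ (k′ , e) with π (iter (skip n π) k′ i) ℕ.≟ n
    ...   | yes q = inj₂ (trans (cong π (sym e)) q , k′ , q)
    ...   | no q  = inj₁ (suc k′ , trans (skip-≢ q) (cong π e))

    minimal-skip : ∀ {i} → i < n → minimalᵇ (suc n) π i ≡ minimalᵇ n (skip n π) i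
    minimal-skip {i} l = minimalᵇ-⇔ P IsPerm-skip (up l) l
      (λ m k → let k′ , e = fromSkip k l in subst (i ≤_) e (m k′)) back
      where
      back : Minimal (skip n π) i → Minimal π i
      back m k with toSkip k l
      ... | inj₁ (k′ , e) = subst (i ≤_) e (m k′)
      ... | inj₂ (e , _)  = subst (i ≤_) (sym e) (ℕ.<⇒≤ l)

    minimal-last : minimalᵇ (suc n) π n ≡ (π n ≡ᵇ n)
    minimal-last = bool-iff
      (λ h → ≡ᵇ⁺ (ℕ.≤-antisym (ℕ.≤-pred (bounded P n<1+n)) (minimalᵇ⁻ P n<1+n h 1)))
      (λ h → minimalᵇ⁺ P (λ k → ℕ.≤-reflexive (sym (iter-fix π k (≡ᵇ⁻ h)))))

  -- The point `n` is the least of its cycle only if it is fixed, so every other cycle keeps its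
  -- least element when `n` is taken out.
  #cyc-skip : #cyc (suc n) π ≡ #cyc n (skip n π) + 𝟙 (π n ≡ᵇ n)
  #cyc-skip = trans (countB-suc (minimalᵇ (suc n) π) n)
    (cong₂ _+_ (countB-cong (upTo n) (λ m → minimal-skip (∈-upTo⁻ m))) (cong 𝟙 minimal-last))

-- Cycles of inverses and conjugates

module _ {n : ℕ} {π σ : ℕ → ℕ} (P : IsPerm n π) (S : IsPerm n σ) (σπ : ∀ {i} → i < n → σ (π i) ≡ i) where

  rightInverse : ∀ {i} → i < n → π (σ i) ≡ i
  rightInverse l with preimage P l
  ... | j , lj , refl = cong π (σπ lj)

  private
    -- If `x` returns to itself after `q + 1` steps of `π`, then `σ x` is the point reached after
    -- `q` steps. Hence orbits of the inverse stay inside those of `π`.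
    inverse-iter : ∀ k {i} → i < n → ∃ λ k′ → iter π k′ i ≡ iter σ k i
    inverse-iter zero    l = 0 , refl
    inverse-iter (suc k) {i} l with inverse-iter k l
    ... | k′ , e with period P (iter-bounded S k l)
    ...   | q , _ , e′ = q + k′ , (begin
      iter π (q + k′) i        ≡⟨ iter-+ π q k′ i ⟩
      iter π q (iter π k′ i)   ≡⟨ cong (iter π q) e ⟩
      iter π q x               ≡⟨ σπ (iter-bounded P q (iter-bounded S k l)) ⟨
      σ (iter π (suc q) x)     ≡⟨ cong σ e′ ⟩
      σ x ∎)
      where
      open ≡-Reasoning
      x : ℕ
      x = iter σ k i

  minimal-inverse : ∀ {i} → i < n → Minimal π i → Minimal σ i
  minimal-inverse l m k with inverse-iter k l
  ... | k′ , e = subst (_ ≤_) e (m k′)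

#cyc-inverse : ∀ {n π σ} → IsPerm n π → IsPerm n σ → (∀ {i} → i < n → σ (π i) ≡ i) → #cyc n π ≡ #cyc n σ
#cyc-inverse {n} P S h = countB-cong (upTo n) λ m → let l = ∈-upTo⁻ m in
  minimalᵇ-⇔ P S l l (minimal-inverse P S h l) (minimal-inverse S P (rightInverse P S h) l)

module _ {n : ℕ} {π : ℕ → ℕ} (P : IsPerm n π) where

  private
    inv-spec : ∀ {j} → j < n → π (inv n π j) ≡ j × inv n π j < n
    inv-spec {j} l with preimage P l
    ... | i , li , e with firstOr-hit j (upTo n) (∈-upTo⁺ li) (≡ᵇ⁺ e)
    ...   | q , m = ≡ᵇ⁻ q , ∈-upTo⁻ m

  inv-rightInverse : ∀ {j} → j < n → π (inv n π j) ≡ j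
  inv-rightInverse l = proj₁ (inv-spec l)

  inv-leftInverse : ∀ {i} → i < n → inv n π (π i) ≡ i
  inv-leftInverse l with inv-spec (bounded P l)
  ... | q , l′ = injective P l′ l q

  IsPerm-inv : IsPerm n (inv n π)
  IsPerm-inv = leftInverse⇒IsPerm π (λ l → proj₂ (inv-spec l)) inv-rightInverse

  inv-unique : ∀ (σ : ℕ → ℕ) → (∀ {i} → i < n → σ i < n) → (∀ {i} → i < n → π (σ i) ≡ i) →
               ∀ {i} → i < n → inv n π i ≡ σ i
  inv-unique σ b h l = trans (cong (inv n π) (sym (h l))) (inv-leftInverse (b l))

module _ {n : ℕ} {π : ℕ → ℕ} (P : IsPerm n π) where

  private
    findMinimal : ∀ {i} → i < n → Acc _<_ i → ∃ λ k → minimalᵇ n π (iter π k i) ≡ true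
    findMinimal {i} l (acc rs) with minimalᵇ n π i in e
    ... | true  = 0 , e
    ... | false with allUpTo-false⁻ {n = n} e
    ...   | k , _ , h with findMinimal (iter-bounded P (suc k) l) (rs (<ᵇ⁻ (not-false h)))
      where
      not-false : ∀ {b} → not b ≡ false → b ≡ true
      not-false {true} _ = refl
    ...     | k′ , q = k′ + suc k , subst (λ z → minimalᵇ n π z ≡ true) (sym (iter-+ π k′ (suc k) i)) q

  minimalIterate : ∀ {i} → i < n → ∃ λ k → minimalᵇ n π (iter π k i) ≡ true
  minimalIterate l = findMinimal l (<-wellFounded _)

  minimal-unique : ∀ {i j} → i < n → j < n → minimalᵇ n π i ≡ true → minimalᵇ n π j ≡ true →
                   ∀ k → iter π k i ≡ j → i ≡ j
  minimal-unique li lj mi mj k refl with orbit-sym P k li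
  ... | k′ , e = ℕ.≤-antisym (minimalᵇ⁻ P li mi k) (subst (_ ≤_) e (minimalᵇ⁻ P lj mj k′))

module _ {n : ℕ} {π ρ σ : ℕ → ℕ} (P : IsPerm n π) (R : IsPerm n ρ) (S : IsPerm n σ)
         (comm : ∀ {i} → i < n → ρ (σ i) ≡ σ (π i)) where

  private
    iter-comm : ∀ k {i} → i < n → iter ρ k (σ i) ≡ σ (iter π k i)
    iter-comm zero    l = refl
    iter-comm (suc k) l = trans (cong ρ (iter-comm k l)) (comm (iter-bounded P k l))

    -- The number of steps of `ρ` from `σ i` to the least element of its cycle, so that `f` below
    -- sends the representative of a cycle of `π` to that of the corresponding cycle of `ρ`.
    k₀ : ℕ → ℕ
    k₀ i with i ℕ.<? n
    ... | yes l = proj₁ (minimalIterate R (bounded S l))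
    ... | no _  = 0

    f : ℕ → ℕ
    f i = iter ρ (k₀ i) (σ i)

    f-minimal : ∀ {i} → i < n → minimalᵇ n ρ (f i) ≡ true
    f-minimal {i} l with i ℕ.<? n
    ... | yes l′ = proj₂ (minimalIterate R (bounded S l′))
    ... | no h   = ⊥-elim (h l)

    reps : (ℕ → ℕ) → List ℕ
    reps π = filterᵇ (minimalᵇ n π) (upTo n)

    reps⁻ : ∀ π {i} → i ∈ reps π → i < n × minimalᵇ n π i ≡ true
    reps⁻ π m with ∈-filterᵇ⁻ (minimalᵇ n π) m
    ... | a , b = ∈-upTo⁻ a , b

    f-injective : ∀ {i j} → i ∈ reps π → j ∈ reps π → f i ≡ f j → i ≡ j
    f-injective {i} {j} mi mj e with reps⁻ π mi | reps⁻ π mj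
    ... | li , ri | lj , rj with orbit-sym P (k₀ j) lj
    ...   | k , q = minimal-unique P li lj ri rj (k + k₀ i) (begin
      iter π (k + k₀ i) i         ≡⟨ iter-+ π k (k₀ i) i ⟩
      iter π k (iter π (k₀ i) i)  ≡⟨ cong (iter π k) (injective S (iter-bounded P (k₀ i) li) (iter-bounded P (k₀ j) lj)
                                     (trans (sym (iter-comm (k₀ i) li)) (trans e (iter-comm (k₀ j) lj)))) ⟩
      iter π k (iter π (k₀ j) j)  ≡⟨ q ⟩
      j ∎)
      where open ≡-Reasoning

    f-onto : ∀ {j} → j ∈ reps ρ → ∃ λ i → i ∈ reps π × f i ≡ j
    f-onto {j} m with reps⁻ ρ m
    ... | lj , rj with preimage S lj
    ...   | i , li , refl with minimalIterate P li
    ...     | k , r = iter π k i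
                    , ∈-filterᵇ⁺ (minimalᵇ n π) (∈-upTo⁺ lx) r
                    , sym (minimal-unique R lj (iter-bounded R (k₀ (iter π k i)) (bounded S lx)) rj (f-minimal lx)
                            (k₀ (iter π k i) + k) step)
      where
      lx : iter π k i < n
      lx = iter-bounded P k li
      step : iter ρ (k₀ (iter π k i) + k) (σ i) ≡ f (iter π k i)
      step = trans (iter-+ ρ (k₀ (iter π k i)) k (σ i)) (cong (iter ρ (k₀ (iter π k i))) (iter-comm k li))

  #cyc-conjugate : #cyc n π ≡ #cyc n ρ
  #cyc-conjugate = begin
    #cyc n π                 ≡⟨ countB≡length-filterᵇ (minimalᵇ n π) (upTo n) ⟩
    length (reps π)          ≡⟨ List.length-map f (reps π) ⟨
    length (map f (reps π))  ≡⟨ ↭-length (bijection⇒↭ f (Unique.filter⁺ _ (Unique.upTo⁺ n))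
                                  (Unique.filter⁺ _ (Unique.upTo⁺ n)) f-into f-injective f-onto) ⟩
    length (reps ρ)          ≡⟨ countB≡length-filterᵇ (minimalᵇ n ρ) (upTo n) ⟨
    #cyc n ρ ∎
    where
    open ≡-Reasoning
    f-into : ∀ {i} → i ∈ reps π → f i ∈ reps ρ
    f-into m with reps⁻ π m
    ... | l , _ = ∈-filterᵇ⁺ (minimalᵇ n ρ) (∈-upTo⁺ (iter-bounded R (k₀ _) (bounded S l))) (f-minimal l)

module _ {n : ℕ} {π ρ σ : ℕ → ℕ} (P : IsPerm n π) (R : IsPerm n ρ) (S : IsPerm n σ)
         (h : ∀ {i} → i < n → ρ (σ (π i)) ≡ σ i) where

  -- The hypothesis says that `ρ` is the conjugate by `σ` of the inverse of `π`, and inversion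
  -- preserves cycles. In this form nothing has to be inverted in order to check it.
  #cyc-conjugate-inverse : #cyc n π ≡ #cyc n ρ
  #cyc-conjugate-inverse = trans (#cyc-inverse P (IsPerm-inv P) (inv-leftInverse P))
    (#cyc-conjugate (IsPerm-inv P) R S λ {i} l →
      trans (cong (ρ ∘ σ) (sym (inv-rightInverse P l))) (h (bounded (IsPerm-inv P) l)))

-- Lists as functions, and non-crossing partitions as trees

at-++ˡ : ∀ xs {ys i} → i < length xs → at (xs ++ ys) i ≡ at xs i
at-++ˡ (x ∷ xs) {i = zero}  l       = refl
at-++ˡ (x ∷ xs) {i = suc i} (s≤s l) = at-++ˡ xs l

at-++ʳ : ∀ xs {ys} i → at (xs ++ ys) (length xs + i) ≡ at ys i
at-++ʳ []       i = refl
at-++ʳ (x ∷ xs) i = at-++ʳ xs i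

at-map : ∀ (f : ℕ → ℕ) xs {i} → i < length xs → at (map f xs) i ≡ f (at xs i)
at-map f (x ∷ xs) {zero}  l       = refl
at-map f (x ∷ xs) {suc i} (s≤s l) = at-map f xs l

at-All : ∀ {Q : ℕ → Set} {xs} → All Q xs → ∀ {i} → i < length xs → Q (at xs i)
at-All (q ∷ qs) {zero}  l       = q
at-All (q ∷ qs) {suc i} (s≤s l) = at-All qs l

at-∷ʳ-last : ∀ xs {x n} → length xs ≡ n → at (xs ∷ʳ x) n ≡ x
at-∷ʳ-last []       refl = refl
at-∷ʳ-last (y ∷ xs) refl = at-∷ʳ-last xs refl

-- A tree is a list of trees, the last element being split off by node. As a partition of an
-- interval it lists the blocks that are not nested in other blocks, and a block
-- with k elements is itself the list of the partitions of its k-1 gaps.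
data Tree : Set where
  leaf : Tree
  node : Tree → Tree → Tree

size : Tree → ℕ
size leaf       = 0
size (node L R) = suc (size L + size R)

-- One-line notation of the permutation of a tree, and of its inverse. The permutation of the last
-- outer block R, with its nested blocks, is map suc (inverse R) ++ [ 0 ].
perm inverse : Tree → List ℕ
perm leaf       = []
perm (node L R) = perm L ++ map (size L +_) (map suc (inverse R) ++ [ 0 ])
inverse leaf       = []
inverse (node L R) = inverse L ++ (size L + size R) ∷ map (size L +_) (perm R)

length-perm : ∀ t → length (perm t) ≡ size t
length-inverse : ∀ t → length (inverse t) ≡ size t
length-perm leaf       = refl
length-perm (node L R)
  rewrite List.length-++ (perm L) {map (size L +_) (map suc (inverse R) ++ [ 0 ])} | length-perm L
        | List.length-map (size L +_) (map suc (inverse R) ++ [ 0 ])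
        | List.length-++ (map suc (inverse R)) {[ 0 ]} | List.length-map suc (inverse R) | length-inverse R
        | ℕ.+-comm (size R) 1 = ℕ.+-suc (size L) (size R)
length-inverse leaf       = refl
length-inverse (node L R)
  rewrite List.length-++ (inverse L) {(size L + size R) ∷ map (size L +_) (perm R)} | length-inverse L
        | List.length-map (size L +_) (perm R) | length-perm R = ℕ.+-suc (size L) (size R)

module _ (L R : Tree) where

  perm-left : ∀ {i} → i < size L → at (perm (node L R)) i ≡ at (perm L) i
  perm-left l = at-++ˡ (perm L) (subst (_ <_) (sym (length-perm L)) l)

  private
    perm-right : ∀ j → at (perm (node L R)) (size L + j) ≡ at (map (size L +_) (map suc (inverse R) ++ [ 0 ])) j
    perm-right j = trans (cong (λ z → at (perm (node L R)) (z + j)) (sym (length-perm L))) (at-++ʳ (perm L) j)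

    length-block : length (map suc (inverse R) ++ [ 0 ]) ≡ suc (size R)
    length-block = trans (List.length-++ (map suc (inverse R)))
      (trans (cong (_+ 1) (trans (List.length-map suc (inverse R)) (length-inverse R))) (ℕ.+-comm (size R) 1))

  perm-mid : ∀ {j} → j < size R → at (perm (node L R)) (size L + j) ≡ size L + suc (at (inverse R) j)
  perm-mid {j} l = trans (perm-right j)
    (trans (at-map (size L +_) (map suc (inverse R) ++ [ 0 ]) (subst (j <_) (sym length-block) (ℕ.m<n⇒m<1+n l)))
    (cong (size L +_) (trans (at-++ˡ (map suc (inverse R)) (subst (j <_) (sym (List.length-map suc (inverse R))) l′))
                             (at-map suc (inverse R) l′))))
    where
    l′ : j < length (inverse R)
    l′ = subst (j <_) (sym (length-inverse R)) l

  perm-last : at (perm (node L R)) (size L + size R) ≡ size L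
  perm-last = trans (perm-right (size R))
    (trans (at-map (size L +_) (map suc (inverse R) ++ [ 0 ]) (subst (size R <_) (sym length-block) (ℕ.n<1+n _)))
    (trans (cong (size L +_) (at-∷ʳ-last (map suc (inverse R)) (trans (List.length-map suc (inverse R)) (length-inverse R))))
           (ℕ.+-identityʳ (size L))))

  inverse-left : ∀ {i} → i < size L → at (inverse (node L R)) i ≡ at (inverse L) i
  inverse-left l = at-++ˡ (inverse L) (subst (_ <_) (sym (length-inverse L)) l)

  private
    inverse-right : ∀ j → at (inverse (node L R)) (size L + j) ≡ at ((size L + size R) ∷ map (size L +_) (perm R)) j
    inverse-right j = trans (cong (λ z → at (inverse (node L R)) (z + j)) (sym (length-inverse L))) (at-++ʳ (inverse L) j)

  inverse-first : at (inverse (node L R)) (size L) ≡ size L + size R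
  inverse-first = trans (cong (at (inverse (node L R))) (sym (ℕ.+-identityʳ (size L)))) (inverse-right 0)

  inverse-mid : ∀ {j} → j < size R → at (inverse (node L R)) (size L + suc j) ≡ size L + at (perm R) j
  inverse-mid {j} l = trans (inverse-right (suc j)) (at-map (size L +_) (perm R) (subst (j <_) (sym (length-perm R)) l))

-- The exceptional entry of the outer block of `node L R` sits at its last position in `perm` and at
-- its first in `inverse`, hence two views of the same range.
data ViewLast (a b : ℕ) : ℕ → Set where
  inLeft  : ∀ {i} → i < a → ViewLast a b i
  inRight : ∀ {j} → j < b → ViewLast a b (a + j)
  isLast  : ViewLast a b (a + b)

viewLast : ∀ a b {i} → i < suc (a + b) → ViewLast a b i
viewLast a b {i} l with i ℕ.<? a
... | yes h = inLeft h
... | no h with i ∸ a ℕ.<? b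
...   | yes h′ = subst (ViewLast a b) (ℕ.m+[n∸m]≡n (ℕ.≮⇒≥ h)) (inRight h′)
...   | no h′  = subst (ViewLast a b) (ℕ.≤-antisym
                   (ℕ.≤-trans (ℕ.+-monoʳ-≤ a (ℕ.≮⇒≥ h′)) (ℕ.≤-reflexive (ℕ.m+[n∸m]≡n (ℕ.≮⇒≥ h))))
                   (ℕ.≤-pred l)) isLast

data ViewFirst (a b : ℕ) : ℕ → Set where
  inLeft  : ∀ {i} → i < a → ViewFirst a b i
  isFirst : ViewFirst a b a
  inRight : ∀ {j} → j < b → ViewFirst a b (a + suc j)

viewFirst : ∀ a b {i} → i < suc (a + b) → ViewFirst a b i
viewFirst a b {i} l with ℕ.<-cmp i a
... | tri< h _ _ = inLeft h
... | tri≈ _ refl _ = isFirst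
... | tri> _ _ h = subst (ViewFirst a b) (trans (ℕ.+-suc a _) (ℕ.m+[n∸m]≡n h))
                     (inRight (ℕ.+-cancelˡ-< a _ _ (ℕ.≤-pred (subst (_< suc (a + b))
                       (sym (trans (sym (ℕ.+-suc a _)) (trans (ℕ.+-suc a _) (ℕ.m+[n∸m]≡n h)))) l))))

<-left : ∀ {i a} b → i < a → i < suc (a + b)
<-left b l = ℕ.m<n⇒m<1+n (ℕ.<-≤-trans l (ℕ.m≤m+n _ b))

<-right : ∀ a {j b} → j < b → a + suc j < suc (a + b)
<-right a l = s≤s (ℕ.+-monoʳ-≤ a l)

<-right′ : ∀ a {j b} → j < b → a + j < suc (a + b)
<-right′ a l = ℕ.m<n⇒m<1+n (ℕ.+-monoʳ-< a l)

perm-bounded : ∀ t {i} → i < size t → at (perm t) i < size t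
inverse-bounded : ∀ t {i} → i < size t → at (inverse t) i < size t
perm-bounded (node L R) l with viewLast (size L) (size R) l
... | inLeft h  rewrite perm-left L R h = <-left (size R) (perm-bounded L h)
... | inRight h rewrite perm-mid L R h = <-right (size L) (inverse-bounded R h)
... | isLast    rewrite perm-last L R = s≤s (ℕ.m≤m+n (size L) (size R))
inverse-bounded (node L R) l with viewFirst (size L) (size R) l
... | inLeft h  rewrite inverse-left L R h = <-left (size R) (inverse-bounded L h)
... | isFirst   rewrite inverse-first L R = ℕ.n<1+n _
... | inRight h rewrite inverse-mid L R h = <-right′ (size L) (perm-bounded R h)

inverse-perm : ∀ t {i} → i < size t → at (inverse t) (at (perm t) i) ≡ i
perm-inverse : ∀ t {i} → i < size t → at (perm t) (at (inverse t) i) ≡ i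
inverse-perm (node L R) l with viewLast (size L) (size R) l
... | inLeft h  rewrite perm-left L R h | inverse-left L R (perm-bounded L h) = inverse-perm L h
... | inRight h rewrite perm-mid L R h | inverse-mid L R (inverse-bounded R h) = cong (size L +_) (perm-inverse R h)
... | isLast    rewrite perm-last L R = inverse-first L R
perm-inverse (node L R) l with viewFirst (size L) (size R) l
... | inLeft h  rewrite inverse-left L R h | perm-left L R (inverse-bounded L h) = perm-inverse L h
... | isFirst   rewrite inverse-first L R = perm-last L R
... | inRight h rewrite inverse-mid L R h | perm-mid L R (perm-bounded R h) = cong (λ z → size L + suc z) (inverse-perm R h)

IsPerm-perm : ∀ t → IsPerm (size t) (at (perm t))
IsPerm-perm t = leftInverse⇒IsPerm (at (inverse t)) (perm-bounded t) (inverse-perm t)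

IsPerm-inverse : ∀ t → IsPerm (size t) (at (inverse t))
IsPerm-inverse t = leftInverse⇒IsPerm (at (perm t)) (inverse-bounded t) (perm-inverse t)

-- Concatenation of trees and the Kreweras complement

infixl 5 _⧺_

_⧺_ : Tree → Tree → Tree
X ⧺ leaf     = X
X ⧺ node L R = node (X ⧺ L) R

leaf-⧺ : ∀ X → leaf ⧺ X ≡ X
leaf-⧺ leaf       = refl
leaf-⧺ (node L R) = cong (λ z → node z R) (leaf-⧺ L)

size-⧺ : ∀ X Y → size (X ⧺ Y) ≡ size X + size Y
size-⧺ X leaf       = sym (ℕ.+-identityʳ (size X))
size-⧺ X (node L R) = begin
  suc (size (X ⧺ L) + size R)       ≡⟨ cong (λ z → suc (z + size R)) (size-⧺ X L) ⟩
  suc (size X + size L + size R)    ≡⟨ cong suc (ℕ.+-assoc (size X) (size L) (size R)) ⟩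
  suc (size X + (size L + size R))  ≡⟨ ℕ.+-suc (size X) _ ⟨
  size X + suc (size L + size R) ∎
  where open ≡-Reasoning

map-+-assoc : ∀ a b xs → map (a + b +_) xs ≡ map (a +_) (map (b +_) xs)
map-+-assoc a b xs = trans (List.map-cong (ℕ.+-assoc a b) xs) (List.map-∘ xs)

perm-⧺ : ∀ X Y → perm (X ⧺ Y) ≡ perm X ++ map (size X +_) (perm Y)
perm-⧺ X leaf       = sym (List.++-identityʳ (perm X))
perm-⧺ X (node L R)
  rewrite perm-⧺ X L | size-⧺ X L | map-+-assoc (size X) (size L) (map suc (inverse R) ++ [ 0 ])
        | List.map-++ (size X +_) (perm L) (map (size L +_) (map suc (inverse R) ++ [ 0 ]))
  = List.++-assoc (perm X) _ _

inverse-⧺ : ∀ X Y → inverse (X ⧺ Y) ≡ inverse X ++ map (size X +_) (inverse Y)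
inverse-⧺ X leaf       = sym (List.++-identityʳ (inverse X))
inverse-⧺ X (node L R)
  rewrite inverse-⧺ X L | size-⧺ X L | map-+-assoc (size X) (size L) (perm R)
        | List.map-++ (size X +_) (inverse L) ((size L + size R) ∷ map (size L +_) (perm R))
        | ℕ.+-assoc (size X) (size L) (size R)
  = List.++-assoc (inverse X) _ _

-- For lists of trees this is `_∷_`, while `node` is `_∷ʳ_`.
cons : Tree → Tree → Tree
cons u leaf       = node leaf u
cons u (node L R) = node (cons u L) R

cons-⧺ : ∀ u X Y → cons u X ⧺ Y ≡ cons u (X ⧺ Y)
cons-⧺ u X leaf       = refl
cons-⧺ u X (node L R) = cong (λ z → node z R) (cons-⧺ u X L)

size-cons : ∀ u v → size (cons u v) ≡ suc (size u + size v)
size-cons u leaf       = cong suc (sym (ℕ.+-identityʳ (size u)))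
size-cons u (node L R) = cong suc (begin
  size (cons u L) + size R        ≡⟨ cong (_+ size R) (size-cons u L) ⟩
  suc (size u + size L + size R)  ≡⟨ cong suc (ℕ.+-assoc (size u) (size L) (size R)) ⟩
  suc (size u + (size L + size R)) ≡⟨ ℕ.+-suc (size u) _ ⟨
  size u + suc (size L + size R) ∎)
  where open ≡-Reasoning

perm-cons : ∀ u v → perm (cons u v) ≡ (map suc (inverse u) ++ [ 0 ]) ++ map (suc (size u) +_) (perm v)
perm-cons u leaf       = trans (List.map-id _) (sym (List.++-identityʳ _))
perm-cons u (node L R)
  rewrite perm-cons u L | size-cons u L
        | map-+-assoc (suc (size u)) (size L) (map suc (inverse R) ++ [ 0 ])
        | List.map-++ (suc (size u) +_) (perm L) (map (size L +_) (map suc (inverse R) ++ [ 0 ]))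
  = List.++-assoc (map suc (inverse u) ++ [ 0 ]) _ _

module _ (u v : Tree) where

  private
    n : ℕ
    n = suc (size u + size v)

    length-block : length (map suc (inverse u) ++ [ 0 ]) ≡ suc (size u)
    length-block = trans (List.length-++ (map suc (inverse u)))
      (trans (cong (_+ 1) (trans (List.length-map suc (inverse u)) (length-inverse u))) (ℕ.+-comm (size u) 1))

    at-cons : ∀ {i} → i < suc (size u) → at (perm (cons u v)) i ≡ at (map suc (inverse u) ++ [ 0 ]) i
    at-cons {i} l = trans (cong (λ z → at z i) (perm-cons u v))
      (at-++ˡ (map suc (inverse u) ++ [ 0 ]) (subst (i <_) (sym length-block) l))

  cons-left : ∀ {i} → i < size u → at (perm (cons u v)) i ≡ suc (at (inverse u) i)
  cons-left {i} l = trans (at-cons (ℕ.m<n⇒m<1+n l))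
    (trans (at-++ˡ (map suc (inverse u)) (subst (i <_) (sym (List.length-map suc (inverse u))) l′))
           (at-map suc (inverse u) l′))
    where
    l′ : i < length (inverse u)
    l′ = subst (i <_) (sym (length-inverse u)) l

  cons-mid : at (perm (cons u v)) (size u) ≡ 0
  cons-mid = trans (at-cons (ℕ.n<1+n _))
    (at-∷ʳ-last (map suc (inverse u)) (trans (List.length-map suc (inverse u)) (length-inverse u)))

  cons-right : ∀ {j} → j < size v → at (perm (cons u v)) (size u + suc j) ≡ size u + suc (at (perm v) j)
  cons-right {j} l = begin
    at (perm (cons u v)) (size u + suc j)
      ≡⟨ cong₂ at (perm-cons u v) (trans (ℕ.+-suc (size u) j) (cong (_+ j) (sym length-block))) ⟩
    at (block ++ map (suc (size u) +_) (perm v)) (length block + j)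
      ≡⟨ at-++ʳ block j ⟩
    at (map (suc (size u) +_) (perm v)) j
      ≡⟨ at-map (suc (size u) +_) (perm v) (subst (j <_) (sym (length-perm v)) l) ⟩
    suc (size u) + at (perm v) j
      ≡⟨ ℕ.+-suc (size u) _ ⟨
    size u + suc (at (perm v) j) ∎
    where
    open ≡-Reasoning
    block : List ℕ
    block = map suc (inverse u) ++ [ 0 ]

  γ-suc : ∀ {i} → suc i < n → γ n i ≡ suc i
  γ-suc l rewrite <ᵇ⁺ l = refl

  γ-last : γ n (size u + size v) ≡ 0
  γ-last rewrite ≮ᵇ⁺ {n} {n} ℕ.≤-refl = refl

  -- Kr (perm (cons u v)) = perm (node u v): in the cyclic sequence of all nested blocks and gaps,
  -- taking the Kreweras complement rotates the first bracket to the end.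
  kreweras : ∀ {i} → i < n → at (perm (cons u v)) (at (perm (node u v)) i) ≡ γ n i
  kreweras l with viewLast (size u) (size v) l
  ... | inLeft h  rewrite perm-left u v h | cons-left (perm-bounded u h) | inverse-perm u h
                = sym (γ-suc (s≤s (ℕ.<-≤-trans h (ℕ.m≤m+n _ _))))
  ... | inRight h rewrite perm-mid u v h | cons-right (inverse-bounded v h) | perm-inverse v h
                = trans (ℕ.+-suc (size u) _) (sym (γ-suc (s≤s (ℕ.+-monoʳ-< (size u) h))))
  ... | isLast    rewrite perm-last u v = trans cons-mid (sym γ-last)

-- Removing the last element

-- The effect of `skip` on one-line notation: the last entry `w` is dropped and written in the place
-- of the entry `n`.
replace : ℕ → ℕ → ℕ → ℕ
replace n w v = if v ≡ᵇ n then w else v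

replace-hit : ∀ {n} w {v} → v ≡ n → replace n w v ≡ w
replace-hit w e rewrite ≡ᵇ⁺ e = refl

replace-miss : ∀ {n} w {v} → v < n → replace n w v ≡ v
replace-miss w l rewrite ≢ᵇ⁺ (ℕ.<⇒≢ l) = refl

replace-self : ∀ n v → replace n n v ≡ v
replace-self n v with v ≡ᵇ n in e
... | true  = sym (≡ᵇ⁻ e)
... | false = refl

map-replace-miss : ∀ {n} w {xs} → All (_< n) xs → map (replace n w) xs ≡ xs
map-replace-miss w h = List.map-id-local (All.map (replace-miss w) h)

at-bounded⇒All : ∀ {k} xs → (∀ {i} → i < length xs → at xs i < k) → All (_< k) xs
at-bounded⇒All []       h = []
at-bounded⇒All (x ∷ xs) h = h z<s ∷ at-bounded⇒All xs (h ∘ s<s)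

All-perm : ∀ t → All (_< size t) (perm t)
All-perm t = at-bounded⇒All (perm t) (λ l → perm-bounded t (subst (_ <_) (length-perm t) l))

All-inverse : ∀ t → All (_< size t) (inverse t)
All-inverse t = at-bounded⇒All (inverse t) (λ l → inverse-bounded t (subst (_ <_) (length-inverse t) l))

All-map-+ : ∀ a {b k xs} → a + b ≤ k → All (_< b) xs → All (_< k) (map (a +_) xs)
All-map-+ a h qs = Allₚ.map⁺ (All.map (λ l → ℕ.<-≤-trans (ℕ.+-monoʳ-< a l) h) qs)

All-weaken : ∀ {b k} {xs : List ℕ} → b ≤ k → All (_< b) xs → All (_< k) xs
All-weaken h = All.map (λ l → ℕ.<-≤-trans l h)

skip-at : ∀ {n} xs {z} → length xs ≡ n → ∀ {i} → i < n →
          skip n (at (xs ++ [ z ])) i ≡ at (map (replace n z) xs) i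
skip-at {n} xs {z} refl {i} l
  rewrite at-++ˡ xs {[ z ]} l | at-∷ʳ-last xs {z} refl = sym (at-map (replace n z) xs l)

transpose : ℕ → ℕ → ℕ
transpose m i = if i ≡ᵇ m then suc m else (if i ≡ᵇ suc m then m else i)

transpose-m : ∀ m → transpose m m ≡ suc m
transpose-m m rewrite ≡ᵇ⁺ {m} refl = refl

transpose-suc : ∀ m → transpose m (suc m) ≡ m
transpose-suc m rewrite ≢ᵇ⁺ (ℕ.1+n≢n {m}) | ≡ᵇ⁺ {m} refl = refl

transpose-< : ∀ {m i} → i < m → transpose m i ≡ i
transpose-< l rewrite ≢ᵇ⁺ (ℕ.<⇒≢ l) | ≢ᵇ⁺ (ℕ.<⇒≢ (ℕ.m<n⇒m<1+n l)) = refl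

-- The transposition exchanges the last two entries `w` and `z`, so it is now `w` that is dropped
-- and written in the place of the greatest value.
skip-transpose-at : ∀ {m} xs {w z} → length xs ≡ m → ∀ {i} → i < suc m →
  skip (suc m) (at (xs ++ w ∷ z ∷ []) ∘ transpose m) i ≡ at (map (replace (suc m) w) (xs ++ [ z ])) i
skip-transpose-at {m} xs {w} {z} refl {i} l
  rewrite transpose-suc m | trans (cong (at (xs ++ w ∷ z ∷ [])) (sym (ℕ.+-identityʳ m))) (at-++ʳ xs {w ∷ z ∷ []} 0)
  with i ℕ.≟ m
... | yes refl rewrite transpose-m m
                     | trans (cong (at (xs ++ w ∷ z ∷ [])) (ℕ.+-comm 1 m)) (at-++ʳ xs {w ∷ z ∷ []} 1)
                     | List.map-++ (replace (suc m) w) xs [ z ]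
                     = sym (at-∷ʳ-last (map (replace (suc m) w) xs) (List.length-map _ xs))
... | no h with ℕ.≤∧≢⇒< (ℕ.≤-pred l) h
...   | l′ rewrite transpose-< l′ | at-++ˡ xs {w ∷ z ∷ []} l′ | List.map-++ (replace (suc m) w) xs [ z ]
                 | at-++ˡ (map (replace (suc m) w) xs) {map (replace (suc m) w) [ z ]}
                     (subst (i <_) (sym (List.length-map (replace (suc m) w) xs)) l′)
                 = sym (at-map (replace (suc m) w) xs l′)

-- The tree of the partition without its last element x, and the tree of the partition in which,
-- before x is deleted, the permutation is composed with the transposition of x-1 and x.
delete merge : Tree → Tree
delete leaf                = leaf
delete (node L leaf)       = L
-- Without its last element the outer block no longer covers its last gap `r`, whose blocks become
-- outer ones.
delete (node L (node R r)) = node L R ⧺ r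
merge leaf                             = leaf
merge (node L leaf)                    = L
merge (node L (node R leaf))           = node L R
-- The last two elements lie in different blocks, the outer one and the last block `r₂` of its last
-- gap. The transposition joins the two cycles: `r₁` becomes a gap, and the gaps of `r₂` follow it.
merge (node L (node R (node r₁ r₂)))   = node L (node R r₁ ⧺ r₂)

-- Whether the removed element is a fixed point at the moment of removal: for `delete` it is a
-- singleton block, for `merge` its predecessor lies next to it in the same block.
deleteFixed mergeFixed : Tree → Bool
deleteFixed (node L leaf) = true
deleteFixed _             = false
mergeFixed (node L (node R leaf)) = true
mergeFixed _                      = false

private
  init : Tree → List ℕ
  init leaf       = []
  init (node L R) = perm L ++ map (size L +_) (map suc (inverse R))

  perm-init : ∀ L R → perm (node L R) ≡ init (node L R) ++ [ size L ]
  perm-init L R = begin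
    perm L ++ map (size L +_) (map suc (inverse R) ++ [ 0 ])
      ≡⟨ cong (perm L ++_) (List.map-++ (size L +_) (map suc (inverse R)) [ 0 ]) ⟩
    perm L ++ map (size L +_) (map suc (inverse R)) ++ [ size L + 0 ]
      ≡⟨ List.++-assoc (perm L) _ _ ⟨
    init (node L R) ++ [ size L + 0 ]
      ≡⟨ cong (λ z → init (node L R) ++ [ z ]) (ℕ.+-identityʳ (size L)) ⟩
    init (node L R) ++ [ size L ] ∎
    where open ≡-Reasoning

  length-init : ∀ L R → length (init (node L R)) ≡ size L + size R
  length-init L R = trans (List.length-++ (perm L))
    (cong₂ _+_ (length-perm L) (trans (List.length-map (size L +_) (map suc (inverse R)))
      (trans (List.length-map suc (inverse R)) (length-inverse R))))

  map-suc-+ : ∀ a b xs → map (a +_) (map suc (map (b +_) xs)) ≡ map (suc (a + b) +_) xs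
  map-suc-+ a b xs = trans (cong (map (a +_)) (sym (List.map-∘ xs)))
    (trans (sym (List.map-∘ xs)) (List.map-cong (λ x → trans (ℕ.+-suc a (b + x)) (cong suc (sym (ℕ.+-assoc a b x)))) xs))

  All-map-suc-+ : ∀ a {b k xs} → a + suc b ≤ k → All (_< b) xs → All (_< k) (map (a +_) (map suc xs))
  All-map-suc-+ a h qs = All-map-+ a h (Allₚ.map⁺ (All.map s<s qs))

  init-node : ∀ L R r → init (node L (node R r)) ≡
    perm L ++ map (size L +_) (map suc (inverse R)) ++ (size L + suc (size R + size r)) ∷ map (suc (size L + size R) +_) (perm r)
  init-node L R r = cong (perm L ++_) (begin
    map (a +_) (map suc (inverse R ++ (b + size r) ∷ map (b +_) (perm r)))
      ≡⟨ cong (map (a +_)) (List.map-++ suc (inverse R) _) ⟩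
    map (a +_) (map suc (inverse R) ++ suc (b + size r) ∷ map suc (map (b +_) (perm r)))
      ≡⟨ List.map-++ (a +_) (map suc (inverse R)) _ ⟩
    map (a +_) (map suc (inverse R)) ++ (a + suc (b + size r)) ∷ map (a +_) (map suc (map (b +_) (perm r)))
      ≡⟨ cong (λ z → map (a +_) (map suc (inverse R)) ++ (a + suc (b + size r)) ∷ z) (map-suc-+ a b (perm r)) ⟩
    map (a +_) (map suc (inverse R)) ++ (a + suc (b + size r)) ∷ map (suc (a + b) +_) (perm r) ∎)
    where
    open ≡-Reasoning
    a b : ℕ
    a = size L
    b = size R

  delete-list : ∀ L R → map (replace (size L + size R) (size L)) (init (node L R)) ≡ perm (delete (node L R))
  delete-list L leaf = trans (cong (map _) (List.++-identityʳ (perm L)))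
    (map-replace-miss (size L) (All-weaken (ℕ.≤-reflexive (sym (ℕ.+-identityʳ (size L)))) (All-perm L)))
  delete-list L (node R r) = begin
    map f (init (node L (node R r)))
      ≡⟨ cong (map f) (init-node L R r) ⟩
    map f (perm L ++ map (a +_) (map suc (inverse R)) ++ (a + suc (b + size r)) ∷ map (suc (a + b) +_) (perm r))
      ≡⟨ List.map-++ f (perm L) _ ⟩
    map f (perm L) ++ map f (map (a +_) (map suc (inverse R)) ++ (a + suc (b + size r)) ∷ map (suc (a + b) +_) (perm r))
      ≡⟨ cong₂ _++_ (map-replace-miss a (All-weaken (ℕ.m≤m+n a _) (All-perm L)))
           (trans (List.map-++ f (map (a +_) (map suc (inverse R))) _)
             (cong₂ _++_ (map-replace-miss a (All-map-suc-+ a (ℕ.+-monoʳ-≤ a (s≤s (ℕ.m≤m+n b _))) (All-inverse R)))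
               (cong₂ _∷_ (replace-hit {a + suc (b + size r)} a refl)
                 (map-replace-miss a (All-map-+ (suc (a + b)) (ℕ.≤-reflexive (trans (cong suc (ℕ.+-assoc a b (size r))) (sym (ℕ.+-suc a _)))) (All-perm r)))))) ⟩
    perm L ++ map (a +_) (map suc (inverse R)) ++ a ∷ map (suc (a + b) +_) (perm r)
      ≡⟨ cong (perm L ++_) (List.++-assoc (map (a +_) (map suc (inverse R))) [ a ] _) ⟨
    perm L ++ (map (a +_) (map suc (inverse R)) ++ [ a ]) ++ map (suc (a + b) +_) (perm r)
      ≡⟨ List.++-assoc (perm L) _ _ ⟨
    (perm L ++ map (a +_) (map suc (inverse R)) ++ [ a ]) ++ map (suc (a + b) +_) (perm r)
      ≡⟨ cong (_++ map (suc (a + b) +_) (perm r)) (List.++-assoc (perm L) _ _) ⟨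
    (init (node L R) ++ [ a ]) ++ map (suc (a + b) +_) (perm r)
      ≡⟨ cong (_++ map (suc (a + b) +_) (perm r)) (perm-init L R) ⟨
    perm (node L R) ++ map (suc (a + b) +_) (perm r)
      ≡⟨ perm-⧺ (node L R) r ⟨
    perm (node L R ⧺ r) ∎
    where
    open ≡-Reasoning
    a b : ℕ
    a = size L
    b = size R
    f : ℕ → ℕ
    f = replace (a + suc (b + size r)) a

skip-delete : ∀ L R {i} → i < size L + size R →
              skip (size L + size R) (at (perm (node L R))) i ≡ at (perm (delete (node L R))) i
skip-delete L R {i} l = trans (cong (λ z → skip (size L + size R) (at z) i) (perm-init L R))
  (trans (skip-at (init (node L R)) (length-init L R) l) (cong (λ z → at z i) (delete-list L R)))

delete-fixed : ∀ L R → (at (perm (node L R)) (size L + size R) ≡ᵇ size L + size R) ≡ deleteFixed (node L R)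
delete-fixed L leaf rewrite perm-last L leaf = ≡ᵇ⁺ (sym (ℕ.+-identityʳ (size L)))
delete-fixed L (node R r) rewrite perm-last L (node R r) = ≢ᵇ⁺ (ℕ.<⇒≢ (ℕ.m<m+n (size L) z<s))

size-delete : ∀ L R → size (delete (node L R)) ≡ size L + size R
size-delete L leaf       = sym (ℕ.+-identityʳ (size L))
size-delete L (node R r) = trans (size-⧺ (node L R) r)
  (trans (cong suc (ℕ.+-assoc (size L) (size R) (size r))) (sym (ℕ.+-suc (size L) _)))

private
  -- The facts about the last two entries of the one-line notation that each case of `merge` has to
  -- supply. The entry `w` at position `m` tells whether `m` is sent to `suc m`.
  record MergeList (t : Tree) (m : ℕ) : Set where
    field
      {front} : List ℕ
      {w z}   : ℕ
      perm≡   : perm t ≡ front ++ w ∷ z ∷ []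
      length≡ : length front ≡ m
      merge≡  : map (replace (suc m) w) (front ++ [ z ]) ≡ perm (merge t)
      fixed≡  : (w ≡ᵇ suc m) ≡ mergeFixed t

  open MergeList

  mergeList : ∀ t m → size t ≡ suc (suc m) → MergeList t m
  mergeList (node (node L R) leaf) m e = record
    { front   = init (node L R)
    ; perm≡   = trans (perm-init (node L R) leaf) (trans (cong (_++ [ n ]) (trans (List.++-identityʳ _) (perm-init L R)))
                  (List.++-assoc (init (node L R)) _ _))
    ; length≡ = trans (length-init L R) m≡
    ; merge≡  = trans (List.map-++ f (init (node L R)) [ n ])
                  (trans (cong₂ (λ x y → x ++ [ y ]) (map-replace-miss (size L) init<) (replace-hit (size L) (cong suc m≡)))
                         (sym (perm-init L R)))
    ; fixed≡  = ≢ᵇ⁺ (ℕ.<⇒≢ (s≤s (ℕ.≤-trans (ℕ.m≤m+n (size L) (size R)) (ℕ.≤-reflexive m≡))))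
    }
    where
    n : ℕ
    n = size (node L R)
    f : ℕ → ℕ
    f = replace (suc m) (size L)
    m≡ : size L + size R ≡ m
    m≡ = ℕ.suc-injective (ℕ.suc-injective (trans (cong suc (sym (ℕ.+-identityʳ n))) e))
    init< : All (_< suc m) (init (node L R))
    init< = Allₚ.++⁻ˡ _ (subst (All (_< suc m)) (perm-init L R) (All-weaken (ℕ.≤-reflexive (cong suc m≡)) (All-perm (node L R))))
  mergeList (node L (node R leaf)) m e = record
    { front   = init (node L R)
    ; w       = suc m
    ; z       = size L
    ; perm≡   = trans (perm-init L (node R leaf)) (trans (cong (_++ [ size L ]) (trans (init-node L R leaf)
                  (trans (sym (List.++-assoc (perm L) _ _)) (cong (λ z → init (node L R) ++ [ z ]) n≡))))
                  (List.++-assoc (init (node L R)) _ _))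
    ; length≡ = trans (length-init L R) m≡
    ; merge≡  = trans (List.map-id-local (All.universal (replace-self (suc m)) _)) (sym (perm-init L R))
    ; fixed≡  = ≡ᵇ⁺ {m} refl
    }
    where
    n≡ : size L + suc (size R + 0) ≡ suc m
    n≡ = ℕ.suc-injective e
    m≡ : size L + size R ≡ m
    m≡ = trans (cong (size L +_) (sym (ℕ.+-identityʳ (size R)))) (ℕ.suc-injective (trans (sym (ℕ.+-suc (size L) _)) n≡))
  mergeList (node L (node R (node r₁ r₂))) m e = record
    { front   = perm L ++ map (a +_) (map suc (inverse R)) ++ (a + suc (b + suc (c + d))) ∷ map (suc (a + b) +_) (init (node r₁ r₂))
    ; w       = suc (a + b) + c
    ; z       = a
    ; perm≡   = begin
        perm (node L (node R r))
          ≡⟨ perm-init L (node R r) ⟩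
        init (node L (node R r)) ++ [ a ]
          ≡⟨ cong (_++ [ a ]) (init-node L R r) ⟩
        (perm L ++ A ++ N ∷ map (s +_) (perm r)) ++ [ a ]
          ≡⟨ cong (λ z → (perm L ++ A ++ N ∷ z) ++ [ a ]) (trans (cong (map (s +_)) (perm-init r₁ r₂)) (List.map-++ (s +_) (init r) [ c ])) ⟩
        (perm L ++ A ++ N ∷ map (s +_) (init r) ++ [ s + c ]) ++ [ a ]
          ≡⟨ cong (_++ [ a ]) (regroup (N ∷ map (s +_) (init r)) [ s + c ]) ⟩
        ((perm L ++ A ++ N ∷ map (s +_) (init r)) ++ [ s + c ]) ++ [ a ]
          ≡⟨ List.++-assoc (perm L ++ A ++ N ∷ map (s +_) (init r)) _ _ ⟩
        (perm L ++ A ++ N ∷ map (s +_) (init r)) ++ (s + c) ∷ a ∷ [] ∎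
    ; length≡ = begin
        length (perm L ++ A ++ N ∷ map (s +_) (init r))
          ≡⟨ List.length-++ (perm L) ⟩
        length (perm L) + length (A ++ N ∷ map (s +_) (init r))
          ≡⟨ cong₂ _+_ (length-perm L) (List.length-++ A) ⟩
        a + (length A + suc (length (map (s +_) (init r))))
          ≡⟨ cong (a +_) (cong₂ (λ x y → x + suc y)
               (trans (List.length-map (a +_) (map suc (inverse R))) (trans (List.length-map suc (inverse R)) (length-inverse R)))
               (trans (List.length-map (s +_) (init r)) (length-init r₁ r₂))) ⟩
        a + (b + suc (c + d))
          ≡⟨ ℕ.suc-injective (trans (sym (ℕ.+-suc a _)) N≡) ⟩
        m ∎
    ; merge≡  = begin
        map f ((perm L ++ A ++ N ∷ map (s +_) (init r)) ++ [ a ])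
          ≡⟨ List.map-++ f (perm L ++ A ++ N ∷ map (s +_) (init r)) [ a ] ⟩
        map f (perm L ++ A ++ N ∷ map (s +_) (init r)) ++ [ f a ]
          ≡⟨ cong₂ (λ x y → x ++ [ y ])
               (trans (List.map-++ f (perm L) _) (cong₂ _++_ (map-replace-miss (s + c) (All-weaken (ℕ.<⇒≤ a<) (All-perm L)))
                 (trans (List.map-++ f A _) (cong₂ _++_
                   (map-replace-miss (s + c) (All-map-suc-+ a (ℕ.≤-trans (ℕ.+-monoʳ-≤ a (s≤s (ℕ.m≤m+n b _))) (ℕ.≤-reflexive N≡)) (All-inverse R)))
                   (cong₂ _∷_ (replace-hit (s + c) N≡) (map-replace-miss (s + c) init<))))))
               (replace-miss (s + c) a<) ⟩
        (perm L ++ A ++ (s + c) ∷ map (s +_) (init r)) ++ [ a ]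
          ≡⟨ cong (_++ [ a ]) init-merge ⟨
        init (node L (node R r₁ ⧺ r₂)) ++ [ a ]
          ≡⟨ perm-init L (node R r₁ ⧺ r₂) ⟨
        perm (node L (node R r₁ ⧺ r₂)) ∎
    ; fixed≡  = ≢ᵇ⁺ (ℕ.<⇒≢ s+c<)
    }
    where
    open ≡-Reasoning
    a b c d : ℕ
    a = size L
    b = size R
    c = size r₁
    d = size r₂
    r : Tree
    r = node r₁ r₂
    s N : ℕ
    s = suc (a + b)
    N = a + suc (b + suc (c + d))
    A : List ℕ
    A = map (a +_) (map suc (inverse R))
    f : ℕ → ℕ
    f = replace (suc m) (s + c)
    N≡ : N ≡ suc m
    N≡ = ℕ.suc-injective e
    s+r≡ : s + size r ≡ suc m
    s+r≡ = trans (cong suc (ℕ.+-assoc a b (size r))) (trans (sym (ℕ.+-suc a _)) N≡)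
    a< : a < suc m
    a< = subst (a <_) N≡ (ℕ.m<m+n a z<s)
    s+c< : s + c < suc m
    s+c< = subst (s + c <_) s+r≡ (ℕ.+-monoʳ-< s (s≤s (ℕ.m≤m+n c d)))
    regroup : ∀ xs ys → perm L ++ A ++ xs ++ ys ≡ (perm L ++ A ++ xs) ++ ys
    regroup xs ys = trans (cong (perm L ++_) (sym (List.++-assoc A xs ys))) (sym (List.++-assoc (perm L) (A ++ xs) ys))
    init< : All (_< suc m) (map (s +_) (init r))
    init< = All-map-+ s (ℕ.≤-reflexive s+r≡) (Allₚ.++⁻ˡ _ (subst (All (_< size r)) (perm-init r₁ r₂) (All-perm r)))
    init-merge : init (node L (node R r₁ ⧺ r₂)) ≡ perm L ++ A ++ (s + c) ∷ map (s +_) (init r)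
    init-merge = cong (perm L ++_) (begin
      map (a +_) (map suc (inverse (node R r₁ ⧺ r₂)))
        ≡⟨ cong (λ z → map (a +_) (map suc z)) (trans (inverse-⧺ (node R r₁) r₂) (List.++-assoc (inverse R) _ _)) ⟩
      map (a +_) (map suc (inverse R ++ (b + c) ∷ map (b +_) (perm r₁) ++ map (suc (b + c) +_) (inverse r₂)))
        ≡⟨ trans (cong (map (a +_)) (List.map-++ suc (inverse R) _)) (List.map-++ (a +_) (map suc (inverse R)) _) ⟩
      A ++ (a + suc (b + c)) ∷ map (a +_) (map suc (map (b +_) (perm r₁) ++ map (suc (b + c) +_) (inverse r₂)))
        ≡⟨ cong (A ++_) (cong₂ _∷_ (trans (ℕ.+-suc a (b + c)) (cong suc (sym (ℕ.+-assoc a b c)))) (begin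
             map (a +_) (map suc (map (b +_) (perm r₁) ++ map (suc (b + c) +_) (inverse r₂)))
               ≡⟨ cong (λ z → map (a +_) (map suc (map (b +_) (perm r₁) ++ z)))
                    (trans (List.map-cong (λ x → trans (sym (ℕ.+-suc (b + c) x)) (ℕ.+-assoc b c (suc x))) (inverse r₂))
                      (trans (List.map-∘ (inverse r₂)) (cong (map (b +_)) (List.map-∘ (inverse r₂))))) ⟩
             map (a +_) (map suc (map (b +_) (perm r₁) ++ map (b +_) (map (c +_) (map suc (inverse r₂)))))
               ≡⟨ cong (λ z → map (a +_) (map suc z)) (List.map-++ (b +_) (perm r₁) _) ⟨
             map (a +_) (map suc (map (b +_) (init r)))
               ≡⟨ map-suc-+ a b (init r) ⟩
             map (s +_) (init r) ∎)) ⟩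
      A ++ (s + c) ∷ map (s +_) (init r) ∎)

skip-merge : ∀ t {m} → size t ≡ suc (suc m) → ∀ {i} → i < suc m →
             skip (suc m) (at (perm t) ∘ transpose m) i ≡ at (perm (merge t)) i
skip-merge t {m} e {i} l = trans (cong (λ z → skip (suc m) (at z ∘ transpose m) i) (perm≡ M))
  (trans (skip-transpose-at (front M) (length≡ M) l) (cong (λ z → at z i) (merge≡ M)))
  where
  M : MergeList t m
  M = mergeList t m e

merge-fixed : ∀ t {m} → size t ≡ suc (suc m) → (at (perm t) m ≡ᵇ suc m) ≡ mergeFixed t
merge-fixed t {m} e = trans (cong (_≡ᵇ suc m) (begin
  at (perm t) m                            ≡⟨ cong₂ at (perm≡ M) (trans (sym (length≡ M)) (sym (ℕ.+-identityʳ _))) ⟩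
  at (front M ++ w M ∷ z M ∷ []) (length (front M) + 0) ≡⟨ at-++ʳ (front M) 0 ⟩
  w M ∎)) (fixed≡ M)
  where
  open ≡-Reasoning
  M : MergeList t m
  M = mergeList t m e

-- Numbers of cycles

-- Number of blocks of the partition of a tree, and number of blocks in the gaps of a block.
blocks inner : Tree → ℕ
blocks leaf       = 0
blocks (node L R) = blocks L + suc (inner R)
inner leaf       = 0
inner (node L R) = inner L + blocks R

blocks-⧺ : ∀ X Y → blocks (X ⧺ Y) ≡ blocks X + blocks Y
blocks-⧺ X leaf       = sym (ℕ.+-identityʳ _)
blocks-⧺ X (node L R) = trans (cong (_+ suc (inner R)) (blocks-⧺ X L)) (ℕ.+-assoc (blocks X) (blocks L) _)

blocks-delete : ∀ L R → blocks (node L R) ≡ blocks (delete (node L R)) + 𝟙 (deleteFixed (node L R))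
blocks-delete L leaf       = refl
blocks-delete L (node R r) = begin
  blocks L + suc (inner R + blocks r)   ≡⟨ ℕ.+-assoc (blocks L) (suc (inner R)) (blocks r) ⟨
  blocks L + suc (inner R) + blocks r   ≡⟨ blocks-⧺ (node L R) r ⟨
  blocks (node L R ⧺ r)                 ≡⟨ ℕ.+-identityʳ _ ⟨
  blocks (node L R ⧺ r) + 0 ∎
  where open ≡-Reasoning

blocks-cons : ∀ u v → blocks (cons u v) ≡ suc (inner u + blocks v)
blocks-cons u leaf       = cong suc (sym (ℕ.+-identityʳ _))
blocks-cons u (node L R) = trans (cong (_+ suc (inner R)) (blocks-cons u L)) (cong suc (ℕ.+-assoc (inner u) (blocks L) _))

-- A tree form of #α + #α^Kr = n + 1: the two readings of `t` have `blocks t` and `suc (inner t)`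
-- blocks.
blocks+inner : ∀ t → blocks t + inner t ≡ size t
blocks+inner leaf       = refl
blocks+inner (node L R) = begin
  (blocks L + suc (inner R)) + (inner L + blocks R)  ≡⟨ cong (_+ (inner L + blocks R)) (ℕ.+-suc (blocks L) (inner R)) ⟩
  suc ((blocks L + inner R) + (inner L + blocks R))  ≡⟨ cong suc (ℕ.+-assoc (blocks L) (inner R) _) ⟩
  suc (blocks L + (inner R + (inner L + blocks R)))  ≡⟨ cong (λ z → suc (blocks L + z)) (trans (ℕ.+-comm (inner R) _) (ℕ.+-assoc (inner L) (blocks R) (inner R))) ⟩
  suc (blocks L + (inner L + (blocks R + inner R)))  ≡⟨ cong suc (ℕ.+-assoc (blocks L) (inner L) _) ⟨
  suc ((blocks L + inner L) + (blocks R + inner R))  ≡⟨ cong suc (cong₂ _+_ (blocks+inner L) (blocks+inner R)) ⟩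
  suc (size L + size R) ∎
  where open ≡-Reasoning

-- The last element is removed by `delete`, which is not a subtree operation; therefore the
-- induction is on the size.
#cyc-perm : ∀ t → #cyc (size t) (at (perm t)) ≡ blocks t
#cyc-perm t = go t (<-wellFounded (size t))
  where
  go : ∀ t → Acc _<_ (size t) → #cyc (size t) (at (perm t)) ≡ blocks t
  go leaf       _        = refl
  go (node L R) (acc rs) = begin
    #cyc (suc n) (at (perm (node L R)))
      ≡⟨ #cyc-skip (IsPerm-perm (node L R)) ⟩
    #cyc n (skip n (at (perm (node L R)))) + 𝟙 (at (perm (node L R)) n ≡ᵇ n)
      ≡⟨ cong₂ _+_ (#cyc-cong (IsPerm-skip (IsPerm-perm (node L R))) (skip-delete L R)) (cong 𝟙 (delete-fixed L R)) ⟩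
    #cyc n (at (perm (delete (node L R)))) + 𝟙 (deleteFixed (node L R))
      ≡⟨ cong (_+ 𝟙 (deleteFixed (node L R))) (trans (cong (λ z → #cyc z (at (perm (delete (node L R))))) (sym (size-delete L R)))
           (go (delete (node L R)) (rs (ℕ.≤-reflexive (cong suc (size-delete L R)))))) ⟩
    blocks (delete (node L R)) + 𝟙 (deleteFixed (node L R))
      ≡⟨ blocks-delete L R ⟨
    blocks (node L R) ∎
    where
    open ≡-Reasoning
    n : ℕ
    n = size L + size R

extend : Tree → Tree
extend leaf       = leaf
extend (node L R) = node L (node R leaf)

-- The interval partition of {0,…,m} whose blocks end at m and at the i < m with S i.
interval : (ℕ → Bool) → ℕ → Tree
interval S zero    = node leaf leaf
interval S (suc m) = if S m then node (interval S m) leaf else extend (interval S m)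

size-extend : ∀ {m} t → size t ≡ suc m → size (extend t) ≡ suc (suc m)
size-extend (node L R) e = cong suc (trans (trans (ℕ.+-suc (size L) _) (cong (λ z → suc (size L + z)) (ℕ.+-identityʳ (size R)))) e)

size-interval : ∀ S m → size (interval S m) ≡ suc m
size-interval S zero    = refl
size-interval S (suc m) with S m
... | true  = cong suc (trans (ℕ.+-identityʳ _) (size-interval S m))
... | false = size-extend (interval S m) (size-interval S m)

blocks-extend : ∀ t → blocks (extend t) ≡ blocks t
blocks-extend leaf       = refl
blocks-extend (node L R) = cong (λ z → blocks L + suc z) (ℕ.+-identityʳ (inner R))

-- The length of the interval partition: each `i < m` outside `S` joins `i` to `i + 1` and costs one
-- transposition.
countFalse : (ℕ → Bool) → ℕ → ℕ
countFalse S zero    = 0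
countFalse S (suc m) = countFalse S m + 𝟙 (not (S m))

blocks-interval : ∀ S m → blocks (interval S m) + countFalse S m ≡ suc m
blocks-interval S zero    = refl
blocks-interval S (suc m) with S m
... | true  = begin
  blocks (interval S m) + 1 + (countFalse S m + 0)   ≡⟨ cong₂ _+_ (ℕ.+-comm (blocks (interval S m)) 1) (ℕ.+-identityʳ (countFalse S m)) ⟩
  suc (blocks (interval S m) + countFalse S m)       ≡⟨ cong suc (blocks-interval S m) ⟩
  suc (suc m) ∎
  where open ≡-Reasoning
... | false = begin
  blocks (extend (interval S m)) + (countFalse S m + 1) ≡⟨ cong₂ _+_ (blocks-extend (interval S m)) (ℕ.+-comm (countFalse S m) 1) ⟩
  blocks (interval S m) + suc (countFalse S m)       ≡⟨ ℕ.+-suc _ _ ⟩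
  suc (blocks (interval S m) + countFalse S m)       ≡⟨ cong suc (blocks-interval S m) ⟩
  suc (suc m) ∎
  where open ≡-Reasoning

-- The inverse of the permutation of the interval partition, in which form it enters `α⁻¹β`.
ι : (ℕ → Bool) → ℕ → ℕ → ℕ
ι S m = at (inverse (interval S m))

IsPerm-ι : ∀ S m → IsPerm (suc m) (ι S m)
IsPerm-ι S m = subst (λ z → IsPerm z (ι S m)) (size-interval S m) (IsPerm-inverse (interval S m))

extend-< : ∀ t {m i} → size t ≡ suc m → i < suc m → at (inverse (extend t)) i ≡ transpose m (at (inverse t) i)
extend-< (node L R) {i = i} refl l with viewFirst (size L) (size R) l
... | inLeft h rewrite inverse-left L (node R leaf) h | inverse-left L R h
  = sym (transpose-< (ℕ.<-≤-trans (inverse-bounded L h) (ℕ.m≤m+n _ (size R))))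
... | isFirst rewrite inverse-first L (node R leaf) | inverse-first L R
  = trans (ℕ.+-suc (size L) _) (trans (cong (λ z → suc (size L + z)) (ℕ.+-identityʳ (size R))) (sym (transpose-m (size L + size R))))
... | inRight {j} h rewrite inverse-mid L (node R leaf) {j} (<-left 0 h) | inverse-mid L R h | perm-left R leaf h
  = sym (transpose-< (ℕ.+-monoʳ-< (size L) (perm-bounded R h)))

extend-last : ∀ t {m} → size t ≡ suc m → at (inverse (extend t)) (suc m) ≡ m
extend-last (node L R) refl = begin
  at (inverse (node L (node R leaf))) (suc (size L + size R))
    ≡⟨ cong (at (inverse (node L (node R leaf)))) (ℕ.+-suc (size L) (size R)) ⟨
  at (inverse (node L (node R leaf))) (size L + suc (size R))
    ≡⟨ inverse-mid L (node R leaf) (s≤s (ℕ.m≤m+n (size R) 0)) ⟩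
  size L + at (perm (node R leaf)) (size R)
    ≡⟨ cong (λ z → size L + at (perm (node R leaf)) z) (ℕ.+-identityʳ (size R)) ⟨
  size L + at (perm (node R leaf)) (size R + 0)
    ≡⟨ cong (size L +_) (perm-last R leaf) ⟩
  size L + size R ∎
  where open ≡-Reasoning

module _ {S : ℕ → Bool} {m : ℕ} (h : S m ≡ true) where

  private
    interval-true : interval S (suc m) ≡ node (interval S m) leaf
    interval-true rewrite h = refl

  ι-true-< : ∀ {i} → i < suc m → ι S (suc m) i ≡ ι S m i
  ι-true-< {i} l = trans (cong (λ z → at (inverse z) i) interval-true)
    (inverse-left (interval S m) leaf (subst (i <_) (sym (size-interval S m)) l))

  ι-true-last : ι S (suc m) (suc m) ≡ suc m
  ι-true-last = begin
    ι S (suc m) (suc m)                                 ≡⟨ cong₂ (λ z → at (inverse z)) interval-true (sym (size-interval S m)) ⟩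
    at (inverse (node (interval S m) leaf)) (size (interval S m)) ≡⟨ inverse-first (interval S m) leaf ⟩
    size (interval S m) + 0                             ≡⟨ trans (ℕ.+-identityʳ _) (size-interval S m) ⟩
    suc m ∎
    where open ≡-Reasoning

module _ {S : ℕ → Bool} {m : ℕ} (h : S m ≡ false) where

  private
    interval-false : interval S (suc m) ≡ extend (interval S m)
    interval-false rewrite h = refl

  -- Lengthening the last interval multiplies `ι` on the left by the transposition of `m` and
  -- `m + 1`. In `perm t ∘ ι` this factor stands next to `perm t` and can be absorbed there, which
  -- produces `merge`.
  ι-false-< : ∀ {i} → i < suc m → ι S (suc m) i ≡ transpose m (ι S m i)
  ι-false-< {i} l = trans (cong (λ z → at (inverse z) i) interval-false)
    (extend-< (interval S m) (size-interval S m) l)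

  ι-false-last : ι S (suc m) (suc m) ≡ m
  ι-false-last = trans (cong (λ z → at (inverse z) (suc m)) interval-false) (extend-last (interval S m) (size-interval S m))

-- Up to conjugation and inversion this is the product `α⁻¹β` of both generating functions, so its
-- cycles are the components of the meandric system.
meander : Tree → (ℕ → Bool) → ℕ → ℕ → ℕ
meander t S m = at (perm t) ∘ ι S m

IsPerm-meander : ∀ t S {m} → size t ≡ suc m → IsPerm (suc m) (meander t S m)
IsPerm-meander t S {m} e = IsPerm-∘ (subst (λ z → IsPerm z (at (perm t))) e (IsPerm-perm t)) (IsPerm-ι S m)

module _ (t : Tree) {S : ℕ → Bool} {m : ℕ} (e : size t ≡ suc (suc m)) where

  private
    M : IsPerm (suc (suc m)) (meander t S (suc m))
    M = IsPerm-meander t S e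

  -- Here `ι S (suc m)` fixes `suc m`, so taking `suc m` out of the product is taking it out of
  -- `perm t`.
  #cyc-delete : S m ≡ true → #cyc (suc (suc m)) (meander t S (suc m)) ≡
                             #cyc (suc m) (meander (delete t) S m) + 𝟙 (deleteFixed t)
  #cyc-delete h = trans (#cyc-skip M) (cong₂ _+_ (#cyc-cong (IsPerm-skip M) step) (cong 𝟙 (trans (cong (λ z → at (perm t) z ≡ᵇ suc m) (ι-true-last {S} h)) (fixed t e))))
    where
    fixed : ∀ t → size t ≡ suc (suc m) → (at (perm t) (suc m) ≡ᵇ suc m) ≡ deleteFixed t
    fixed (node L R) e rewrite sym (ℕ.suc-injective e) = delete-fixed L R
    at-delete : ∀ t → size t ≡ suc (suc m) → ∀ {i} → i < suc m → skip (suc m) (at (perm t)) i ≡ at (perm (delete t)) i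
    at-delete (node L R) e rewrite sym (ℕ.suc-injective e) = skip-delete L R
    step : ∀ {i} → i < suc m → skip (suc m) (meander t S (suc m)) i ≡ meander (delete t) S m i
    step {i} l = trans (cong₂ (λ x y → if at (perm t) x ≡ᵇ suc m then at (perm t) y else at (perm t) x) (ι-true-< {S} h l) (ι-true-last {S} h))
      (at-delete t e (bounded (IsPerm-ι S m) l))

  #cyc-merge : S m ≡ false → #cyc (suc (suc m)) (meander t S (suc m)) ≡
                             #cyc (suc m) (meander (merge t) S m) + 𝟙 (mergeFixed t)
  #cyc-merge h = trans (#cyc-skip M) (cong₂ _+_ (#cyc-cong (IsPerm-skip M) step) (cong 𝟙 (trans (cong (λ z → at (perm t) z ≡ᵇ suc m) (ι-false-last {S} h)) (merge-fixed t e))))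
    where
    step : ∀ {i} → i < suc m → skip (suc m) (meander t S (suc m)) i ≡ meander (merge t) S m i
    step {i} l = trans (cong₂ (λ x y → if at (perm t) x ≡ᵇ suc m then at (perm t) y else at (perm t) x) (ι-false-< {S} h l)
        (trans (ι-false-last {S} h) (sym (transpose-suc m))))
      (skip-merge t e (bounded (IsPerm-ι S m) l))

private
  -- A removed point lowers the length by one unless it was fixed. The bound `c ≤ k` makes the
  -- truncated subtractions exact.
  length-step : ∀ {k c d} b → c ≤ k → d ≡ c + 𝟙 b → suc k ∸ d ≡ 𝟙 (not b) + (k ∸ c)
  length-step {k} {c} true  h refl = cong (suc k ∸_) (ℕ.+-comm c 1)
  length-step {k} {c} false h refl = trans (cong (suc k ∸_) (ℕ.+-identityʳ c)) (ℕ.+-∸-assoc 1 h)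

∥meander∥ : Tree → (ℕ → Bool) → ℕ → ℕ
∥meander∥ t S m = ∥ meander t S m ∥[ suc m ]

∥meander∥-delete : ∀ t {S m} → size t ≡ suc (suc m) → S m ≡ true →
                   ∥meander∥ t S (suc m) ≡ 𝟙 (not (deleteFixed t)) + ∥meander∥ (delete t) S m
∥meander∥-delete t {S} {m} e h = length-step (deleteFixed t) (#cyc≤n (suc m) (meander (delete t) S m)) (#cyc-delete t e h)

∥meander∥-merge : ∀ t {S m} → size t ≡ suc (suc m) → S m ≡ false →
                  ∥meander∥ t S (suc m) ≡ 𝟙 (not (mergeFixed t)) + ∥meander∥ (merge t) S m
∥meander∥-merge t {S} {m} e h = length-step (mergeFixed t) (#cyc≤n (suc m) (meander (merge t) S m)) (#cyc-merge t e h)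

-- Restricted growth strings

-- Grow m p k: p is a restricted growth string when the labels below m are in use before it, and
-- those below k after it.
data Grow : ℕ → List ℕ → ℕ → Set where
  []  : ∀ {m} → Grow m [] m
  new : ∀ {m p k} → Grow (suc m) p k → Grow m (m ∷ p) k
  old : ∀ {m p k l} → l < m → Grow m p k → Grow m (l ∷ p) k

-- The enumeration behind Partitions is private to Defs. Abstracting the literal 1 turns its
-- occurrence below into a generic application, from which unification reads off growthStrings.
mutual
  growthStrings : ℕ → ℕ → List (List ℕ)
  growthStrings = _

  Partitions-suc : ∀ n → Partitions (suc n) ≡ map (0 ∷_) (growthStrings n 1) ++ []
  Partitions-suc n with suc zero
  ... | m = refl

private
  nextLabel : ℕ → ℕ → ℕ
  nextLabel m l = if l ≡ᵇ m then suc m else m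

  children : ℕ → ℕ → ℕ → List (List ℕ)
  children k m l = map (l ∷_) (growthStrings k (nextLabel m l))

growthStrings-sound : ∀ k m {p} → p ∈ growthStrings k m → length p ≡ k × ∃ (Grow m p)
growthStrings-sound zero    m (here refl) = refl , m , []
growthStrings-sound (suc k) m p∈
  with ∈-concat⁻′ (map (children k m) (upTo (suc m))) p∈
... | ps , p∈ps , ps∈ with ∈-map⁻ (children k m) ps∈
...   | l , l∈ , refl with ∈-map⁻ (l ∷_) p∈ps
...     | q , q∈ , refl with l ℕ.≟ m
...       | yes refl with growthStrings-sound k (suc m) (subst (λ z → q ∈ growthStrings k z) (cong (if_then suc m else m) (≡ᵇ⁺ {m} refl)) q∈)
...         | e , j , g = cong suc e , j , new g
growthStrings-sound (suc k) m p∈ | _ | l , l∈ , refl | q , q∈ , refl | no h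
    with growthStrings-sound k m (subst (λ z → q ∈ growthStrings k z) (cong (if_then suc m else m) (≢ᵇ⁺ h)) q∈)
...         | e , j , g = cong suc e , j , old (ℕ.≤∧≢⇒< (ℕ.≤-pred (∈-upTo⁻ l∈)) h) g

growthStrings-complete : ∀ {m p k} → Grow m p k → p ∈ growthStrings (length p) m
growthStrings-complete []                   = here refl
growthStrings-complete {m} (new {p = p} g) =
  ∈-concat⁺′ (∈-map⁺ (m ∷_) (subst (λ z → p ∈ growthStrings (length p) z) (sym (cong (if_then suc m else m) (≡ᵇ⁺ {m} refl))) (growthStrings-complete g)))
             (∈-map⁺ (children (length p) m) (∈-upTo⁺ (ℕ.n<1+n m)))
growthStrings-complete {m} (old {p = p} {l = l} l<m g) =
  ∈-concat⁺′ (∈-map⁺ (l ∷_) (subst (λ z → p ∈ growthStrings (length p) z) (sym (cong (if_then suc m else m) (≢ᵇ⁺ (ℕ.<⇒≢ l<m)))) (growthStrings-complete g)))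
             (∈-map⁺ (children (length p) m) (∈-upTo⁺ (ℕ.m<n⇒m<1+n l<m)))

unique-concatMap : ∀ {A B : Set} (f : A → List B) xs → Unique xs → (∀ x → Unique (f x)) →
                   (∀ {x y z} → z ∈ f x → z ∈ f y → x ≡ y) → Unique (concatMap f xs)
unique-concatMap f []       u         uf d = []
unique-concatMap f (x ∷ xs) (px ∷ u) uf d =
  Unique.++⁺ (uf x) (unique-concatMap f xs u uf d) disjoint
  where
  disjoint : Disjoint (f x) (concatMap f xs)
  disjoint (z∈ , z∈′) with ∈-concat⁻′ (map f xs) z∈′
  ... | _ , z∈fy , fy∈ with ∈-map⁻ f fy∈
  ...   | y , y∈ , refl = All.lookup px y∈ (d z∈ z∈fy)

growthStrings-unique : ∀ k m → Unique (growthStrings k m)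
growthStrings-unique zero    m = [] ∷ []
growthStrings-unique (suc k) m = unique-concatMap (children k m) (upTo (suc m)) (Unique.upTo⁺ (suc m))
  (λ l → Unique.map⁺ List.∷-injectiveʳ (growthStrings-unique k (nextLabel m l))) same-head
  where
  same-head : ∀ {l l′ p} → p ∈ children k m l → p ∈ children k m l′ → l ≡ l′
  same-head {l} {l′} a b with ∈-map⁻ (l ∷_) a | ∈-map⁻ (l′ ∷_) b
  ... | _ , _ , refl | _ , _ , refl = refl

Partitions⁻ : ∀ {n p} → p ∈ Partitions n → length p ≡ n × ∃ (Grow 0 p)
Partitions⁻ {n} = growthStrings-sound n 0

Partitions⁺ : ∀ {p k} → Grow 0 p k → p ∈ Partitions (length p)
Partitions⁺ = growthStrings-complete

grow-++ : ∀ {m xs k ys l} → Grow m xs k → Grow k ys l → Grow m (xs ++ ys) l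
grow-++ []        h = h
grow-++ (new g)   h = new (grow-++ g h)
grow-++ (old l g) h = old l (grow-++ g h)

grow-split : ∀ {m l} xs {ys} → Grow m (xs ++ ys) l → ∃ λ k → Grow m xs k × Grow k ys l
grow-split []       g         = _ , [] , g
grow-split (x ∷ xs) (new g)   with grow-split xs g
... | k , a , b = k , new a , b
grow-split (x ∷ xs) (old l g) with grow-split xs g
... | k , a , b = k , old l a , b

grow-shift : ∀ a {m xs k} → Grow m xs k → Grow (a + m) (map (a +_) xs) (a + k)
grow-shift a []        = []
grow-shift a {m} {k = k} (new {p = p} g) = new (subst (λ z → Grow z (map (a +_) p) (a + k)) (ℕ.+-suc a m) (grow-shift a g))
grow-shift a (old l g) = old (ℕ.+-monoʳ-< a l) (grow-shift a g)

grow-unshift : ∀ a {m xs k} → Grow (a + m) xs k → All (a ≤_) xs →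
               ∃ λ ys → ∃ λ j → xs ≡ map (a +_) ys × Grow m ys j
grow-unshift a {m} []      h       = [] , m , refl , []
grow-unshift a {m} {k = k} (new {p = p} g) (_ ∷ h) with grow-unshift a {suc m} (subst (λ z → Grow z p k) (sym (ℕ.+-suc a m)) g) h
... | ys , j , refl , g′ = m ∷ ys , j , refl , new g′
grow-unshift a (old {l = l} q g) (a≤l ∷ h) with grow-unshift a g h
... | ys , j , refl , g′ = (l ∸ a) ∷ ys , j , cong (_∷ _) (sym (ℕ.m+[n∸m]≡n a≤l))
                         , old (ℕ.+-cancelˡ-< a _ _ (subst (_< _) (sym (ℕ.m+[n∸m]≡n a≤l)) q)) g′

grow-functional : ∀ {m xs k l} → Grow m xs k → Grow m xs l → k ≡ l
grow-functional []        []         = refl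
grow-functional (new g)   (new h)    = grow-functional g h
grow-functional (new g)   (old l h)  = ⊥-elim (ℕ.<-irrefl refl l)
grow-functional (old l g) (new h)    = ⊥-elim (ℕ.<-irrefl refl l)
grow-functional (old _ g) (old _ h)  = grow-functional g h

grow-≤ : ∀ {m xs k} → Grow m xs k → m ≤ k
grow-≤ []        = ℕ.≤-refl
grow-≤ (new g)   = ℕ.<⇒≤ (grow-≤ g)
grow-≤ (old _ g) = grow-≤ g

grow-bounded : ∀ {m xs k} → Grow m xs k → All (_< k) xs
grow-bounded []        = []
grow-bounded (new g)   = grow-≤ g ∷ grow-bounded g
grow-bounded (old l g) = ℕ.<-≤-trans l (grow-≤ g) ∷ grow-bounded g

grow-onto : ∀ {m xs k} → Grow m xs k → ∀ {l} → m ≤ l → l < k → l ∈ xs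
grow-onto []       m≤l l<k = ⊥-elim (ℕ.<⇒≱ l<k m≤l)
grow-onto {m} (new g) {l} m≤l l<k with l ℕ.≟ m
... | yes refl = here refl
... | no h     = there (grow-onto g (ℕ.≤∧≢⇒< m≤l (h ∘ sym)) l<k)
grow-onto (old _ g) m≤l l<k = there (grow-onto g m≤l l<k)

grow-length : ∀ {m xs k} → Grow m xs k → k ≤ m + length xs
grow-length {m} []        = ℕ.m≤m+n m 0
grow-length {m} (new {p = p} {k = k} g) = subst (k ≤_) (sym (ℕ.+-suc m (length p))) (grow-length g)
grow-length {m} (old _ g) = ℕ.≤-trans (grow-length g) (ℕ.+-monoʳ-≤ m (ℕ.n≤1+n _))

-- The two readings of a tree as restricted growth strings. In `block` the enclosing block has label
-- 0, and each gap takes its labels after those already in use.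
labels block : Tree → List ℕ
labels leaf       = []
labels (node L R) = labels L ++ map (blocks L +_) (block R)
block leaf       = [ 0 ]
block (node L R) = block L ++ map (suc (inner L) +_) (labels R) ++ [ 0 ]

length-labels : ∀ t → length (labels t) ≡ size t
length-block  : ∀ t → length (block t) ≡ suc (size t)
length-labels leaf       = refl
length-labels (node L R) = trans (List.length-++ (labels L))
  (trans (cong₂ _+_ (length-labels L) (trans (List.length-map _ (block R)) (length-block R))) (ℕ.+-suc (size L) (size R)))
length-block leaf       = refl
length-block (node L R) = trans (List.length-++ (block L))
  (cong₂ _+_ (length-block L) (trans (List.length-++ (map (suc (inner L) +_) (labels R)))
    (trans (cong (_+ 1) (trans (List.length-map _ (labels R)) (length-labels R))) (ℕ.+-comm (size R) 1)))
  ∙ ℕ.+-suc (suc (size L)) (size R))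
  where _∙_ = trans

grow-labels : ∀ t → Grow 0 (labels t) (blocks t)
grow-block  : ∀ t → Grow 0 (block t) (suc (inner t))
grow-labels leaf       = []
grow-labels (node L R) = grow-++ (grow-labels L)
  (subst (λ z → Grow z (map (blocks L +_) (block R)) (blocks (node L R))) (ℕ.+-identityʳ (blocks L)) (grow-shift (blocks L) (grow-block R)))
grow-block leaf       = new []
grow-block (node L R) = grow-++ (grow-block L) (grow-++
  (subst (λ z → Grow z (map (suc (inner L) +_) (labels R)) (suc (inner (node L R)))) (ℕ.+-identityʳ (suc (inner L))) (grow-shift (suc (inner L)) (grow-labels R)))
  (old z<s []))

-- Crossings as forbidden subsequences

⊆-split : ∀ {zs : List ℕ} xs {ys} → zs ⊆ xs ++ ys → ∃ λ us → ∃ λ vs → zs ≡ us ++ vs × us ⊆ xs × vs ⊆ ys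
⊆-split []       τ             = [] , _ , refl , [] , τ
⊆-split (x ∷ xs) (y skip∷ τ)   with ⊆-split xs τ
... | us , vs , e , a , b = us , vs , e , (x skip∷ a) , b
⊆-split (x ∷ xs) (refl ∷ τ)    with ⊆-split xs τ
... | us , vs , refl , a , b = x ∷ us , vs , refl , (refl ∷ a) , b

⊆⇒∈ : ∀ {x : ℕ} {zs xs} → (x ∷ zs) ⊆ xs → x ∈ xs
⊆⇒∈ (_ skip∷ τ) = there (⊆⇒∈ τ)
⊆⇒∈ (refl ∷ τ)  = here refl

∈⇒⊆ : ∀ {x : ℕ} {xs} → x ∈ xs → [ x ] ⊆ xs
∈⇒⊆ (here refl) = refl ∷ Subₚ.[]⊆-universal _
∈⇒⊆ (there m)   = _ skip∷ ∈⇒⊆ m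

⊆-tail : ∀ {x : ℕ} {zs xs} → (x ∷ zs) ⊆ xs → zs ⊆ xs
⊆-tail (y skip∷ τ) = y skip∷ ⊆-tail τ
⊆-tail (refl ∷ τ)  = _ skip∷ τ

NonCrossing : List ℕ → Set
NonCrossing p = ∀ {x y} → x ≢ y → ¬ ((x ∷ y ∷ x ∷ y ∷ []) ⊆ p)

nonCrossing-⊆ : ∀ {p q} → p ⊆ q → NonCrossing q → NonCrossing p
nonCrossing-⊆ σ h ne τ = h ne (⊆-trans τ σ)

nonCrossing-++ : ∀ {xs ys} → Disjoint xs ys → NonCrossing xs → NonCrossing ys → NonCrossing (xs ++ ys)
nonCrossing-++ {xs} d hx hy ne τ with ⊆-split xs τ
... | [] , _ , refl , a , b                     = hy ne b
... | _ ∷ [] , _ , refl , a , b                 = d (⊆⇒∈ a , ⊆⇒∈ (⊆-tail b))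
... | _ ∷ _ ∷ [] , _ , refl , a , b             = d (⊆⇒∈ a , ⊆⇒∈ b)
... | _ ∷ _ ∷ _ ∷ [] , _ , refl , a , b         = d (⊆⇒∈ (⊆-tail a) , ⊆⇒∈ b)
... | _ ∷ _ ∷ _ ∷ _ ∷ [] , [] , refl , a , b    = hx ne a

⊆-map⁻ : ∀ a {zs} xs → zs ⊆ map (a +_) xs → ∃ λ ws → zs ≡ map (a +_) ws × ws ⊆ xs
⊆-map⁻ a []       []           = [] , refl , []
⊆-map⁻ a (x ∷ xs) (_ skip∷ τ)  with ⊆-map⁻ a xs τ
... | ws , e , σ = ws , e , (x skip∷ σ)
⊆-map⁻ a (x ∷ xs) (refl ∷ τ)   with ⊆-map⁻ a xs τ
... | ws , refl , σ = x ∷ ws , refl , (refl ∷ σ)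

nonCrossing-map⁺ : ∀ a {xs} → NonCrossing xs → NonCrossing (map (a +_) xs)
nonCrossing-map⁺ a {xs} h ne τ with ⊆-map⁻ a xs τ
... | x ∷ y ∷ z ∷ w ∷ [] , e , σ
  with List.∷-injective e
... | refl , e₁ with List.∷-injective e₁
... | refl , e₂ with List.∷-injective e₂
... | e₃ , e₄ with ℕ.+-cancelˡ-≡ a _ _ e₃ | ℕ.+-cancelˡ-≡ a _ _ (proj₁ (List.∷-injective e₄))
... | refl | refl = h (ne ∘ cong (a +_)) σ

nonCrossing-map⁻ : ∀ a {xs} → NonCrossing (map (a +_) xs) → NonCrossing xs
nonCrossing-map⁻ a h ne τ = h (ne ∘ ℕ.+-cancelˡ-≡ a _ _) (Subₚ.map⁺ (a +_) τ)

<-≥-disjoint : ∀ {k xs ys} → All (_< k) xs → All (k ≤_) ys → Disjoint xs ys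
<-≥-disjoint hx hy (a , b) = ℕ.<⇒≱ (All.lookup hx a) (All.lookup hy b)

All-≥-map : ∀ a xs → All (a ≤_) (map (a +_) xs)
All-≥-map a xs = Allₚ.map⁺ (All.universal (λ x → ℕ.m≤m+n a x) xs)

labels-disjoint : ∀ L R → Disjoint (labels L) (map (blocks L +_) (block R))
labels-disjoint L R = <-≥-disjoint (grow-bounded (grow-labels L)) (All-≥-map (blocks L) (block R))

block-disjoint : ∀ L R → Disjoint (block L) (map (suc (inner L) +_) (labels R))
block-disjoint L R = <-≥-disjoint (grow-bounded (grow-block L)) (All-≥-map (suc (inner L)) (labels R))

0∉gap : ∀ a xs → 0 ∉ map (suc a +_) xs
0∉gap a xs m with ∈-map⁻ (suc a +_) m
... | _ , _ , ()

block-last : ∀ t → ∃ λ xs → block t ≡ xs ++ [ 0 ]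
block-last leaf       = [] , refl
block-last (node L R) = block L ++ map (suc (inner L) +_) (labels R) , sym (List.++-assoc (block L) _ _)

block-head : ∀ t → ∃ λ xs → block t ≡ 0 ∷ xs
block-head leaf       = [] , refl
block-head (node L R) with block-head L
... | xs , e = _ , cong (_++ map (suc (inner L) +_) (labels R) ++ [ 0 ]) e

-- A crossing that uses the new 0 consists of x 0 x before it. Disjointness forces these three into
-- `xs ++ [ 0 ]`, where the old final 0 can take over from the new one.
nonCrossing-snoc : ∀ {xs ys} → NonCrossing ((xs ++ [ 0 ]) ++ ys) → Disjoint (xs ++ [ 0 ]) ys →
                   NonCrossing (((xs ++ [ 0 ]) ++ ys) ++ [ 0 ])
nonCrossing-snoc {xs} {ys} h d {x} {y} ne τ with ⊆-split ((xs ++ [ 0 ]) ++ ys) τ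
... | _ ∷ _ ∷ _ ∷ _ ∷ [] , [] , refl , a , b    = h ne a
... | _ ∷ _ ∷ _ ∷ [] , _ , refl , a , (refl ∷ []) = last a
  where
  0∈ : 0 ∈ xs ++ [ 0 ]
  0∈ = ∈-++⁺ʳ xs (here refl)
  last : (x ∷ 0 ∷ x ∷ []) ⊆ ((xs ++ [ 0 ]) ++ ys) → ⊥
  last a with ⊆-split (xs ++ [ 0 ]) a
  ... | [] , _ , refl , _ , b          = d (0∈ , ⊆⇒∈ (⊆-tail b))
  ... | _ ∷ [] , _ , refl , _ , b      = d (0∈ , ⊆⇒∈ b)
  ... | _ ∷ _ ∷ [] , _ , refl , a , b  = d (⊆⇒∈ a , ⊆⇒∈ b)
  ... | _ ∷ _ ∷ _ ∷ [] , [] , refl , a , b with ⊆-split xs a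
  ...   | _ ∷ _ ∷ _ ∷ [] , [] , refl , c , _ = h ne (Subₚ.++⁺ʳ ys (Subₚ.++⁺ c (refl ∷ [])))
  ...   | _ ∷ _ ∷ [] , _ , refl , c , (refl ∷ []) = ne refl
  ...   | _ ∷ [] , _ , refl , c , (_ skip∷ ())
  ...   | [] , _ , refl , c , (_ skip∷ ())
nonCrossing-snoc h d ne τ | _ ∷ _ ∷ [] , _ , refl , a , (_ skip∷ ())
nonCrossing-snoc h d ne τ | _ ∷ _ ∷ [] , _ , refl , a , (_ ∷ ())
nonCrossing-snoc h d ne τ | _ ∷ [] , _ , refl , a , (_ skip∷ ())
nonCrossing-snoc h d ne τ | _ ∷ [] , _ , refl , a , (_ ∷ ())
nonCrossing-snoc h d ne τ | [] , _ , refl , a , (_ skip∷ ())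
nonCrossing-snoc h d ne τ | [] , _ , refl , a , (_ ∷ ())

nonCrossing-labels : ∀ t → NonCrossing (labels t)
nonCrossing-block  : ∀ t → NonCrossing (block t)
nonCrossing-labels leaf ne ()
nonCrossing-labels (node L R) =
  nonCrossing-++ (labels-disjoint L R) (nonCrossing-labels L) (nonCrossing-map⁺ (blocks L) (nonCrossing-block R))
nonCrossing-block leaf ne (_ skip∷ ())
nonCrossing-block leaf ne (_ ∷ ())
nonCrossing-block (node L R) with block L | block-last L | nonCrossing-block L | block-disjoint L R
... | _ | xs , refl | h | d = subst NonCrossing (List.++-assoc (xs ++ [ 0 ]) _ _)
  (nonCrossing-snoc {xs} (nonCrossing-++ d h (nonCrossing-map⁺ (suc (inner L)) (nonCrossing-labels R))) d)

-- The trees of size n enumerate the non-crossing partitions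

⊆-index : ∀ {x : ℕ} {zs} k p → (x ∷ zs) ⊆ drop k p →
          ∃ λ i → k ≤ i × i < length p × at p i ≡ x × zs ⊆ drop (suc i) p
⊆-index zero    (y ∷ p) (_ skip∷ τ) with ⊆-index zero p τ
... | i , _ , l , e , σ = suc i , z≤n , s<s l , e , σ
⊆-index zero    (y ∷ p) (refl ∷ τ) = 0 , z≤n , z<s , refl , τ
⊆-index (suc k) (y ∷ p) τ with ⊆-index k p τ
... | i , h , l , e , σ = suc i , s≤s h , s<s l , e , σ

index-⊆ : ∀ {zs k i} p → zs ⊆ drop (suc i) p → k ≤ i → i < length p → (at p i ∷ zs) ⊆ drop k p
index-⊆ {k = zero}  {zero}  (x ∷ p) τ h l       = refl ∷ τ
index-⊆ {k = zero}  {suc i} (x ∷ p) τ h (s≤s l) = x skip∷ index-⊆ {k = zero} p τ z≤n l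
index-⊆ {k = suc k} {suc i} (x ∷ p) τ (s≤s h) (s≤s l) = index-⊆ {k = k} p τ h l

isNC⁻ : ∀ p → isNC (length p) p ≡ true → NonCrossing p
isNC⁻ p h {x} {y} ne τ
  with ⊆-index 0 p τ
... | a , _ , la , refl , τ₁ with ⊆-index (suc a) p τ₁
... | c , a<c , lc , refl , τ₂ with ⊆-index (suc c) p τ₂
... | b , c<b , lb , eb , τ₃ with ⊆-index (suc b) p τ₃
... | d , b<d , ld , ed , _ = true≢false
  (∧-true⁺ (<ᵇ⁺ a<c) (∧-true⁺ (<ᵇ⁺ c<b) (∧-true⁺ (<ᵇ⁺ b<d) (∧-true⁺ (≡ᵇ⁺ (sym eb)) (∧-true⁺ (≡ᵇ⁺ (sym ed)) (not-true⁺ (≢ᵇ⁺ ne)))))))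
  (not-true⁻ (allUpTo⁻ {n = n} (allUpTo⁻ {n = n} (allUpTo⁻ {n = n} (allUpTo⁻ {n = n} h la) lb) lc) ld))
  where
  n : ℕ
  n = length p

isNC⁺ : ∀ p → NonCrossing p → isNC (length p) p ≡ true
isNC⁺ p h = allUpTo⁺ {n = n} λ {a} la → allUpTo⁺ {n = n} λ {b} lb → allUpTo⁺ {n = n} λ {c} lc → allUpTo⁺ {n = n} λ {d} ld →
  not-true⁺ (¬true⇒false (crossing la lb lc ld))
  where
  n : ℕ
  n = length p
  crossing : ∀ {a b c d} → a < n → b < n → c < n → d < n →
    ((a <ᵇ c) ∧ (c <ᵇ b) ∧ (b <ᵇ d) ∧ (at p a ≡ᵇ at p b) ∧ (at p c ≡ᵇ at p d) ∧ not (at p a ≡ᵇ at p c)) ≡ true → ⊥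
  crossing {a} {b} {c} {d} la lb lc ld e with ∧-true⁻ {a <ᵇ c} e
  ... | ac , e₁ with ∧-true⁻ {c <ᵇ b} e₁
  ... | cb , e₂ with ∧-true⁻ {b <ᵇ d} e₂
  ... | bd , e₃ with ∧-true⁻ {at p a ≡ᵇ at p b} e₃
  ... | ab , e₄ with ∧-true⁻ {at p c ≡ᵇ at p d} e₄
  ... | cd , ne = h (≢ᵇ⁻ (not-true⁻ ne))
    (index-⊆ p (index-⊆ p (subst₂ (λ x y → (x ∷ y ∷ []) ⊆ drop (suc c) p) (sym (≡ᵇ⁻ ab)) (sym (≡ᵇ⁻ cd))
      (index-⊆ p (index-⊆ p (Subₚ.[]⊆-universal _) (<ᵇ⁻ bd) ld) (<ᵇ⁻ cb) lb)) (<ᵇ⁻ ac) lc) z≤n la)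

firstOccurrence : ∀ {c : ℕ} {p} → c ∈ p → ∃ λ xs → ∃ λ zs → p ≡ xs ++ c ∷ zs × c ∉ xs
firstOccurrence {c} {x ∷ p} m with c ℕ.≟ x
... | yes refl = [] , p , refl , λ ()
... | no h with m
...   | here e  = ⊥-elim (h e)
...   | there m′ with firstOccurrence m′
...     | xs , zs , refl , n∉ = x ∷ xs , zs , refl , λ { (here e) → h e ; (there q) → n∉ q }

lastOccurrence : ∀ {c : ℕ} {p} → c ∈ p → ∃ λ xs → ∃ λ zs → p ≡ xs ++ c ∷ zs × c ∉ zs
lastOccurrence {c} {x ∷ p} m with any? (c ℕ.≟_) p
... | yes m′ with lastOccurrence m′
...   | xs , zs , refl , n∉ = x ∷ xs , zs , refl , n∉
lastOccurrence {c} {x ∷ p} (here refl) | no h = [] , p , refl , h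
lastOccurrence {c} {x ∷ p} (there m)   | no h = ⊥-elim (h m)

firstOccurrence-unique : ∀ {c : ℕ} xs xs′ {zs zs′} → c ∉ xs → c ∉ xs′ → xs ++ c ∷ zs ≡ xs′ ++ c ∷ zs′ → xs ≡ xs′ × zs ≡ zs′
firstOccurrence-unique []       []         h h′ refl = refl , refl
firstOccurrence-unique []       (x ∷ xs′)  h h′ refl = ⊥-elim (h′ (here refl))
firstOccurrence-unique (x ∷ xs) []         h h′ refl = ⊥-elim (h (here refl))
firstOccurrence-unique (x ∷ xs) (x′ ∷ xs′) h h′ e with List.∷-injective e
... | refl , e′ with firstOccurrence-unique xs xs′ (h ∘ there) (h′ ∘ there) e′
...   | refl , q = refl , q

lastOccurrence-unique : ∀ {c : ℕ} xs xs′ {zs zs′} → c ∉ zs → c ∉ zs′ → xs ++ c ∷ zs ≡ xs′ ++ c ∷ zs′ → xs ≡ xs′ × zs ≡ zs′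
lastOccurrence-unique []       []         h h′ refl = refl , refl
lastOccurrence-unique []       (x ∷ xs′)  h h′ refl = ⊥-elim (h (∈-++⁺ʳ xs′ (here refl)))
lastOccurrence-unique (x ∷ xs) []         h h′ refl = ⊥-elim (h′ (∈-++⁺ʳ xs (here refl)))
lastOccurrence-unique (x ∷ xs) (x′ ∷ xs′) h h′ e with List.∷-injective e
... | refl , e′ with lastOccurrence-unique xs xs′ h h′ e′
...   | refl , q = refl , q

map-+-injective : ∀ a {xs ys : List ℕ} → map (a +_) xs ≡ map (a +_) ys → xs ≡ ys
map-+-injective a = List.map-injective (ℕ.+-cancelˡ-≡ a _ _)

private
  labels-last : ∀ L R → ∃ λ ys → labels (node L R) ≡ ys ∷ʳ blocks L
  labels-last L R with block R | block-last R
  ... | _ | xs , refl = labels L ++ map (blocks L +_) xs ,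
    trans (cong (labels L ++_) (trans (List.map-++ (blocks L +_) xs [ 0 ]) (cong (λ z → map (blocks L +_) xs ++ [ z ]) (ℕ.+-identityʳ (blocks L)))))
          (sym (List.++-assoc (labels L) _ _))

  labels-first : ∀ L R → ∃ λ zs → labels (node L R) ≡ labels L ++ blocks L ∷ zs
  labels-first L R with block R | block-head R
  ... | _ | xs , refl = map (blocks L +_) xs , cong (λ z → labels L ++ z ∷ map (blocks L +_) xs) (ℕ.+-identityʳ (blocks L))

  blocks∉labels : ∀ t → blocks t ∉ labels t
  blocks∉labels t m = ℕ.<-irrefl refl (All.lookup (grow-bounded (grow-labels t)) m)

-- The last label is `blocks L`, and its first occurrence shows where the last outer block begins,
-- which separates `labels L`. In a block without its final 0, the last remaining 0 shows where the
-- last gap begins.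
labels-injective : ∀ t t′ → labels t ≡ labels t′ → t ≡ t′
block-injective  : ∀ t t′ → block t ≡ block t′ → t ≡ t′
labels-injective leaf leaf e = refl
labels-injective leaf (node L R) e with trans (cong length e) (length-labels (node L R))
... | ()
labels-injective (node L R) leaf e with trans (cong length (sym e)) (length-labels (node L R))
... | ()
labels-injective (node L R) (node L′ R′) e
  with labels-last L R | labels-last L′ R′ | labels-first L R | labels-first L′ R′
... | ys , p | ys′ , p′ | zs , q | zs′ , q′
  with List.∷ʳ-injectiveʳ ys ys′ (trans (sym p) (trans e p′))
... | b≡ with firstOccurrence-unique (labels L) (labels L′) (blocks∉labels L) (subst (_∉ labels L′) (sym b≡) (blocks∉labels L′))
                (trans (sym q) (trans e (trans q′ (cong (λ z → labels L′ ++ z ∷ zs′) (sym b≡)))))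
...   | l≡ , _ with labels-injective L L′ l≡
...     | refl = cong (node L) (block-injective R R′ (map-+-injective (blocks L) (List.++-cancelˡ (labels L) _ _ e)))
block-injective leaf leaf e = refl
block-injective leaf (node L R) e with ℕ.suc-injective (trans (cong length e) (length-block (node L R)))
... | ()
block-injective (node L R) leaf e with ℕ.suc-injective (trans (cong length (sym e)) (length-block (node L R)))
... | ()
block-injective (node L R) (node L′ R′) e with block-last L | block-last L′
... | us , p | us′ , p′ with List.∷ʳ-injectiveˡ (block L ++ G L R) (block L′ ++ G L′ R′)
                             (trans (List.++-assoc (block L) _ _) (trans e (sym (List.++-assoc (block L′) _ _))))
  where
  G : Tree → Tree → List ℕ
  G L R = map (suc (inner L) +_) (labels R)
... | e₁ with lastOccurrence-unique us us′ (0∉gap (inner L) (labels R)) (0∉gap (inner L′) (labels R′))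
                (trans (sym (trans (cong (_++ _) p) (List.++-assoc us _ _))) (trans e₁ (trans (cong (_++ _) p′) (List.++-assoc us′ _ _))))
...   | refl , g≡ with block-injective L L′ (trans p (sym p′))
...     | refl = cong (node L) (labels-injective R R′ (map-+-injective (suc (inner L)) g≡))

private
  -- The whole string ends in `c`, so any other label after an occurrence of `c` is followed by `c`
  -- again; this completes the crossings d c d c in `parse`.
  last-∈ : ∀ (xs : List ℕ) {c zs ys} → ys ++ [ c ] ≡ xs ++ c ∷ zs → ∀ {d} → d ≢ c → d ∈ zs → (d ∷ c ∷ []) ⊆ zs
  last-∈ xs {c} {zs} {ys} e {d} d≢c m with initLast zs
  ... | zs′ ∷ʳ′ c′ with List.∷ʳ-injectiveʳ ys (xs ++ c ∷ zs′) (trans e (sym (List.++-assoc xs (c ∷ zs′) [ c′ ])))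
  ...   | refl with ∈-++⁻ zs′ m
  ...     | inj₁ m′ = Subₚ.++⁺ (∈⇒⊆ m′) (refl ∷ [])
  ...     | inj₂ (here e′) = ⊥-elim (d≢c e′)

  grow-head : ∀ {x xs k} → Grow 0 (x ∷ xs) k → x ≡ 0
  grow-head (new _) = refl

  map-last : ∀ b ws {ys c} → c ≡ b + 0 → ys ++ [ c ] ≡ map (b +_) ws → ∃ λ us → ws ≡ us ++ [ 0 ]
  map-last b ws {ys} c≡ e with initLast ws
  map-last b _ {[]}     c≡ () | []
  map-last b _ {_ ∷ ys} c≡ () | []
  map-last b _ {ys} c≡ e | us ∷ʳ′ w
    with List.∷ʳ-injectiveʳ ys (map (b +_) us) (trans e (List.map-++ (b +_) us [ w ]))
  ... | e′ = us , cong (λ z → us ++ [ z ]) (ℕ.+-cancelˡ-≡ b w 0 (trans (sym e′) c≡))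

  snoc : ∀ (x : ℕ) xs → ∃ λ ys → ∃ λ z → x ∷ xs ≡ ys ++ [ z ]
  snoc x []       = [] , x , refl
  snoc x (y ∷ xs) with snoc y xs
  ... | ys , z , e = x ∷ ys , z , cong (x ∷_) e

  suffix-snoc : ∀ {xs zs ys : List ℕ} {c} → ys ++ [ c ] ≡ xs ++ c ∷ zs → ∃ λ ys′ → ys′ ++ [ c ] ≡ c ∷ zs
  suffix-snoc {xs} {zs} {ys} {c} e with snoc c zs
  ... | ys′ , c′ , q with List.∷ʳ-injectiveʳ ys (xs ++ ys′) (trans e (trans (cong (xs ++_) q) (sym (List.++-assoc xs ys′ [ c′ ]))))
  ...   | refl = ys′ , sym q

-- The string is cut at the places described for `labels-injective`. Absence of crossings makes the
-- labels of the pieces disjoint, so that the shifted piece is a growth string again. The pieces are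
-- not subterms, hence the bound `n` on the length.
parse      : ∀ n p {k} → length p ≤ n → Grow 0 p k → NonCrossing p → ∃ λ t → labels t ≡ p
parseBlock : ∀ n us {k} → length us ≤ n → Grow 0 (us ++ [ 0 ]) k → NonCrossing (us ++ [ 0 ]) → ∃ λ t → block t ≡ us ++ [ 0 ]
parse n p l g h with initLast p
parse n _ l g h | [] = leaf , refl
parse n _ l g h | ys ∷ʳ′ c with firstOccurrence (∈-++⁺ʳ ys {[ c ]} (here refl))
parse zero _ l g h | ys ∷ʳ′ c | _ with ys
parse zero _ () g h | ys ∷ʳ′ c | _ | []
parse zero _ () g h | ys ∷ʳ′ c | _ | _ ∷ _
parse (suc n) _ {k} l g h | ys ∷ʳ′ c | xs , zs , e , c∉xs
  with grow-split xs {c ∷ zs} (subst (λ z → Grow 0 z k) e g)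
... | b , g₁ , g₂ with grow-unshift b {0} (subst (λ z → Grow z (c ∷ zs) k) (sym (ℕ.+-identityʳ b)) g₂) (All.tabulate above)
  where
  -- A label below `b` has occurred in `xs`; recurring after the first `c` it would give the
  -- crossing d c d c.
  above : ∀ {d} → d ∈ c ∷ zs → b ≤ d
  above {d} m = ℕ.≮⇒≥ λ d<b → crossing (grow-onto g₁ z≤n d<b) m
    where
    crossing : d ∈ xs → d ∈ c ∷ zs → ⊥
    crossing d∈xs (here refl) = c∉xs d∈xs
    crossing d∈xs (there m′)  = h d≢c (subst (_ ⊆_) (sym e) (Subₚ.++⁺ (∈⇒⊆ d∈xs) (refl ∷ last-∈ xs {ys = ys} e d≢c m′)))
      where
      d≢c : d ≢ c
      d≢c refl = c∉xs d∈xs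
... | w ∷ ws , j , q , g₃ with grow-head g₃
...   | refl with map-last b (0 ∷ ws) (proj₁ (List.∷-injective q)) (trans (proj₂ (suffix-snoc {xs} {zs} {ys} e)) q)
...     | us , ws≡ with parse n xs (ℕ.≤-pred (ℕ.<-≤-trans xs< l)) g₁ (nonCrossing-⊆ (subst (xs ⊆_) (sym e) (Subₚ.++⁺ʳ (c ∷ zs) ⊆-refl)) h)
                      | parseBlock n us (ℕ.≤-pred (ℕ.≤-trans us< l)) (subst (λ z → Grow 0 z j) ws≡ g₃)
                          (subst NonCrossing ws≡ (nonCrossing-map⁻ b (subst NonCrossing q (nonCrossing-⊆ (subst ((c ∷ zs) ⊆_) (sym e) (Subₚ.++⁺ˡ xs ⊆-refl)) h))))
  where
  total : length (ys ++ [ c ]) ≡ length xs + suc (length zs)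
  total = trans (cong length e) (List.length-++ xs)
  xs< : length xs < length (ys ++ [ c ])
  xs< = subst (length xs <_) (sym total) (ℕ.m<m+n (length xs) z<s)
  us< : length us < length (ys ++ [ c ])
  us< = subst₂ _≤_ (trans (cong length q) (trans (List.length-map (b +_) (0 ∷ ws)) (trans (cong length ws≡)
          (trans (List.length-++ us) (ℕ.+-comm (length us) 1))))) (sym total) (ℕ.m≤n+m _ (length xs))
...       | L , refl | R , r≡ with grow-functional g₁ (grow-labels L)
...         | refl = node L R , trans (cong (λ z → labels L ++ map (blocks L +_) z) (trans r≡ (sym ws≡))) (trans (cong (labels L ++_) (sym q)) (sym e))
parseBlock n [] l g h = leaf , refl
parseBlock zero (u ∷ us) () g h
parseBlock (suc n) (u ∷ us) {k₀} l g h with grow-head g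
... | refl with lastOccurrence {0} {0 ∷ us} (here refl)
...   | as , gap , e , 0∉ with grow-split (as ++ [ 0 ]) {gap ++ [ 0 ]} (subst (λ z → Grow 0 z k₀) whole g)
  where
  whole : (0 ∷ us) ++ [ 0 ] ≡ (as ++ [ 0 ]) ++ gap ++ [ 0 ]
  whole = trans (cong (_++ [ 0 ]) e) (trans (List.++-assoc as _ _) (sym (List.++-assoc as [ 0 ] _)))
...     | k , g₁ , g₂ with grow-split gap g₂
...       | k′ , g₃ , _ with parseBlock n as (ℕ.≤-pred (ℕ.<-≤-trans as< l)) g₁ (nonCrossing-⊆ (subst ((as ++ [ 0 ]) ⊆_) (sym whole) (Subₚ.++⁺ʳ _ ⊆-refl)) h)
  where
  whole : (0 ∷ us) ++ [ 0 ] ≡ (as ++ [ 0 ]) ++ gap ++ [ 0 ]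
  whole = trans (cong (_++ [ 0 ]) e) (trans (List.++-assoc as _ _) (sym (List.++-assoc as [ 0 ] _)))
  as< : length as < length (0 ∷ us)
  as< = subst (length as <_) (sym (trans (cong length e) (List.length-++ as))) (ℕ.m<m+n (length as) z<s)
...         | L , l≡ with grow-functional (subst (λ z → Grow 0 z k) (sym l≡) g₁) (grow-block L)
...           | refl with grow-unshift (suc (inner L)) {0} (subst (λ z → Grow z gap k′) (sym (ℕ.+-identityʳ (suc (inner L)))) g₃) (All.tabulate above)
  where
  whole : (0 ∷ us) ++ [ 0 ] ≡ as ++ 0 ∷ gap ++ [ 0 ]
  whole = trans (cong (_++ [ 0 ]) e) (List.++-assoc as _ _)
  -- A label of the shorter block recurring in the gap would give d 0 d 0, with the 0 before the gap
  -- and the final 0.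
  above : ∀ {d} → d ∈ gap → suc (inner L) ≤ d
  above {d} m = ℕ.≮⇒≥ λ d< → crossing (∈-++⁻ as (grow-onto g₁ z≤n d<))
    where
    d≢0 : d ≢ 0
    d≢0 refl = 0∉ m
    crossing : d ∈ as ⊎ d ∈ [ 0 ] → ⊥
    crossing (inj₁ d∈as)     = h d≢0 (subst (_ ⊆_) (sym whole) (Subₚ.++⁺ (∈⇒⊆ d∈as) (refl ∷ Subₚ.++⁺ (∈⇒⊆ m) (refl ∷ []))))
    crossing (inj₂ (here q)) = d≢0 q
...             | gap′ , j , refl , g₄ with parse n gap′ (ℕ.≤-pred (ℕ.<-≤-trans gap< l)) g₄
                      (nonCrossing-map⁻ (suc (inner L)) (nonCrossing-⊆ (subst (map (suc (inner L) +_) gap′ ⊆_) (sym whole) (Subₚ.++⁺ˡ as (0 skip∷ Subₚ.++⁺ʳ [ 0 ] ⊆-refl))) h))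
  where
  G : List ℕ
  G = map (suc (inner L) +_) gap′
  whole : (0 ∷ us) ++ [ 0 ] ≡ as ++ 0 ∷ G ++ [ 0 ]
  whole = trans (cong (_++ [ 0 ]) e) (List.++-assoc as _ _)
  gap< : length gap′ < length (0 ∷ us)
  gap< = subst₂ _<_ (List.length-map (suc (inner L) +_) gap′) (sym (trans (cong length e) (List.length-++ as)))
           (ℕ.m≤n+m (suc (length G)) (length as))
...               | R , refl = node L R , (begin
  block L ++ map (suc (inner L) +_) (labels R) ++ [ 0 ]   ≡⟨ cong (_++ map (suc (inner L) +_) (labels R) ++ [ 0 ]) l≡ ⟩
  (as ++ [ 0 ]) ++ map (suc (inner L) +_) (labels R) ++ [ 0 ] ≡⟨ List.++-assoc as [ 0 ] _ ⟩
  as ++ 0 ∷ map (suc (inner L) +_) (labels R) ++ [ 0 ]     ≡⟨ trans (cong (_++ [ 0 ]) e) (List.++-assoc as _ _) ⟨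
  (0 ∷ us) ++ [ 0 ] ∎)
  where open ≡-Reasoning

∈-NC⁺ : ∀ t → labels t ∈ NC (size t)
∈-NC⁺ t = ∈-filterᵇ⁺ (isNC (size t)) (subst (λ z → labels t ∈ Partitions z) (length-labels t) (Partitions⁺ (grow-labels t)))
  (subst (λ z → isNC z (labels t) ≡ true) (length-labels t) (isNC⁺ (labels t) (nonCrossing-labels t)))

∈-NC⁻ : ∀ n {p} → p ∈ NC n → ∃ λ t → size t ≡ n × labels t ≡ p
∈-NC⁻ n {p} m with ∈-filterᵇ⁻ (isNC n) m
... | p∈ , nc with Partitions⁻ {n} p∈
...   | refl , _ , g with parse (length p) p ℕ.≤-refl g (isNC⁻ p nc)
...     | t , refl = t , sym (length-labels t) , refl

NC-unique : ∀ n → Unique (NC n)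
NC-unique n = Unique.filter⁺ _ (growthStrings-unique n 0)

-- The first argument bounds the depth of the recursion; it must be at least the size.
treesBelow : ℕ → ℕ → List Tree
treesBelow f       zero    = [ leaf ]
treesBelow zero    (suc n) = []
treesBelow (suc f) (suc n) =
  concatMap (λ l → cartesianProductWith node (treesBelow f l) (treesBelow f (n ∸ l))) (upTo (suc n))

trees : ℕ → List Tree
trees n = treesBelow n n

private
  splits : ℕ → ℕ → ℕ → List Tree
  splits f n l = cartesianProductWith node (treesBelow f l) (treesBelow f (n ∸ l))

treesBelow⁻ : ∀ f n {t} → t ∈ treesBelow f n → size t ≡ n
treesBelow⁻ zero    zero    (here refl) = refl
treesBelow⁻ (suc f) zero    (here refl) = refl
treesBelow⁻ (suc f) (suc n) m with ∈-concat⁻′ (map (splits f n) (upTo (suc n))) m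
... | _ , t∈ , ts∈ with ∈-map⁻ (splits f n) {xs = upTo (suc n)} ts∈
...   | l , l∈ , refl with ∈-cartesianProductWith⁻ node (treesBelow f l) (treesBelow f (n ∸ l)) t∈
...     | L , R , L∈ , R∈ , refl = cong suc (trans (cong₂ _+_ (treesBelow⁻ f l L∈) (treesBelow⁻ f (n ∸ l) R∈))
                                                   (ℕ.m+[n∸m]≡n (ℕ.≤-pred (∈-upTo⁻ l∈))))

treesBelow⁺ : ∀ f t → size t ≤ f → t ∈ treesBelow f (size t)
treesBelow⁺ zero    leaf       h = here refl
treesBelow⁺ (suc f) leaf       h = here refl
treesBelow⁺ (suc f) (node L R) (s≤s h) = ∈-concat⁺′
  (∈-cartesianProductWith⁺ node (treesBelow⁺ f L (ℕ.≤-trans (ℕ.m≤m+n _ _) h))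
    (subst (λ z → R ∈ treesBelow f z) (sym (ℕ.m+n∸m≡n (size L) (size R))) (treesBelow⁺ f R (ℕ.≤-trans (ℕ.m≤n+m _ _) h))))
  (∈-map⁺ (splits f (size L + size R)) (∈-upTo⁺ (s≤s (ℕ.m≤m+n (size L) (size R)))))

node-injective : ∀ {L L′ R R′} → node L R ≡ node L′ R′ → L ≡ L′ × R ≡ R′
node-injective refl = refl , refl

treesBelow-unique : ∀ f n → Unique (treesBelow f n)
treesBelow-unique zero    zero    = [] ∷ []
treesBelow-unique (suc f) zero    = [] ∷ []
treesBelow-unique zero    (suc n) = []
treesBelow-unique (suc f) (suc n) = unique-concatMap (splits f n) (upTo (suc n)) (Unique.upTo⁺ (suc n))
  (λ l → Unique.cartesianProductWith⁺ node node-injective (treesBelow-unique f l) (treesBelow-unique f (n ∸ l))) same-size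
  where
  same-size : ∀ {l l′ t} → t ∈ splits f n l → t ∈ splits f n l′ → l ≡ l′
  same-size {l} {l′} a b with ∈-cartesianProductWith⁻ node (treesBelow f l) (treesBelow f (n ∸ l)) a
                            | ∈-cartesianProductWith⁻ node (treesBelow f l′) (treesBelow f (n ∸ l′)) b
  ... | L , _ , L∈ , _ , refl | _ , _ , L∈′ , _ , refl = trans (sym (treesBelow⁻ f l L∈)) (treesBelow⁻ f l′ L∈′)

treesBelow↭trees : ∀ {f n} → n ≤ f → map id (treesBelow f n) ↭ trees n
treesBelow↭trees {f} {n} h = bijection⇒↭ id (treesBelow-unique f n) (treesBelow-unique n n)
  (λ m → complete n ℕ.≤-refl (treesBelow⁻ f n m)) (λ _ _ e → e) (λ m → _ , complete f h (treesBelow⁻ n n m) , refl)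
  where
  complete : ∀ f {t} → n ≤ f → size t ≡ n → t ∈ treesBelow f n
  complete f {t} h refl = treesBelow⁺ f t h

trees↭NC : ∀ n → map labels (trees n) ↭ NC n
trees↭NC n = bijection⇒↭ labels (treesBelow-unique n n) (NC-unique n)
  (λ {t} m → subst (λ z → labels t ∈ NC z) (treesBelow⁻ n n m) (∈-NC⁺ t))
  (λ {t} {t′} _ _ → labels-injective t t′) onto
  where
  onto : ∀ {p} → p ∈ NC n → ∃ λ t → t ∈ trees n × labels t ≡ p
  onto m with ∈-NC⁻ n m
  ... | t , refl , e = t , treesBelow⁺ n t ℕ.≤-refl , e

-- On trees this undoes the Kreweras complement, which takes `cons u v` to `node u v`. It serves to
-- reindex the sum over β in `M`.
rotate unrotate : Tree → Tree
rotate leaf       = leaf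
rotate (node u v) = cons u v
unrotate leaf = leaf
unrotate (node leaf R) = node R leaf
unrotate (node L@(node _ _) R) = attach (unrotate L)
  where
  attach : Tree → Tree
  attach leaf       = leaf
  attach (node u v) = node u (node v R)

unrotate-cons : ∀ u v → unrotate (cons u v) ≡ node u v
unrotate-cons u leaf = refl
unrotate-cons u (node leaf R) = refl
unrotate-cons u (node (node L R′) R) rewrite unrotate-cons u (node L R′) = refl

rotate-unrotate : ∀ t → rotate (unrotate t) ≡ t
rotate-unrotate leaf = refl
rotate-unrotate (node leaf R) = refl
rotate-unrotate (node L@(node _ _) R) with unrotate L | rotate-unrotate L
... | node u v | e = cong (λ z → node z R) e

unrotate-rotate : ∀ t → unrotate (rotate t) ≡ t
unrotate-rotate leaf       = refl
unrotate-rotate (node u v) = unrotate-cons u v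

size-rotate : ∀ t → size (rotate t) ≡ size t
size-rotate leaf       = refl
size-rotate (node u v) = size-cons u v

rotate↭ : ∀ n → map rotate (trees n) ↭ trees n
rotate↭ n = bijection⇒↭ rotate (treesBelow-unique n n) (treesBelow-unique n n)
  (λ {t} m → complete (trans (size-rotate t) (treesBelow⁻ n n m)))
  (λ {t} {t′} _ _ e → trans (sym (unrotate-rotate t)) (trans (cong unrotate e) (unrotate-rotate t′)))
  (λ {t} m → unrotate t , complete (trans (sym (size-rotate (unrotate t))) (trans (cong size (rotate-unrotate t)) (treesBelow⁻ n n m))) , rotate-unrotate t)
  where
  complete : ∀ {t} → size t ≡ n → t ∈ trees n
  complete {t} refl = treesBelow⁺ n t ℕ.≤-refl

-- The permutation of a partition

-- The cyclic successor within a block, as a specification of `toPerm` free of its list searches: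
-- `forward` goes to the next occurrence of the label, `backward` from the last occurrence around to
-- the first.
data Next (p : List ℕ) : ℕ → ℕ → Set where
  forward  : ∀ {i j} → i < j → j < length p → at p j ≡ at p i →
             (∀ {k} → i < k → k < j → at p k ≢ at p i) → Next p i j
  backward : ∀ {i j} → j ≤ i → i < length p → at p j ≡ at p i →
             (∀ {k} → k < j → at p k ≢ at p i) →
             (∀ {k} → i < k → k < length p → at p k ≢ at p i) → Next p i j

firstOr-applyUpTo : ∀ {P : ℕ → Bool} d (f : ℕ → ℕ) m {k} → k < m → (∀ {l} → l < k → P (f l) ≡ false) →
                    P (f k) ≡ true → firstOr d P (applyUpTo f m) ≡ f k
firstOr-applyUpTo d f (suc m) {zero}  l       h e rewrite e = refl
firstOr-applyUpTo d f (suc m) {suc k} (s≤s l) h e rewrite h {0} z<s = firstOr-applyUpTo d (f ∘ suc) m l (h ∘ s<s) e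

private
  module ToPerm (p : List ℕ) (i : ℕ) where

    n : ℕ
    n = length p

    same : ℕ → Bool
    same j = at p j ≡ᵇ at p i

    later : List ℕ
    later = map (λ k → suc (i + k)) (upTo (n ∸ suc i))

    toPerm-next : ∀ {j} → Next p i j → firstOr (firstOr i same (upTo n)) same later ≡ j
    toPerm-next (forward {j = j} i<j j<n e h) =
      trans (cong (firstOr _ same) (List.map-upTo (λ k → suc (i + k)) (n ∸ suc i)))
        (trans (firstOr-applyUpTo {same} _ (λ k → suc (i + k)) (n ∸ suc i) (ℕ.∸-monoˡ-< j<n i<j)
          (λ {l} l< → ≢ᵇ⁺ (h (s≤s (ℕ.m≤m+n i l)) (subst (suc (i + l) <_) j≡ (s≤s (ℕ.+-monoʳ-< i l<)))))
          (≡ᵇ⁺ (trans (cong (at p) j≡) e))) j≡)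
      where
      j≡ : suc (i + (j ∸ suc i)) ≡ j
      j≡ = ℕ.m+[n∸m]≡n i<j
    toPerm-next (backward {j = j} j≤i i<n e h h′) =
      trans (firstOr-miss _ later none)
        (firstOr-applyUpTo {same} i id n (ℕ.≤-<-trans j≤i i<n) (λ l< → ≢ᵇ⁺ (h l<)) (≡ᵇ⁺ e))
      where
      none : ∀ {x} → x ∈ later → same x ≡ false
      none m with ∈-map⁻ (λ k → suc (i + k)) m
      ... | k , k∈ , refl = ≢ᵇ⁺ (h′ (s≤s (ℕ.m≤m+n i k))
        (ℕ.<-≤-trans (ℕ.+-monoʳ-< (suc i) (∈-upTo⁻ k∈))
          (ℕ.≤-reflexive (ℕ.m+[n∸m]≡n i<n))))

toPerm-next : ∀ p {i j} → Next p i j → toPerm (length p) p i ≡ j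
toPerm-next p {i} = ToPerm.toPerm-next p i

next-< : ∀ {p i j} → Next p i j → i < length p × j < length p
next-< (forward i<j j<n _ _)      = ℕ.<-trans i<j j<n , j<n
next-< (backward j≤i i<n _ _ _)   = i<n , ℕ.≤-<-trans j≤i i<n

at-∈ : ∀ xs {i} → i < length xs → at xs i ∈ xs
at-∈ (x ∷ xs) {zero}  l       = here refl
at-∈ (x ∷ xs) {suc i} (s≤s l) = there (at-∈ xs l)

next-map : ∀ a {p i j} → Next p i j → Next (map (a +_) p) i j
next-map a {p} (forward i<j j<n e h) = forward i<j (subst (_ <_) (sym len) j<n)
  (trans (at-map (a +_) p j<n) (trans (cong (a +_) e) (sym (at-map (a +_) p (ℕ.<-trans i<j j<n)))))
  (λ i<k k<j q → h i<k k<j (ℕ.+-cancelˡ-≡ a _ _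
    (trans (sym (at-map (a +_) p (ℕ.<-trans k<j j<n))) (trans q (at-map (a +_) p (ℕ.<-trans i<j j<n))))))
  where
  len : length (map (a +_) p) ≡ length p
  len = List.length-map (a +_) p
next-map a {p} (backward j≤i i<n e h h′) = backward j≤i (subst (_ <_) (sym len) i<n)
  (trans (at-map (a +_) p (ℕ.≤-<-trans j≤i i<n)) (trans (cong (a +_) e) (sym (at-map (a +_) p i<n))))
  (λ k<j → back (ℕ.<-trans k<j (ℕ.≤-<-trans j≤i i<n)) (h k<j))
  (λ i<k k<n → back (subst (_ <_) len k<n) (h′ i<k (subst (_ <_) len k<n)))
  where
  len : length (map (a +_) p) ≡ length p
  len = List.length-map (a +_) p
  back : ∀ {k} → k < length p → at p k ≢ at p _ → at (map (a +_) p) k ≢ at (map (a +_) p) _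
  back k<n ne q = ne (ℕ.+-cancelˡ-≡ a _ _ (trans (sym (at-map (a +_) p k<n)) (trans q (at-map (a +_) p i<n))))

-- A forward step is not affected by what is appended, while a step around the block survives only
-- if the label does not recur.
next-++ˡ : ∀ {xs ys i j} → Next xs i j → at xs i ∉ ys ⊎ i < j → Next (xs ++ ys) i j
next-++ˡ {xs} {ys} {i} {j} nx d with next-< nx
... | li , lj = go nx d
  where
  up : ∀ {k} → k < length xs → k < length (xs ++ ys)
  up l = subst (_ <_) (sym (List.length-++ xs)) (ℕ.<-≤-trans l (ℕ.m≤m+n _ _))
  e : at (xs ++ ys) i ≡ at xs i
  e = at-++ˡ xs li
  left : ∀ {k} → k < length xs → at xs k ≢ at xs i → at (xs ++ ys) k ≢ at (xs ++ ys) i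
  left lk ne q = ne (trans (sym (at-++ˡ xs lk)) (trans q e))
  go : Next xs i j → at xs i ∉ ys ⊎ i < j → Next (xs ++ ys) i j
  go (forward i<j j<n q h) _ = forward i<j (up j<n) (trans (at-++ˡ xs lj) (trans q (sym e)))
    (λ i<k k<j → left (ℕ.<-trans k<j j<n) (h i<k k<j))
  go (backward j≤i i<n q h h′) (inj₂ i<j) = ⊥-elim (ℕ.<⇒≱ i<j j≤i)
  go (backward j≤i i<n q h h′) (inj₁ ∉ys) = backward j≤i (up i<n) (trans (at-++ˡ xs lj) (trans q (sym e)))
    (λ k<j → left (ℕ.<-trans k<j lj) (h k<j)) after
    where
    after : ∀ {k} → i < k → k < length (xs ++ ys) → at (xs ++ ys) k ≢ at (xs ++ ys) i
    after {k} i<k k<n with k ℕ.<? length xs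
    ... | yes l = left l (h′ i<k l)
    ... | no ≥ = λ q → ∉ys (subst (_∈ ys) (trans (sym (at-++ʳ xs (k ∸ length xs))) (trans (cong (at (xs ++ ys)) k≡) (trans q e)))
                   (at-∈ ys (ℕ.+-cancelˡ-< (length xs) _ _ (subst₂ _<_ (sym k≡) (List.length-++ xs) k<n))))
      where
      k≡ : length xs + (k ∸ length xs) ≡ k
      k≡ = ℕ.m+[n∸m]≡n (ℕ.≮⇒≥ ≥)

next-++ʳ : ∀ {xs ys i j} → Next ys i j → at ys i ∉ xs → Next (xs ++ ys) (length xs + i) (length xs + j)
next-++ʳ {xs} {ys} {i} {j} nx ∉xs = go nx
  where
  a : ℕ
  a = length xs
  up : ∀ {k} → k < length ys → a + k < length (xs ++ ys)
  up l = subst (_ <_) (sym (List.length-++ xs)) (ℕ.+-monoʳ-< a l)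
  left : ∀ {k} → k < a → at (xs ++ ys) k ≢ at (xs ++ ys) (a + i)
  left {k} l q = ∉xs (subst (_∈ xs) (trans (sym (at-++ˡ xs l)) (trans q (at-++ʳ xs i))) (at-∈ xs l))
  right : ∀ {k} → at ys k ≢ at ys i → at (xs ++ ys) (a + k) ≢ at (xs ++ ys) (a + i)
  right ne q = ne (trans (sym (at-++ʳ xs _)) (trans q (at-++ʳ xs i)))
  eq : at ys j ≡ at ys i → at (xs ++ ys) (a + j) ≡ at (xs ++ ys) (a + i)
  eq q = trans (at-++ʳ xs j) (trans q (sym (at-++ʳ xs i)))
  shifted : ∀ {k} → a ≤ k → ∃ λ l → a + l ≡ k
  shifted h = _ , ℕ.m+[n∸m]≡n h
  go : Next ys i j → Next (xs ++ ys) (a + i) (a + j)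
  go (forward i<j j<n q h) = forward (ℕ.+-monoʳ-< a i<j) (up j<n) (eq q) between
    where
    between : ∀ {k} → a + i < k → k < a + j → at (xs ++ ys) k ≢ at (xs ++ ys) (a + i)
    between {k} i<k k<j with shifted (ℕ.≤-trans (ℕ.m≤m+n a i) (ℕ.<⇒≤ i<k))
    ... | l , refl = right (h (ℕ.+-cancelˡ-< a _ _ i<k) (ℕ.+-cancelˡ-< a _ _ k<j))
  go (backward j≤i i<n q h h′) = backward (ℕ.+-monoʳ-≤ a j≤i) (up i<n) (eq q) before after
    where
    before : ∀ {k} → k < a + j → at (xs ++ ys) k ≢ at (xs ++ ys) (a + i)
    before {k} k<j with k ℕ.<? a
    ... | yes l = left l
    ... | no l with shifted (ℕ.≮⇒≥ l)
    ...   | k′ , refl = right (h (ℕ.+-cancelˡ-< a _ _ k<j))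
    after : ∀ {k} → a + i < k → k < length (xs ++ ys) → at (xs ++ ys) k ≢ at (xs ++ ys) (a + i)
    after {k} i<k k<n with shifted (ℕ.≤-trans (ℕ.m≤m+n a i) (ℕ.<⇒≤ i<k))
    ... | l , refl = right (h′ (ℕ.+-cancelˡ-< a _ _ i<k) (ℕ.+-cancelˡ-< a _ _ (subst (a + l <_) (List.length-++ xs) k<n)))

next-labels : ∀ t {i} → i < size t → Next (labels t) i (at (perm t) i)
next-block  : ∀ t {i} → i < size t → Next (block t) i (suc (at (inverse t) i))
next-block-last : ∀ t → Next (block t) (size t) 0

block-0 : ∀ t → at (block t) 0 ≡ 0
block-0 t with block t | block-head t
... | _ | _ , refl = refl

block-size : ∀ t → at (block t) (size t) ≡ 0
block-size t with block-last t
... | xs , e = trans (cong (λ z → at z (size t)) e) (at-∷ʳ-last xs (ℕ.suc-injective (begin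
  suc (length xs)      ≡⟨ ℕ.+-comm (length xs) 1 ⟨
  length xs + 1        ≡⟨ List.length-++ xs ⟨
  length (xs ++ [ 0 ]) ≡⟨ cong length e ⟨
  length (block t)     ≡⟨ length-block t ⟩
  suc (size t) ∎)))
  where open ≡-Reasoning

gap : Tree → Tree → List ℕ
gap L R = map (suc (inner L) +_) (labels R)

next-gap : ∀ L R {i} → i < size R → Next (block (node L R)) (size L + suc i) (suc (size L + at (perm R) i))
next-gap L R {i} l = subst₂ (Next (block (node L R))) (trans (cong (_+ i) (length-block L)) (sym (ℕ.+-suc (size L) i)))
  (cong (_+ at (perm R) i) (length-block L))
  (next-++ʳ {block L} (next-++ˡ {gap L R} {[ 0 ]} (next-map (suc (inner L)) (next-labels R l)) (inj₁ ∉0)) ∉block)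
  where
  l′ : i < length (gap L R)
  l′ = subst (i <_) (sym (trans (List.length-map _ (labels R)) (length-labels R))) l
  ∉0 : at (gap L R) i ∉ [ 0 ]
  ∉0 (here e) = 0∉gap (inner L) (labels R) (subst (_∈ gap L R) e (at-∈ (gap L R) l′))
  ∉block : at (gap L R ++ [ 0 ]) i ∉ block L
  ∉block m = block-disjoint L R (m , subst (_∈ gap L R) (sym (at-++ˡ (gap L R) l′)) (at-∈ (gap L R) l′))

at-gap : ∀ L R {k} → size L < k → k < suc (size L + size R) → at (block (node L R)) k ≢ 0
at-gap L R {k} l h q = 0∉gap (inner L) (labels R) (subst (_∈ gap L R) e (at-∈ (gap L R) k′<))
  where
  k′ : ℕ
  k′ = k ∸ suc (size L)
  k≡ : suc (size L) + k′ ≡ k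
  k≡ = ℕ.m+[n∸m]≡n l
  k′< : k′ < length (gap L R)
  k′< = subst (k′ <_) (sym (trans (List.length-map _ (labels R)) (length-labels R))) (ℕ.+-cancelˡ-< (suc (size L)) _ _ (subst (_< _) (sym k≡) h))
  e : at (gap L R) k′ ≡ 0
  e = begin
    at (gap L R) k′                                   ≡⟨ at-++ˡ (gap L R) k′< ⟨
    at (gap L R ++ [ 0 ]) k′                          ≡⟨ at-++ʳ (block L) k′ ⟨
    at (block (node L R)) (length (block L) + k′)     ≡⟨ cong (at (block (node L R))) (trans (cong (_+ k′) (length-block L)) k≡) ⟩
    at (block (node L R)) k                           ≡⟨ q ⟩
    0 ∎
    where open ≡-Reasoning

next-labels (node L R) l with viewLast (size L) (size R) l
... | inLeft {i} h rewrite perm-left L R h = next-++ˡ (next-labels L h)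
      (inj₁ λ m → labels-disjoint L R (at-∈ (labels L) (subst (i <_) (sym (length-labels L)) h) , m))
... | inRight {j} h rewrite perm-mid L R h = shifted (next-block R h)
  where
  shifted : ∀ {k} → Next (block R) j k → Next (labels (node L R)) (size L + j) (size L + k)
  shifted {k} nx = subst (λ z → Next (labels (node L R)) (z + j) (z + k)) (length-labels L)
    (next-++ʳ {labels L} (next-map (blocks L) nx) (λ m → labels-disjoint L R (m , at-∈ (map (blocks L +_) (block R))
      (subst (j <_) (sym (trans (List.length-map _ (block R)) (length-block R))) (ℕ.m<n⇒m<1+n h)))))
... | isLast rewrite perm-last L R = subst₂ (Next (labels (node L R))) (cong (_+ size R) (length-labels L))
    (trans (cong (_+ 0) (length-labels L)) (ℕ.+-identityʳ _))
    (next-++ʳ {labels L} (next-map (blocks L) (next-block-last R)) (λ m → labels-disjoint L R (m , at-∈ (map (blocks L +_) (block R))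
      (subst (size R <_) (sym (trans (List.length-map _ (block R)) (length-block R))) (ℕ.n<1+n (size R))))))

next-block (node L R) l with viewFirst (size L) (size R) l
... | inLeft {i} h rewrite inverse-left L R h = next-++ˡ nx (fresh nx)
  where
  nx : Next (block L) i (suc (at (inverse L) i))
  nx = next-block L h
  -- A step around the block from some `i < size L` cannot concern label 0, since that label occurs
  -- again at position `size L`.
  fresh : Next (block L) i (suc (at (inverse L) i)) → at (block L) i ∉ gap L R ++ [ 0 ] ⊎ i < suc (at (inverse L) i)
  fresh (forward i<j _ _ _) = inj₂ i<j
  fresh (backward _ _ _ _ h′) = inj₁ λ m → [ (λ m′ → block-disjoint L R (at-∈ (block L) (subst (i <_) (sym (length-block L)) (ℕ.m<n⇒m<1+n h)) , m′))
    , (λ { (here e) → h′ h (subst (size L <_) (sym (length-block L)) (ℕ.n<1+n _)) (trans (block-size L) (sym e)) }) ]′ (∈-++⁻ (gap L R) m)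
... | isFirst rewrite inverse-first L R = forward (s≤s (ℕ.m≤m+n (size L) (size R)))
    (subst (suc (size L + size R) <_) (sym (length-block (node L R))) (ℕ.n<1+n _))
    (trans (block-size (node L R)) (sym e)) (λ l h q → at-gap L R l h (trans q e))
  where
  e : at (block (node L R)) (size L) ≡ 0
  e = trans (at-++ˡ (block L) (subst (size L <_) (sym (length-block L)) (ℕ.n<1+n _))) (block-size L)
... | inRight {j} h rewrite inverse-mid L R h = next-gap L R h

next-block-last t = backward z≤n (subst (size t <_) (sym (length-block t)) (ℕ.n<1+n _))
  (trans (block-0 t) (sym (block-size t))) (λ ())
  (λ l h → ⊥-elim (ℕ.<⇒≱ (subst (_ <_) (length-block t) h) l))

toPerm-labels : ∀ t {i} → i < size t → toPerm (size t) (labels t) i ≡ at (perm t) i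
toPerm-labels t {i} l = subst (λ z → toPerm z (labels t) i ≡ at (perm t) i) (length-labels t) (toPerm-next (labels t) (next-labels t l))

-- Labels and block sizes

filterᵇ-upTo : ∀ (P : ℕ → Bool) n b → b ≤ n → (∀ {l} → l < b → P l ≡ true) → (∀ {l} → b ≤ l → P l ≡ false) →
               filterᵇ P (upTo n) ≡ upTo b
filterᵇ-upTo P n b h t f = go id n b h t f
  where
  go : ∀ (g : ℕ → ℕ) n b → b ≤ n → (∀ {l} → l < b → P (g l) ≡ true) → (∀ {l} → b ≤ l → P (g l) ≡ false) →
       filterᵇ P (applyUpTo g n) ≡ applyUpTo g b
  go g zero    zero    h t f = refl
  go g (suc n) zero    h t f with P (g 0) | f {0} z≤n
  ... | false | refl = go (g ∘ suc) n zero z≤n (λ ()) (λ _ → f z≤n)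
  go g (suc n) (suc b) (s≤s h) t f with P (g 0) | t {0} z<s
  ... | true | refl = cong (g 0 ∷_) (go (g ∘ suc) n b h (t ∘ s<s) (f ∘ s≤s))

∈⇒at : ∀ {x : ℕ} {xs} → x ∈ xs → ∃ λ i → i < length xs × at xs i ≡ x
∈⇒at (here refl) = 0 , z<s , refl
∈⇒at (there m) with ∈⇒at m
... | i , l , e = suc i , s<s l , e

blockLabels-labels : ∀ t → blockLabels (size t) (labels t) ≡ upTo (blocks t)
blockLabels-labels t = filterᵇ-upTo _ (size t) (blocks t)
  (subst (blocks t ≤_) (length-labels t) (grow-length (grow-labels t)))
  occurs absent
  where
  occurs : ∀ {l} → l < blocks t → any (λ i → at (labels t) i ≡ᵇ l) (upTo (size t)) ≡ true
  occurs l< with ∈⇒at (grow-onto (grow-labels t) z≤n l<)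
  ... | i , i< , e = anyUpTo⁺ {n = size t} (subst (i <_) (length-labels t) i<) (≡ᵇ⁺ e)
  absent : ∀ {l} → blocks t ≤ l → any (λ i → at (labels t) i ≡ᵇ l) (upTo (size t)) ≡ false
  absent {l} h = ¬true⇒false λ e → let i , i< , q = anyUpTo⁻ {n = size t} e in
    ℕ.<⇒≱ (subst (_< blocks t) (≡ᵇ⁻ q) (at-All (grow-bounded (grow-labels t)) (subst (i <_) (sym (length-labels t)) i<))) h

occurrences : ℕ → List ℕ → ℕ
occurrences l = countB (_≡ᵇ l)

blockSize-occurrences : ∀ p l → blockSize (length p) p l ≡ occurrences l p
blockSize-occurrences p l = go id p (λ _ → refl)
  where
  go : ∀ (g : ℕ → ℕ) q → (∀ i → at p (g i) ≡ at q i) → countB (λ i → at p i ≡ᵇ l) (applyUpTo g (length q)) ≡ occurrences l q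
  go g []      h = refl
  go g (x ∷ q) h rewrite h 0 | go (g ∘ suc) q (h ∘ suc) = refl

≡ᵇ-+ : ∀ a x l → (a + x ≡ᵇ a + l) ≡ (x ≡ᵇ l)
≡ᵇ-+ zero    x l = refl
≡ᵇ-+ (suc a) x l = ≡ᵇ-+ a x l

occurrences-map-≥ : ∀ a l xs → occurrences (a + l) (map (a +_) xs) ≡ occurrences l xs
occurrences-map-≥ a l []       = refl
occurrences-map-≥ a l (x ∷ xs) rewrite occurrences-map-≥ a l xs | ≡ᵇ-+ a x l = refl

occurrences-∉ : ∀ l xs → l ∉ xs → occurrences l xs ≡ 0
occurrences-∉ l []       h = refl
occurrences-∉ l (x ∷ xs) h rewrite ≢ᵇ⁺ {x} {l} (λ e → h (here (sym e))) = occurrences-∉ l xs (h ∘ there)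

-- Interval partitions

at-ext : ∀ xs ys → length xs ≡ length ys → (∀ {i} → i < length xs → at xs i ≡ at ys i) → xs ≡ ys
at-ext []       []       e h = refl
at-ext (x ∷ xs) (y ∷ ys) e h = cong₂ _∷_ (h z<s) (at-ext xs ys (ℕ.suc-injective e) (h ∘ s<s))

level : (ℕ → Bool) → ℕ → ℕ
level S zero    = 0
level S (suc i) = level S i + 𝟙 (S i)

level-shift : ∀ S i → level S (suc i) ≡ 𝟙 (S 0) + level (S ∘ suc) i
level-shift S zero    = sym (ℕ.+-identityʳ _)
level-shift S (suc i) = trans (cong (_+ 𝟙 (S (suc i))) (level-shift S i)) (ℕ.+-assoc (𝟙 (S 0)) _ _)

level-mono : ∀ S {i j} → i ≤ j → level S i ≤ level S j
level-mono S {i} {zero}  z≤n = z≤n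
level-mono S {i} {suc j} h with i ℕ.≟ suc j
... | yes refl = ℕ.≤-refl
... | no ne = ℕ.≤-trans (level-mono S (ℕ.≤-pred (ℕ.≤∧≢⇒< h ne))) (ℕ.m≤m+n _ _)

blocks-level : ∀ S m → blocks (interval S m) ≡ suc (level S m)
blocks-level S zero    = refl
blocks-level S (suc m) with S m
... | true  = cong (_+ 1) (blocks-level S m)
... | false = trans (blocks-extend (interval S m)) (trans (blocks-level S m) (cong suc (sym (ℕ.+-identityʳ _))))

private
  lastLabel : ∀ t {m} → size t ≡ suc m → at (labels t) m ≡ pred (blocks t) → at (labels (extend t)) (suc m) ≡ pred (blocks t)
  lastLabel (node L R) {m} e h = begin
    at (labels (extend (node L R))) (suc m)
      ≡⟨ cong₂ at (extend-labels) (sym (trans (ℕ.+-identityʳ _) (trans (length-labels (node L R)) e))) ⟩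
    at (labels (node L R) ++ [ blocks L + 0 ]) (length (labels (node L R)) + 0)
      ≡⟨ at-++ʳ (labels (node L R)) 0 ⟩
    blocks L + 0
      ≡⟨ cong (blocks L +_) (block-size R) ⟨
    blocks L + at (block R) (size R)
      ≡⟨ at-map (blocks L +_) (block R) (subst (size R <_) (sym (length-block R)) (ℕ.n<1+n _)) ⟨
    at (map (blocks L +_) (block R)) (size R)
      ≡⟨ at-++ʳ (labels L) (size R) ⟨
    at (labels (node L R)) (length (labels L) + size R)
      ≡⟨ cong (at (labels (node L R))) (trans (cong (_+ size R) (length-labels L)) (ℕ.suc-injective e)) ⟩
    at (labels (node L R)) m
      ≡⟨ h ⟩
    pred (blocks (node L R)) ∎
    where
    open ≡-Reasoning
    extend-labels : labels (extend (node L R)) ≡ labels (node L R) ++ [ blocks L + 0 ]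
    extend-labels = trans (cong (labels L ++_) (List.map-++ (blocks L +_) (block R) [ 0 ])) (sym (List.++-assoc (labels L) _ _))

  labels-extend-< : ∀ t {i} → i < size t → at (labels (extend t)) i ≡ at (labels t) i
  labels-extend-< (node L R) {i} l = trans (cong (λ z → at z i)
    (trans (cong (labels L ++_) (List.map-++ (blocks L +_) (block R) [ 0 ])) (sym (List.++-assoc (labels L) _ _))))
    (at-++ˡ (labels (node L R)) (subst (i <_) (sym (length-labels (node L R))) l))

labels-interval : ∀ S m {i} → i < suc m → at (labels (interval S m)) i ≡ level S i
labels-interval S zero    {zero}  l        = refl
labels-interval S zero    {suc i} (s≤s ())
labels-interval S (suc m) {i} l with S m in e | i ℕ.≟ suc m
... | true | yes refl = begin
  at (labels t ++ [ blocks t + 0 ]) (suc m)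
    ≡⟨ at-∷ʳ-last (labels t) (trans (length-labels t) (size-interval S m)) ⟩
  blocks t + 0             ≡⟨ ℕ.+-identityʳ _ ⟩
  blocks t                 ≡⟨ blocks-level S m ⟩
  suc (level S m)          ≡⟨ ℕ.+-comm (level S m) 1 ⟨
  level S m + 1            ≡⟨ cong (λ z → level S m + 𝟙 z) e ⟨
  level S (suc m) ∎
  where
  open ≡-Reasoning
  t : Tree
  t = interval S m
... | true | no h = trans (at-++ˡ (labels (interval S m)) (subst (i <_) (sym (trans (length-labels (interval S m)) (size-interval S m))) l′)) (labels-interval S m l′)
  where
  l′ : i < suc m
  l′ = ℕ.≤∧≢⇒< (ℕ.≤-pred l) h
... | false | yes refl = begin
  at (labels (extend t)) (suc m)  ≡⟨ lastLabel t (size-interval S m) (trans (labels-interval S m (ℕ.n<1+n m)) (sym p≡)) ⟩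
  pred (blocks t)                 ≡⟨ p≡ ⟩
  level S m                       ≡⟨ ℕ.+-identityʳ _ ⟨
  level S m + 0                   ≡⟨ cong (λ z → level S m + 𝟙 z) e ⟨
  level S (suc m) ∎
  where
  open ≡-Reasoning
  t : Tree
  t = interval S m
  p≡ : pred (blocks t) ≡ level S m
  p≡ = cong pred (blocks-level S m)
... | false | no h = trans (labels-extend-< (interval S m) (subst (i <_) (sym (size-interval S m)) l′)) (labels-interval S m l′)
  where
  l′ : i < suc m
  l′ = ℕ.≤∧≢⇒< (ℕ.≤-pred l) h

length-interval : ∀ S m → length (labels (interval S m)) ≡ suc m
length-interval S m = trans (length-labels (interval S m)) (size-interval S m)

∈-Int⁺ : ∀ S m → labels (interval S m) ∈ Int (suc m)
∈-Int⁺ S m = ∈-filterᵇ⁺ (isInt (suc m)) (subst (λ z → p ∈ Partitions z) (length-interval S m) (Partitions⁺ (grow-labels (interval S m))))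
  (allUpTo⁺ {n = n} λ {a} la → allUpTo⁺ {n = n} λ {b} lb → allUpTo⁺ {n = n} λ {c} lc → body a b c la lb lc)
  where
  n : ℕ
  n = suc m
  p : List ℕ
  p = labels (interval S m)
  body : ∀ a b c → a < n → b < n → c < n →
         (not ((a <ᵇ c) ∧ (c <ᵇ b) ∧ (at p a ≡ᵇ at p b)) ∨ (at p c ≡ᵇ at p a)) ≡ true
  body a b c la lb lc with (a <ᵇ c) ∧ (c <ᵇ b) ∧ (at p a ≡ᵇ at p b) in e
  ... | false = refl
  ... | true with ∧-true⁻ {a <ᵇ c} e
  ...   | ac , e₁ with ∧-true⁻ {c <ᵇ b} e₁
  ...     | cb , ab = ≡ᵇ⁺ (trans (labels-interval S m lc) (trans (ℕ.≤-antisym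
      (ℕ.≤-trans (level-mono S {c} {b} (ℕ.<⇒≤ (<ᵇ⁻ cb))) (ℕ.≤-reflexive (trans (sym (labels-interval S m lb)) (trans (sym (≡ᵇ⁻ {at p a} ab)) (labels-interval S m la)))))
      (level-mono S {a} {c} (ℕ.<⇒≤ (<ᵇ⁻ ac)))) (sym (labels-interval S m la))))

-- Enumeration of interval partitions by bit lists

bits : ℕ → List (List Bool)
bits zero    = [ [] ]
bits (suc m) = map (false ∷_) (bits m) ++ map (true ∷_) (bits m)

fn : List Bool → ℕ → Bool
fn []       i       = false
fn (b ∷ bs) zero    = b
fn (b ∷ bs) (suc i) = fn bs i

bits⁺ : ∀ bs → bs ∈ bits (length bs)
bits⁺ []           = here refl
bits⁺ (false ∷ bs) = ∈-++⁺ˡ (∈-map⁺ (false ∷_) (bits⁺ bs))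
bits⁺ (true ∷ bs)  = ∈-++⁺ʳ (map (false ∷_) (bits (length bs))) (∈-map⁺ (true ∷_) (bits⁺ bs))

bits⁻ : ∀ m {bs} → bs ∈ bits m → length bs ≡ m
bits⁻ zero    (here refl) = refl
bits⁻ (suc m) h with ∈-++⁻ (map (false ∷_) (bits m)) h
... | inj₁ h′ with ∈-map⁻ (false ∷_) h′
...   | _ , h″ , refl = cong suc (bits⁻ m h″)
bits⁻ (suc m) h | inj₂ h′ with ∈-map⁻ (true ∷_) h′
...   | _ , h″ , refl = cong suc (bits⁻ m h″)

bits-unique : ∀ m → Unique (bits m)
bits-unique zero    = [] ∷ []
bits-unique (suc m) = Unique.++⁺ (Unique.map⁺ List.∷-injectiveʳ (bits-unique m)) (Unique.map⁺ List.∷-injectiveʳ (bits-unique m)) disjoint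
  where
  disjoint : Disjoint (map (false ∷_) (bits m)) (map (true ∷_) (bits m))
  disjoint (a , b) with ∈-map⁻ (false ∷_) a | ∈-map⁻ (true ∷_) b
  ... | _ , _ , refl | _ , _ , ()

fn-ext : ∀ bs bs′ → length bs ≡ length bs′ → (∀ {i} → i < length bs → fn bs i ≡ fn bs′ i) → bs ≡ bs′
fn-ext []       []         e h = refl
fn-ext (b ∷ bs) (b′ ∷ bs′) e h = cong₂ _∷_ (h z<s) (fn-ext bs bs′ (ℕ.suc-injective e) (h ∘ s<s))

private
  𝟙-injective : ∀ {a b} → 𝟙 a ≡ 𝟙 b → a ≡ b
  𝟙-injective {false} {false} e = refl
  𝟙-injective {true}  {true}  e = refl

  isInt⁻ : ∀ p → isInt (length p) p ≡ true → ∀ {x y} → x ≢ y → ¬ ((x ∷ y ∷ x ∷ []) ⊆ p)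
  isInt⁻ p h ne τ with ⊆-index 0 p τ
  ... | a , _ , la , refl , τ₁ with ⊆-index (suc a) p τ₁
  ... | c , a<c , lc , refl , τ₂ with ⊆-index (suc c) p τ₂
  ... | b , c<b , lb , eb , _
    with (a <ᵇ c) ∧ (c <ᵇ b) ∧ (at p a ≡ᵇ at p b) | ∧-true⁺ (<ᵇ⁺ a<c) (∧-true⁺ (<ᵇ⁺ c<b) (≡ᵇ⁺ {at p a} (sym eb)))
       | allUpTo⁻ {n = length p} (allUpTo⁻ {n = length p} (allUpTo⁻ {n = length p} h la) lb) lc
  ... | _ | refl | q = ne (sym (≡ᵇ⁻ q))

  -- The growth string of an interval partition is a staircase that rises exactly after the block
  -- ends.
  steps : ℕ → List Bool → List ℕ
  steps c []       = [ c ]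
  steps c (b ∷ bs) = c ∷ steps (c + 𝟙 b) bs

  length-steps : ∀ c bs → length (steps c bs) ≡ suc (length bs)
  length-steps c []       = refl
  length-steps c (b ∷ bs) = cong suc (length-steps _ bs)

  at-steps : ∀ c bs {i} → i < suc (length bs) → at (steps c bs) i ≡ c + level (fn bs) i
  at-steps c []       {zero}  l       = sym (ℕ.+-identityʳ c)
  at-steps c []       {suc i} (s≤s ())
  at-steps c (b ∷ bs) {zero}  l       = sym (ℕ.+-identityʳ c)
  at-steps c (b ∷ bs) {suc i} (s≤s l) = trans (at-steps (c + 𝟙 b) bs l)
    (trans (ℕ.+-assoc c (𝟙 b) _) (cong (c +_) (sym (level-shift (fn (b ∷ bs)) i))))

  -- Every label below the current `c` lies in `pre`. If the next label were one of these, say `x`,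
  -- the string would contain x c x; so it is `c` again or new.
  toSteps : ∀ {p} → (∀ {x y} → x ≢ y → ¬ ((x ∷ y ∷ x ∷ []) ⊆ p)) → ∀ pre c suf {k} → p ≡ pre ++ c ∷ suf →
            Grow (suc c) suf k → (∀ {l} → l < c → l ∈ pre) → ∃ λ bs → length bs ≡ length suf × c ∷ suf ≡ steps c bs
  toSteps h pre c []        e g        o = [] , refl , refl
  toSteps h pre c (x ∷ suf) e (new g)  o
    with toSteps h (pre ++ [ c ]) (suc c) suf (trans e (sym (List.++-assoc pre [ c ] (suc c ∷ suf)))) g o′
    where
    o′ : ∀ {l} → l < suc c → l ∈ pre ++ [ c ]
    o′ {l} l< with l ℕ.≟ c
    ... | yes refl = ∈-++⁺ʳ pre (here refl)
    ... | no ne    = ∈-++⁺ˡ (o (ℕ.≤∧≢⇒< (ℕ.≤-pred l<) ne))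
  ... | bs , e₁ , e₂ = true ∷ bs , cong suc e₁ , cong (c ∷_) (trans e₂ (cong (λ z → steps z bs) (ℕ.+-comm 1 c)))
  toSteps h pre c (x ∷ suf) e (old l g) o with x ℕ.≟ c
  ... | no ne = ⊥-elim (h ne (subst (_ ⊆_) (sym e) (Subₚ.++⁺ (∈⇒⊆ (o (ℕ.≤∧≢⇒< (ℕ.≤-pred l) ne))) (refl ∷ refl ∷ Subₚ.[]⊆-universal _))))
  ... | yes refl with toSteps h (pre ++ [ c ]) c suf (trans e (sym (List.++-assoc pre [ c ] (c ∷ suf)))) g (λ q → ∈-++⁺ˡ (o q))
  ...   | bs , e₁ , e₂ = false ∷ bs , cong suc e₁ , cong (c ∷_) (trans e₂ (cong (λ z → steps z bs) (sym (ℕ.+-identityʳ c))))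

∈-Int⁻ : ∀ m {p} → p ∈ Int (suc m) → ∃ λ bs → bs ∈ bits m × labels (interval (fn bs) m) ≡ p
∈-Int⁻ m {p} h with ∈-filterᵇ⁻ (isInt (suc m)) {xs = Partitions (suc m)} h
... | p∈ , int with Partitions⁻ {suc m} p∈
∈-Int⁻ m {c ∷ suf} h | p∈ , int | refl , k , new g
  with toSteps (isInt⁻ (c ∷ suf) int) [] 0 suf refl g (λ ())
... | bs , e₁ , e₂ = bs , subst (λ z → bs ∈ bits z) e₁ (bits⁺ bs) ,
  trans (at-ext _ _ (trans (length-interval (fn bs) m) (sym (trans (length-steps 0 bs) (cong suc e₁))))
    (λ {i} l → let l′ = subst (i <_) (length-interval (fn bs) m) l in
      trans (labels-interval (fn bs) m l′) (sym (at-steps 0 bs (subst (λ z → i < suc z) (sym e₁) l′))))) (sym e₂)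

bits↭Int : ∀ m → map (λ bs → labels (interval (fn bs) m)) (bits m) ↭ Int (suc m)
bits↭Int m = bijection⇒↭ _ (bits-unique m) (Unique.filter⁺ _ (growthStrings-unique (suc m) 0))
  (λ {bs} _ → ∈-Int⁺ (fn bs) m) injective′ (∈-Int⁻ m)
  where
  injective′ : ∀ {bs bs′} → bs ∈ bits m → bs′ ∈ bits m → labels (interval (fn bs) m) ≡ labels (interval (fn bs′) m) → bs ≡ bs′
  injective′ {bs} {bs′} b∈ b∈′ e = fn-ext bs bs′ (trans (bits⁻ m b∈) (sym (bits⁻ m b∈′))) λ {i} l →
    let l′ = subst (i <_) (bits⁻ m b∈) l in
    𝟙-injective (ℕ.+-cancelˡ-≡ (level (fn bs) i) _ _ (trans (same (s<s l′)) (cong (_+ 𝟙 (fn bs′ i)) (sym (same (ℕ.m<n⇒m<1+n l′))))))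
    where
    same : ∀ {i} → i < suc m → level (fn bs) i ≡ level (fn bs′) i
    same {i} l = trans (sym (labels-interval (fn bs) m l)) (trans (cong (λ z → at z i) e) (labels-interval (fn bs′) m l))

-- Kreweras complements of interval partitions

intervalPerm : (ℕ → Bool) → ℕ → ℕ → ℕ
intervalPerm S m = toPerm (suc m) (labels (interval S m))

module _ (S : ℕ → Bool) (m : ℕ) where

  intervalPerm-perm : ∀ {i} → i < suc m → intervalPerm S m i ≡ at (perm (interval S m)) i
  intervalPerm-perm {i} l = subst (λ z → toPerm z (labels (interval S m)) i ≡ at (perm (interval S m)) i) (size-interval S m)
    (toPerm-labels (interval S m) (subst (i <_) (sym (size-interval S m)) l))

  IsPerm-intervalPerm : IsPerm (suc m) (intervalPerm S m)
  IsPerm-intervalPerm = IsPerm-cong (λ l → sym (intervalPerm-perm l))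
    (subst (λ z → IsPerm z (at (perm (interval S m)))) (size-interval S m) (IsPerm-perm (interval S m)))

  perm-ι : ∀ {i} → i < suc m → at (perm (interval S m)) (ι S m i) ≡ i
  perm-ι {i} l = perm-inverse (interval S m) (subst (i <_) (sym (size-interval S m)) l)

  inv-intervalPerm : ∀ {i} → i < suc m → inv (suc m) (intervalPerm S m) i ≡ ι S m i
  inv-intervalPerm = inv-unique IsPerm-intervalPerm (ι S m) (bounded (IsPerm-ι S m))
    (λ l → trans (intervalPerm-perm (bounded (IsPerm-ι S m) l)) (perm-ι l))

  next-ι : ∀ {j} → j < suc m → Next (labels (interval S m)) (ι S m j) j
  next-ι {j} l = subst (Next (labels (interval S m)) (ι S m j)) (perm-ι l)
    (next-labels (interval S m) (subst (ι S m j <_) (sym (size-interval S m)) (bounded (IsPerm-ι S m) l)))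

γ-< : ∀ {m i} → i < m → γ (suc m) i ≡ suc i
γ-< l rewrite <ᵇ⁺ (s<s l) = refl

γ-end : ∀ m → γ (suc m) m ≡ 0
γ-end m rewrite ≮ᵇ⁺ {suc m} {suc m} ℕ.≤-refl = refl

IsPerm-γ : ∀ m → IsPerm (suc m) (γ (suc m))
IsPerm-γ m = leftInverse⇒IsPerm γ⁻¹ bounded′ left
  where
  γ⁻¹ : ℕ → ℕ
  γ⁻¹ zero    = m
  γ⁻¹ (suc i) = i
  bounded′ : ∀ {i} → i < suc m → γ (suc m) i < suc m
  bounded′ {i} l with i ℕ.≟ m
  ... | yes refl rewrite γ-end m = z<s
  ... | no ne rewrite γ-< (ℕ.≤∧≢⇒< (ℕ.≤-pred l) ne) = s<s (ℕ.≤∧≢⇒< (ℕ.≤-pred l) ne)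
  left : ∀ {i} → i < suc m → γ⁻¹ (γ (suc m) i) ≡ i
  left {i} l with i ℕ.≟ m
  ... | yes refl rewrite γ-end m = refl
  ... | no ne rewrite γ-< (ℕ.≤∧≢⇒< (ℕ.≤-pred l) ne) = refl

krPerm : (ℕ → Bool) → ℕ → ℕ → ℕ
krPerm S m = Kr (suc m) (intervalPerm S m)

krPerm-ι : ∀ S m {i} → i < suc m → krPerm S m i ≡ ι S m (γ (suc m) i)
krPerm-ι S m l = inv-intervalPerm S m (bounded (IsPerm-γ m) l)

-- The number `d` bounds the distance still to climb. Membership in `Z` is carried along only below
-- `m`, the point `m` being the target.
reach : ∀ {m} (f : ℕ → ℕ) (Z : ℕ → Set) → (∀ {i} → i < m → Z i → i < f i × f i ≤ m × (f i < m → Z (f i))) →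
        ∀ d {i} → m ≤ i + d → i ≤ m → (i < m → Z i) → ∃ λ k → iter f k i ≡ m
reach {m} f Z h zero    {i} b l z = 0 , ℕ.≤-antisym l (ℕ.≤-trans b (ℕ.≤-reflexive (ℕ.+-identityʳ i)))
reach {m} f Z h (suc d) {i} b l z with i ℕ.≟ m
... | yes e = 0 , e
... | no ne with h (ℕ.≤∧≢⇒< l ne) (z (ℕ.≤∧≢⇒< l ne))
...   | up , le , z′ with reach f Z h d (ℕ.≤-trans b (ℕ.≤-trans (ℕ.≤-reflexive (ℕ.+-suc i d)) (ℕ.+-monoˡ-≤ d up))) le z′
...     | k , e = suc k , trans (iter-suc f k i) e

-- κ is the Kreweras complement of the interval partition of S.
module KrInterval (S : ℕ → Bool) (m : ℕ) (κ : ℕ → ℕ) (κ-ι : ∀ {i} → i < suc m → κ i ≡ ι S m (γ (suc m) i)) where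

  IsPerm-κ : IsPerm (suc m) κ
  IsPerm-κ = IsPerm-cong (λ l → sym (κ-ι l)) (IsPerm-∘ (IsPerm-ι S m) (IsPerm-γ m))

  -- The last point ends a block whatever `S` says about it.
  End : ℕ → Set
  End x = x ≡ m ⊎ S x ≡ true

  private
    lab : ℕ → ℕ
    lab = at (labels (interval S m))

    next-end : ∀ {x} → x < suc m → (∀ {k} → x < k → k < length (labels (interval S m)) → lab k ≢ lab x) → End x
    next-end {x} x<n h with x ℕ.≟ m
    ... | yes e = inj₁ e
    ... | no ne with S x in e
    ...   | true  = inj₂ refl
    ...   | false = ⊥-elim (h (ℕ.n<1+n x) (subst (suc x <_) (sym (length-interval S m)) (s<s x<m)) (begin
        lab (suc x)              ≡⟨ labels-interval S m (s<s x<m) ⟩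
        level S x + 𝟙 (S x)     ≡⟨ cong (λ z → level S x + 𝟙 z) e ⟩
        level S x + 0            ≡⟨ ℕ.+-identityʳ _ ⟩
        level S x                ≡⟨ labels-interval S m x<n ⟨
        lab x ∎))
      where
      open ≡-Reasoning
      x<m : x < m
      x<m = ℕ.≤∧≢⇒< (ℕ.≤-pred x<n) ne

    forward-suc : ∀ {x i} → i < m → x < suc i → lab (suc i) ≡ lab x → (∀ {k} → x < k → k < suc i → lab k ≢ lab x) →
                  x ≡ i × S i ≡ false
    forward-suc {x} {i} i<m x<j e h with x ℕ.≟ i
    ... | yes refl = refl , 𝟙-zero (ℕ.+-cancelˡ-≡ (level S i) _ _ (begin
        level S i + 𝟙 (S i)   ≡⟨ labels-interval S m (s<s i<m) ⟨
        lab (suc i)            ≡⟨ e ⟩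
        lab i                  ≡⟨ labels-interval S m (ℕ.m<n⇒m<1+n i<m) ⟩
        level S i              ≡⟨ ℕ.+-identityʳ _ ⟨
        level S i + 0 ∎))
      where
      open ≡-Reasoning
      𝟙-zero : ∀ {b} → 𝟙 b ≡ 0 → b ≡ false
      𝟙-zero {false} _ = refl
    ... | no ne = ⊥-elim (h x<i (ℕ.n<1+n i) (ℕ.≤-antisym
        (ℕ.≤-trans (lab-mono (ℕ.m<n⇒m<1+n i<m) (s<s i<m) (ℕ.n≤1+n i)) (ℕ.≤-reflexive e))
        (lab-mono (ℕ.<-trans x<i (ℕ.m<n⇒m<1+n i<m)) (ℕ.m<n⇒m<1+n i<m) (ℕ.<⇒≤ x<i))))
      where
      x<i : x < i
      x<i = ℕ.≤∧≢⇒< (ℕ.≤-pred x<j) ne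
      lab-mono : ∀ {i j} → i < suc m → j < suc m → i ≤ j → lab i ≤ lab j
      lab-mono li lj h = subst₂ _≤_ (sym (labels-interval S m li)) (sym (labels-interval S m lj)) (level-mono S h)

    -- The value `κ i` is the cyclic predecessor of `i + 1` in its interval: the point `i` if both
    -- share an interval, and otherwise the end of the interval that begins at `i + 1`.
    κ-cases : ∀ {i} → i < m → (κ i ≡ i × S i ≡ false) ⊎ (S i ≡ true × i < κ i × κ i ≤ m × End (κ i))
    κ-cases {i} l = go (κ i) (trans (κ-ι (ℕ.m<n⇒m<1+n l)) (cong (ι S m) (γ-< l))) (next-ι S m (s<s l)) (bounded (IsPerm-ι S m) (s<s l))
      where
      go : ∀ (x : ℕ) → x ≡ ι S m (suc i) → Next (labels (interval S m)) (ι S m (suc i)) (suc i) → ι S m (suc i) < suc m →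
           (x ≡ i × S i ≡ false) ⊎ (S i ≡ true × i < x × x ≤ m × End x)
      go x refl (forward x<j _ e h) x<n = inj₁ (forward-suc l x<j e h)
      go x refl (backward j≤x _ e h h′) x<n = inj₂ (start , j≤x , ℕ.≤-pred x<n , next-end x<n h′)
        where
        start : S i ≡ true
        start with S i in q
        ... | true = refl
        ... | false = ⊥-elim (h (ℕ.n<1+n i) (trans (begin
            lab i                  ≡⟨ labels-interval S m (ℕ.m<n⇒m<1+n l) ⟩
            level S i              ≡⟨ ℕ.+-identityʳ _ ⟨
            level S i + 0          ≡⟨ cong (λ z → level S i + 𝟙 z) q ⟨
            level S (suc i)        ≡⟨ labels-interval S m (s<s l) ⟨
            lab (suc i) ∎) e))
          where open ≡-Reasoning

  κ-fixed : ∀ {i} → i < m → S i ≡ false → κ i ≡ i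
  κ-fixed l h with κ-cases l
  ... | inj₁ (e , _) = e
  ... | inj₂ (q , _) = ⊥-elim (true≢false q h)

  κ-up : ∀ {i} → i < m → S i ≡ true → i < κ i × κ i ≤ m × End (κ i)
  κ-up l h with κ-cases l
  ... | inj₁ (_ , q) = ⊥-elim (true≢false h q)
  ... | inj₂ (_ , r) = r

  κ-last : End (κ m)
  κ-last = subst End (sym (trans (κ-ι (ℕ.n<1+n m)) (cong (ι S m) (γ-end m)))) (go (next-ι S m z<s))
    where
    go : Next (labels (interval S m)) (ι S m 0) 0 → End (ι S m 0)
    go (backward _ _ _ _ h′) = next-end (bounded (IsPerm-ι S m) z<s) h′

  -- The complement climbs from one end to a later one until it arrives at `m`, so all ends form a
  -- single cycle.
  κ-reach : ∀ {i} → i < m → S i ≡ true → ∃ λ k → iter κ k i ≡ m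
  κ-reach {i} l q = reach κ (λ i → S i ≡ true) up m (ℕ.m≤n+m m i) (ℕ.<⇒≤ l) (λ _ → q)
    where
    up : ∀ {i} → i < m → S i ≡ true → i < κ i × κ i ≤ m × (κ i < m → S (κ i) ≡ true)
    up l q with κ-up l q
    ... | a , b , inj₁ c = a , b , λ d → ⊥-elim (ℕ.<⇒≢ d c)
    ... | a , b , inj₂ c = a , b , λ _ → c

-- The order on partitions and the meet in KrInt

sameCycle⁺ : ∀ {n π i j} → IsPerm n π → i < n → ∀ k → iter π k i ≡ j → sameCycle n π i j ≡ true
sameCycle⁺ {n} P l k e with iter-reduce P k l
... | k′ , k′< , q = anyUpTo⁺ {n = suc n} (ℕ.m<n⇒m<1+n k′<) (≡ᵇ⁺ (trans q e))

sameCycle⁻ : ∀ {n π i j} → sameCycle n π i j ≡ true → ∃ λ k → iter π k i ≡ j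
sameCycle⁻ {n} h with anyUpTo⁻ {n = suc n} h
... | k , _ , e = k , ≡ᵇ⁻ e

-- The order test compares `i` with `ρ i` only; chaining these steps covers the whole cycle.
≤ₚ-iter : ∀ {n ρ σ} → IsPerm n ρ → (ρ ≤ₚ[ n ] σ) ≡ true → ∀ k {i} → i < n → ∃ λ k′ → iter σ k′ i ≡ iter ρ k i
≤ₚ-iter R h zero    l = 0 , refl
≤ₚ-iter {n} {ρ} {σ} R h (suc k) {i} l with ≤ₚ-iter {σ = σ} R h k l | sameCycle⁻ {n} (allUpTo⁻ {n = n} h (iter-bounded R k l))
... | k₁ , e₁ | k₂ , e₂ = k₂ + k₁ , trans (iter-+ σ k₂ k₁ i) (trans (cong (iter σ k₂) e₁) e₂)

free : (ℕ → Bool) → Tree → ℕ → Bool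
free S t m = all (λ i → not (S i ∧ (at (labels t) i ≡ᵇ at (labels t) m))) (upTo m)

module Meet (S : ℕ → Bool) (t : Tree) (m : ℕ) (e : size t ≡ suc m)
            {α β : ℕ → ℕ} (α-ι : ∀ {i} → i < suc m → α i ≡ ι S m (γ (suc m) i))
            (β-perm : ∀ {i} → i < suc m → β i ≡ at (perm t) i) where

  private
    n : ℕ
    n = suc m

    lab : ℕ → ℕ
    lab = at (labels t)

    IsPerm-β : IsPerm n β
    IsPerm-β = IsPerm-cong (λ l → sym (β-perm l)) (subst (λ z → IsPerm z (at (perm t))) e (IsPerm-perm t))

    open module A = KrInterval S m α α-ι using () renaming (IsPerm-κ to IsPerm-α; κ-fixed to α-fixed)

    next-β : ∀ {i} → i < n → Next (labels t) i (β i)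
    next-β {i} l = subst (Next (labels t) i) (sym (β-perm l)) (next-labels t (subst (i <_) (sym e) l))

    β-label : ∀ {i} → i < n → lab (β i) ≡ lab i
    β-label l with next-β l
    ... | forward _ _ q _    = q
    ... | backward _ _ q _ _ = q

    β-iter-label : ∀ k {i} → i < n → lab (iter β k i) ≡ lab i
    β-iter-label zero    l = refl
    β-iter-label (suc k) l = trans (β-label (iter-bounded IsPerm-β k l)) (β-iter-label k l)

    β-up : ∀ {i} → i < m → lab i ≡ lab m → i < β i × β i ≤ m × (β i < m → lab (β i) ≡ lab m)
    β-up {i} l q with next-β (ℕ.m<n⇒m<1+n l)
    ... | forward i<j j<n q′ _ = i<j , ℕ.≤-pred (subst (β i <_) (trans (length-labels t) e) j<n) , λ _ → trans q′ q
    ... | backward _ _ _ _ h′  = ⊥-elim (h′ l (subst (m <_) (sym (trans (length-labels t) e)) (ℕ.n<1+n m)) (sym q))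

    reach-β : ∀ {i} → i < m → lab i ≡ lab m → ∃ λ k → iter β k i ≡ m
    reach-β {i} l q = reach β (λ i → lab i ≡ lab m) β-up m (ℕ.m≤n+m m i) (ℕ.<⇒≤ l) (λ _ → q)

    -- If `S′` had an element `i < m`, then `ρ` would join `i` to `m`, and so would `α` and `β`. The
    -- former puts `i` into `S`, the latter into the block of `m`, which `free` excludes. So `S′` is
    -- empty below `m` and `ρ` is the identity.
    meet-sound : ∀ S′ {ρ} → (∀ {i} → i < n → ρ i ≡ ι S′ m (γ n i)) → free S t m ≡ true →
                 (ρ ≤ₚ[ n ] α) ≡ true → (ρ ≤ₚ[ n ] β) ≡ true → (ρ ≤ₚ[ n ] idPerm) ≡ true
    meet-sound S′ {ρ} ρ-ι h qα qβ = allUpTo⁺ {n = n} λ {i} l → anyUpTo⁺ {P = λ k → iter idPerm k i ≡ᵇ ρ i} {n = suc n} {0} z<s (≡ᵇ⁺ (sym (fixed l)))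
      where
      open KrInterval S′ m ρ ρ-ι
      none : ∀ {i} → i < m → S′ i ≡ false
      none {i} l = ¬true⇒false contradiction
        where
        contradiction : S′ i ≡ true → ⊥
        contradiction q with κ-reach l q
        ... | k , r with ≤ₚ-iter IsPerm-κ qα k (ℕ.m<n⇒m<1+n l) | ≤ₚ-iter IsPerm-κ qβ k (ℕ.m<n⇒m<1+n l)
        ...   | k₁ , e₁ | k₂ , e₂ with S i in Si
        ...     | false = ℕ.<⇒≢ l (trans (sym (iter-fix α k₁ (α-fixed l Si))) (trans e₁ r))
        ...     | true  = true≢false (∧-true⁺ Si (≡ᵇ⁺ (sym (trans (cong lab (sym (trans e₂ r))) (β-iter-label k₂ (ℕ.m<n⇒m<1+n l))))))
                            (not-true⁻ (allUpTo⁻ {n = m} h l))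
      fixed : ∀ {i} → i < n → ρ i ≡ i
      fixed {i} l with i ℕ.≟ m
      ... | no ne = κ-fixed (ℕ.≤∧≢⇒< (ℕ.≤-pred l) ne) (none (ℕ.≤∧≢⇒< (ℕ.≤-pred l) ne))
      ... | yes refl with κ-last
      ...   | inj₁ q = q
      ...   | inj₂ q with ρ m ℕ.≟ m
      ...     | yes r = r
      ...     | no ne = ⊥-elim (true≢false q (none (ℕ.≤∧≢⇒< (ℕ.≤-pred (bounded IsPerm-κ (ℕ.n<1+n m))) ne)))

    -- The transposition of i and m is the complement of an interval partition with two blocks.
    meet-complete : ∀ {i ρ} → (∀ {j} → j < n → ρ j ≡ ι (_≡ᵇ i) m (γ n j)) → i < m → S i ≡ true → lab i ≡ lab m →
                    (ρ ≤ₚ[ n ] α) ≡ true × (ρ ≤ₚ[ n ] β) ≡ true × (ρ ≤ₚ[ n ] idPerm) ≡ false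
    meet-complete {i} {ρ} ρ-ι l Si li = below IsPerm-α (A.κ-reach l Si) , below IsPerm-β (reach-β l li) ,
      ¬true⇒false λ q → let k , r = sameCycle⁻ {n} {idPerm} {i} {ρ i} (allUpTo⁻ {n = n} q i<n) in
        ℕ.<⇒≢ l (trans (sym (iter-fix idPerm k refl)) (trans r ρi))
      where
      open KrInterval (_≡ᵇ i) m ρ ρ-ι
      i<n : i < n
      i<n = ℕ.m<n⇒m<1+n l
      ρi : ρ i ≡ m
      ρi with κ-up l (≡ᵇ⁺ {i} refl)
      ... | _ , _ , inj₁ q = q
      ... | up , _ , inj₂ q = ⊥-elim (ℕ.<⇒≢ up (sym (≡ᵇ⁻ q)))
      below : ∀ {σ} → IsPerm n σ → (∃ λ k → iter σ k i ≡ m) → (ρ ≤ₚ[ n ] σ) ≡ true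
      below {σ} P (k , r) = allUpTo⁺ {n = n} step
        where
        step : ∀ {j} → j < n → sameCycle n σ j (ρ j) ≡ true
        step {j} lj with j ℕ.≟ i
        ... | yes refl = sameCycle⁺ P lj k (trans r (sym ρi))
        ... | no j≢i with j ℕ.≟ m
        ...   | no j≢m = sameCycle⁺ P lj 0 (sym (κ-fixed (ℕ.≤∧≢⇒< (ℕ.≤-pred lj) j≢m) (≢ᵇ⁺ j≢i)))
        ...   | yes refl with κ-last
        ...     | inj₁ q = sameCycle⁺ P lj 0 (sym q)
        ...     | inj₂ q with orbit-sym P k i<n
        ...       | k′ , r′ = sameCycle⁺ P lj k′ (trans (trans (cong (iter σ k′) (sym r)) r′) (sym (≡ᵇ⁻ q)))

  private
    Clause : (ℕ → ℕ) → Bool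
    Clause ρ = not ((ρ ≤ₚ[ n ] α) ∧ (ρ ≤ₚ[ n ] β)) ∨ (ρ ≤ₚ[ n ] idPerm)

    clause⁺ : ∀ x y z → (x ≡ true → y ≡ true → z ≡ true) → (not (x ∧ y) ∨ z) ≡ true
    clause⁺ true  true  z h = h refl refl
    clause⁺ true  false z h = refl
    clause⁺ false y     z h = refl

    clause⁻ : ∀ {x y z} → x ≡ true × y ≡ true × z ≡ false → (not (x ∧ y) ∨ z) ≡ true → ⊥
    clause⁻ (refl , refl , refl) ()

    KrInt⁻ : ∀ {ρ} → ρ ∈ KrInt n → ∃ λ S′ → ∀ {i} → i < n → ρ i ≡ ι S′ m (γ n i)
    KrInt⁻ ρ∈ with ∈-map⁻ (λ p → Kr n (toPerm n p)) {xs = Int n} ρ∈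
    ... | p , p∈ , refl with ∈-Int⁻ m p∈
    ...   | bs , _ , refl = fn bs , krPerm-ι (fn bs) m

  meet-free : meetKrIntIsZero n α β ≡ free S t m
  meet-free = bool-iff
    (λ h → allUpTo⁺ {n = m} λ {i} l → not-true⁺ (¬true⇒false λ q → let Si , li = ∧-true⁻ {S i} q in
      clause⁻ (meet-complete (krPerm-ι (_≡ᵇ i) m) l Si (≡ᵇ⁻ li))
        (all⁻ {P = Clause} h (∈-map⁺ (λ p → Kr n (toPerm n p)) (∈-Int⁺ (_≡ᵇ i) m)))))
    (λ h → all⁺ {P = Clause} (KrInt n) λ {ρ} ρ∈ → let S′ , ρ-ι = KrInt⁻ ρ∈ in
      clause⁺ (ρ ≤ₚ[ n ] α) (ρ ≤ₚ[ n ] β) (ρ ≤ₚ[ n ] idPerm) (meet-sound S′ ρ-ι h))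

-- Finite sums and power series

module Sums {c ℓ} (R : CommutativeRing c ℓ) (y yi a b : CommutativeRing.Carrier R) where

  open CommutativeRing R public
    using (Carrier; _≈_; 0#; 1#; -_; setoid; commutativeSemiring; +-cong; +-congˡ; +-congʳ; *-cong; *-congˡ; *-congʳ;
           +-assoc; +-comm; +-identityˡ; +-identityʳ; *-assoc; *-comm; *-identityˡ; *-identityʳ; distribˡ; distribʳ;
           zeroˡ; zeroʳ; -‿inverseʳ; -‿inverseˡ; -‿cong)
    renaming (_+_ to _⊕_; _*_ to _⊗_; refl to ≈-refl; sym to ≈-sym; trans to ≈-trans; reflexive to ≈-reflexive)
  open Series R y yi a b public
  open Relation.Binary.Reasoning.Setoid setoid public
  open Algebra.Solver.Ring.NaturalCoefficients.Default commutativeSemiring public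
    using (solve; _:=_; con; _:+_; _:*_)

  module _ {A : Set} where

    sumL-cong : ∀ {f g : A → Carrier} xs → (∀ {x} → x ∈ xs → f x ≈ g x) → sumL xs f ≈ sumL xs g
    sumL-cong []       h = ≈-refl
    sumL-cong (x ∷ xs) h = +-cong (h (here refl)) (sumL-cong xs (h ∘ there))

    prodL-cong : ∀ {f g : A → Carrier} xs → (∀ {x} → x ∈ xs → f x ≈ g x) → prodL xs f ≈ prodL xs g
    prodL-cong []       h = ≈-refl
    prodL-cong (x ∷ xs) h = *-cong (h (here refl)) (prodL-cong xs (h ∘ there))

    sumL-++ : ∀ (f : A → Carrier) xs ys → sumL (xs ++ ys) f ≈ sumL xs f ⊕ sumL ys f
    sumL-++ f []       ys = ≈-sym (+-identityˡ _)
    sumL-++ f (x ∷ xs) ys = ≈-trans (+-congˡ (sumL-++ f xs ys)) (≈-sym (+-assoc _ _ _))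

    sumL-↭ : ∀ (f : A → Carrier) {xs ys} → xs ↭ ys → sumL xs f ≈ sumL ys f
    sumL-↭ f Perm.refl         = ≈-refl
    sumL-↭ f (Perm.prep x p)   = +-congˡ (sumL-↭ f p)
    sumL-↭ f (Perm.swap x y p) = ≈-trans (+-congˡ (+-congˡ (sumL-↭ f p)))
      (solve 3 (λ x y z → x :+ (y :+ z) := y :+ (x :+ z)) ≈-refl _ _ _)
    sumL-↭ f (Perm.trans p q)  = ≈-trans (sumL-↭ f p) (sumL-↭ f q)

    sumL-⊗ˡ : ∀ k (f : A → Carrier) xs → k ⊗ sumL xs f ≈ sumL xs (λ x → k ⊗ f x)
    sumL-⊗ˡ k f []       = zeroʳ k
    sumL-⊗ˡ k f (x ∷ xs) = ≈-trans (distribˡ _ _ _) (+-congˡ (sumL-⊗ˡ k f xs))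

    sumL-⊗ʳ : ∀ k (f : A → Carrier) xs → sumL xs f ⊗ k ≈ sumL xs (λ x → f x ⊗ k)
    sumL-⊗ʳ k f []       = zeroˡ k
    sumL-⊗ʳ k f (x ∷ xs) = ≈-trans (distribʳ _ _ _) (+-congˡ (sumL-⊗ʳ k f xs))

    sumL-⊕ : ∀ (f g : A → Carrier) xs → sumL xs (λ x → f x ⊕ g x) ≈ sumL xs f ⊕ sumL xs g
    sumL-⊕ f g []       = ≈-sym (+-identityˡ _)
    sumL-⊕ f g (x ∷ xs) = ≈-trans (+-congˡ (sumL-⊕ f g xs))
      (solve 4 (λ p q r s → p :+ q :+ (r :+ s) := p :+ r :+ (q :+ s)) ≈-refl _ _ _ _)

    sumL-0 : ∀ (xs : List A) → sumL xs (λ _ → 0#) ≈ 0#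
    sumL-0 []       = ≈-refl
    sumL-0 (x ∷ xs) = ≈-trans (+-identityˡ _) (sumL-0 xs)

  sumL-map : ∀ {A B : Set} (f : A → B) (F : B → Carrier) xs → sumL (map f xs) F ≡ sumL xs (F ∘ f)
  sumL-map f F []       = refl
  sumL-map f F (x ∷ xs) = cong (F (f x) ⊕_) (sumL-map f F xs)

  module _ {A B : Set} where

    sumL-swap : ∀ (F : A → B → Carrier) xs ys → sumL xs (λ x → sumL ys (F x)) ≈ sumL ys (λ z → sumL xs (λ x → F x z))
    sumL-swap F []       ys = ≈-sym (sumL-0 ys)
    sumL-swap F (x ∷ xs) ys = ≈-trans (+-congˡ (sumL-swap F xs ys)) (≈-sym (sumL-⊕ (F x) _ ys))

    sumL-concatMap : ∀ (f : A → List B) (F : B → Carrier) xs → sumL (concatMap f xs) F ≈ sumL xs (λ x → sumL (f x) F)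
    sumL-concatMap f F []       = ≈-refl
    sumL-concatMap f F (x ∷ xs) = ≈-trans (sumL-++ F (f x) (concatMap f xs)) (+-congˡ (sumL-concatMap f F xs))

    sumL-product : ∀ (f : A → Carrier) (g : B → Carrier) xs ys →
                   sumL xs f ⊗ sumL ys g ≈ sumL xs (λ x → sumL ys (λ z → f x ⊗ g z))
    sumL-product f g xs ys = ≈-trans (sumL-⊗ʳ _ f xs) (sumL-cong xs (λ {x} _ → sumL-⊗ˡ (f x) g ys))

    sumL-cartesianProductWith : ∀ {C : Set} (k : A → B → C) (F : C → Carrier) xs ys →
      sumL (cartesianProductWith k xs ys) F ≈ sumL xs (λ x → sumL ys (λ z → F (k x z)))
    sumL-cartesianProductWith k F []       ys = ≈-refl
    sumL-cartesianProductWith k F (x ∷ xs) ys = ≈-trans (sumL-++ F (map (k x) ys) _)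
      (+-cong (≈-reflexive (sumL-map (k x) F ys)) (sumL-cartesianProductWith k F xs ys))

  sumL-bijection : ∀ {A B : Set} {f : A → B} {xs ys} (F : B → Carrier) → map f xs ↭ ys → sumL ys F ≈ sumL xs (F ∘ f)
  sumL-bijection {f = f} {xs} F p = ≈-trans (≈-sym (sumL-↭ F p)) (≈-reflexive (sumL-map f F xs))

  sumL-upTo-suc : ∀ (F : ℕ → Carrier) n → sumL (upTo (suc n)) F ≈ F 0 ⊕ sumL (upTo n) (F ∘ suc)
  sumL-upTo-suc F n = +-congˡ (≈-reflexive (trans (cong (λ z → sumL z F) (sym (List.map-upTo suc n))) (sumL-map suc F (upTo n))))

  prodL-map : ∀ {A B : Set} (f : A → B) (F : B → Carrier) xs → prodL (map f xs) F ≡ prodL xs (F ∘ f)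
  prodL-map f F []       = refl
  prodL-map f F (x ∷ xs) = cong (F (f x) ⊗_) (prodL-map f F xs)

  prodL-upTo-suc : ∀ (F : ℕ → Carrier) n → prodL (upTo (suc n)) F ≈ F 0 ⊗ prodL (upTo n) (F ∘ suc)
  prodL-upTo-suc F n = *-congˡ (≈-reflexive (trans (cong (λ z → prodL z F) (sym (List.map-upTo suc n))) (prodL-map suc F (upTo n))))

  prodL-upTo-+ : ∀ (F : ℕ → Carrier) m n → prodL (upTo (m + n)) F ≈ prodL (upTo m) F ⊗ prodL (upTo n) (λ i → F (m + i))
  prodL-upTo-+ F zero    n = ≈-sym (*-identityˡ _)
  prodL-upTo-+ F (suc m) n = begin
    prodL (upTo (suc m + n)) F                                                 ≈⟨ prodL-upTo-suc F (m + n) ⟩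
    F 0 ⊗ prodL (upTo (m + n)) (F ∘ suc)                                       ≈⟨ *-congˡ (prodL-upTo-+ (F ∘ suc) m n) ⟩
    F 0 ⊗ (prodL (upTo m) (F ∘ suc) ⊗ prodL (upTo n) (λ i → F (suc m + i)))    ≈⟨ *-assoc _ _ _ ⟨
    F 0 ⊗ prodL (upTo m) (F ∘ suc) ⊗ prodL (upTo n) (λ i → F (suc m + i))      ≈⟨ *-congʳ (prodL-upTo-suc F m) ⟨
    prodL (upTo (suc m)) F ⊗ prodL (upTo n) (λ i → F (suc m + i)) ∎

  pow-+ : ∀ x m n → pow x (m + n) ≈ pow x m ⊗ pow x n
  pow-+ x zero    n = ≈-sym (*-identityˡ _)
  pow-+ x (suc m) n = ≈-trans (*-congˡ (pow-+ x m n)) (≈-sym (*-assoc _ _ _))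

  -- Formal power series and geometric series

  infix 4 _≗_
  _≗_ : PS → PS → Set ℓ
  f ≗ g = ∀ n → f n ≈ g n

  infixl 6 _⊞_
  _⊞_ : PS → PS → PS
  (f ⊞ g) n = f n ⊕ g n

  infixr 7 _·_
  _·_ : Carrier → PS → PS
  (k · f) n = k ⊗ f n

  X· : PS → PS
  X· f zero    = 0#
  X· f (suc n) = f n

  X·-cong : ∀ {f g} → f ≗ g → X· f ≗ X· g
  X·-cong h zero    = ≈-refl
  X·-cong h (suc n) = h n

  ⊛-cong-≤ : ∀ f {g g′} n → (∀ {i} → i ≤ n → g i ≈ g′ i) → (f ⊛ g) n ≈ (f ⊛ g′) n
  ⊛-cong-≤ f n h = sumL-cong (upTo (suc n)) (λ {i} _ → *-congˡ (h (ℕ.m∸n≤m n i)))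

  ⊛-cong : ∀ {f f′ g g′} → f ≗ f′ → g ≗ g′ → f ⊛ g ≗ f′ ⊛ g′
  ⊛-cong p q n = sumL-cong (upTo (suc n)) (λ {i} _ → *-cong (p i) (q (n ∸ i)))

  ⊛-zero : ∀ f g → (f ⊛ g) 0 ≈ f 0 ⊗ g 0
  ⊛-zero f g = +-identityʳ _

  ⊛-suc : ∀ f g n → (f ⊛ g) (suc n) ≈ f 0 ⊗ g (suc n) ⊕ ((f ∘ suc) ⊛ g) n
  ⊛-suc f g n = sumL-upTo-suc (λ i → f i ⊗ g (suc n ∸ i)) (suc n)

  -- The convolution peeled at the other end; comparing it with `⊛-suc` gives commutativity by
  -- induction.
  ⊛-suc′ : ∀ f g n → (f ⊛ g) (suc n) ≈ f (suc n) ⊗ g 0 ⊕ (f ⊛ (g ∘ suc)) n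
  ⊛-suc′ f g zero = begin
    (f ⊛ g) 1                              ≈⟨ ⊛-suc f g 0 ⟩
    f 0 ⊗ g 1 ⊕ ((f ∘ suc) ⊛ g) 0          ≈⟨ +-cong (≈-sym (⊛-zero f (g ∘ suc))) (⊛-zero (f ∘ suc) g) ⟩
    (f ⊛ (g ∘ suc)) 0 ⊕ f 1 ⊗ g 0          ≈⟨ +-comm _ _ ⟩
    f 1 ⊗ g 0 ⊕ (f ⊛ (g ∘ suc)) 0 ∎
  ⊛-suc′ f g (suc n) = begin
    (f ⊛ g) (suc (suc n))                                     ≈⟨ ⊛-suc f g (suc n) ⟩
    f 0 ⊗ g (suc (suc n)) ⊕ ((f ∘ suc) ⊛ g) (suc n)           ≈⟨ +-congˡ (⊛-suc′ (f ∘ suc) g n) ⟩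
    f 0 ⊗ g (suc (suc n)) ⊕ (f (suc (suc n)) ⊗ g 0 ⊕ ((f ∘ suc) ⊛ (g ∘ suc)) n)
      ≈⟨ solve 3 (λ x y z → x :+ (y :+ z) := y :+ (x :+ z)) ≈-refl _ _ _ ⟩
    f (suc (suc n)) ⊗ g 0 ⊕ (f 0 ⊗ g (suc (suc n)) ⊕ ((f ∘ suc) ⊛ (g ∘ suc)) n)
      ≈⟨ +-congˡ (⊛-suc f (g ∘ suc) n) ⟨
    f (suc (suc n)) ⊗ g 0 ⊕ (f ⊛ (g ∘ suc)) (suc n) ∎

  ⊛-comm : ∀ f g → f ⊛ g ≗ g ⊛ f
  ⊛-comm f g zero    = ≈-trans (⊛-zero f g) (≈-trans (*-comm _ _) (≈-sym (⊛-zero g f)))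
  ⊛-comm f g (suc n) = begin
    (f ⊛ g) (suc n)                              ≈⟨ ⊛-suc f g n ⟩
    f 0 ⊗ g (suc n) ⊕ ((f ∘ suc) ⊛ g) n          ≈⟨ +-cong (*-comm _ _) (⊛-comm (f ∘ suc) g n) ⟩
    g (suc n) ⊗ f 0 ⊕ (g ⊛ (f ∘ suc)) n          ≈⟨ ⊛-suc′ g f n ⟨
    (g ⊛ f) (suc n) ∎

  ⊛-⊞ʳ : ∀ f g h → f ⊛ (g ⊞ h) ≗ f ⊛ g ⊞ f ⊛ h
  ⊛-⊞ʳ f g h n = ≈-trans (sumL-cong (upTo (suc n)) (λ {i} _ → distribˡ (f i) (g (n ∸ i)) (h (n ∸ i)))) (sumL-⊕ _ _ (upTo (suc n)))

  ⊛-·ʳ : ∀ f k g → f ⊛ (k · g) ≗ k · (f ⊛ g)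
  ⊛-·ʳ f k g n = ≈-trans (sumL-cong (upTo (suc n)) (λ {i} _ → solve 3 (λ x k y → x :* (k :* y) := k :* (x :* y)) ≈-refl (f i) k (g (n ∸ i))))
    (≈-sym (sumL-⊗ˡ k _ (upTo (suc n))))

  ⊛-⊞ˡ : ∀ f g h → (f ⊞ g) ⊛ h ≗ f ⊛ h ⊞ g ⊛ h
  ⊛-⊞ˡ f g h n = ≈-trans (sumL-cong (upTo (suc n)) (λ {i} _ → distribʳ (h (n ∸ i)) (f i) (g i))) (sumL-⊕ _ _ (upTo (suc n)))

  ⊛-·ˡ : ∀ k f g → (k · f) ⊛ g ≗ k · (f ⊛ g)
  ⊛-·ˡ k f g n = ≈-trans (sumL-cong (upTo (suc n)) (λ {i} _ → *-assoc k (f i) (g (n ∸ i)))) (≈-sym (sumL-⊗ˡ k _ (upTo (suc n))))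

  ⊛-assoc : ∀ f g h → (f ⊛ g) ⊛ h ≗ f ⊛ (g ⊛ h)
  ⊛-assoc f g h zero = begin
    ((f ⊛ g) ⊛ h) 0      ≈⟨ ≈-trans (⊛-zero (f ⊛ g) h) (*-congʳ (⊛-zero f g)) ⟩
    f 0 ⊗ g 0 ⊗ h 0      ≈⟨ *-assoc _ _ _ ⟩
    f 0 ⊗ (g 0 ⊗ h 0)    ≈⟨ ≈-trans (⊛-zero f (g ⊛ h)) (*-congˡ (⊛-zero g h)) ⟨
    (f ⊛ (g ⊛ h)) 0 ∎
  ⊛-assoc f g h (suc n) = begin
    ((f ⊛ g) ⊛ h) (suc n)
      ≈⟨ ⊛-suc (f ⊛ g) h n ⟩
    (f ⊛ g) 0 ⊗ h (suc n) ⊕ (((f ⊛ g) ∘ suc) ⊛ h) n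
      ≈⟨ +-cong (*-congʳ (⊛-zero f g)) (⊛-cong {g = h} (⊛-suc f g) (λ _ → ≈-refl) n) ⟩
    f 0 ⊗ g 0 ⊗ h (suc n) ⊕ ((f 0 · (g ∘ suc) ⊞ (f ∘ suc) ⊛ g) ⊛ h) n
      ≈⟨ +-congˡ (≈-trans (⊛-⊞ˡ (f 0 · (g ∘ suc)) ((f ∘ suc) ⊛ g) h n) (+-cong (⊛-·ˡ (f 0) (g ∘ suc) h n) (⊛-assoc (f ∘ suc) g h n))) ⟩
    f 0 ⊗ g 0 ⊗ h (suc n) ⊕ (f 0 ⊗ ((g ∘ suc) ⊛ h) n ⊕ ((f ∘ suc) ⊛ (g ⊛ h)) n)
      ≈⟨ solve 5 (λ p q r s t → p :* q :* r :+ (p :* s :+ t) := p :* (q :* r :+ s) :+ t) ≈-refl _ _ _ _ _ ⟩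
    f 0 ⊗ (g 0 ⊗ h (suc n) ⊕ ((g ∘ suc) ⊛ h) n) ⊕ ((f ∘ suc) ⊛ (g ⊛ h)) n
      ≈⟨ +-congʳ (*-congˡ (⊛-suc g h n)) ⟨
    f 0 ⊗ (g ⊛ h) (suc n) ⊕ ((f ∘ suc) ⊛ (g ⊛ h)) n
      ≈⟨ ⊛-suc f (g ⊛ h) n ⟨
    (f ⊛ (g ⊛ h)) (suc n) ∎

  ⊛-X·ʳ : ∀ f g → f ⊛ X· g ≗ X· (f ⊛ g)
  ⊛-X·ʳ f g zero    = ≈-trans (⊛-zero f (X· g)) (zeroʳ _)
  ⊛-X·ʳ f g (suc n) = ≈-trans (⊛-suc′ f (X· g) n) (≈-trans (+-congʳ (zeroʳ _)) (+-identityˡ _))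

  ⊛-oneʳ : ∀ f → f ⊛ oneS ≗ f
  ⊛-oneʳ f zero    = ≈-trans (⊛-zero f oneS) (*-identityʳ _)
  ⊛-oneʳ f (suc n) = begin
    (f ⊛ oneS) (suc n)                        ≈⟨ ⊛-suc′ f oneS n ⟩
    f (suc n) ⊗ 1# ⊕ (f ⊛ (λ _ → 0#)) n       ≈⟨ +-cong (*-identityʳ _) (≈-trans (sumL-cong (upTo (suc n)) (λ _ → zeroʳ _)) (sumL-0 (upTo (suc n)))) ⟩
    f (suc n) ⊕ 0#                            ≈⟨ +-identityʳ _ ⟩
    f (suc n) ∎

  module _ (W : PS) where

    -- This is Q = 1 / (1 - ζXW), expressed by its defining equation instead of an inverse series.
    IsStar : Carrier → PS → Set ℓ
    IsStar ζ Q = Q ≗ oneS ⊞ ζ · X· (Q ⊛ W)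

    ⊛-star : ∀ {ζ Q} → IsStar ζ Q → ∀ F → F ⊛ Q ≗ F ⊞ ζ · X· ((F ⊛ W) ⊛ Q)
    ⊛-star {ζ} {Q} s F n = begin
      (F ⊛ Q) n
        ≈⟨ ⊛-cong {F} (λ _ → ≈-refl) s n ⟩
      (F ⊛ (oneS ⊞ ζ · X· (Q ⊛ W))) n
        ≈⟨ ⊛-⊞ʳ F oneS (ζ · X· (Q ⊛ W)) n ⟩
      (F ⊛ oneS) n ⊕ (F ⊛ (ζ · X· (Q ⊛ W))) n
        ≈⟨ +-cong (⊛-oneʳ F n) (≈-trans (⊛-·ʳ F ζ (X· (Q ⊛ W)) n) (*-congˡ (⊛-X·ʳ F (Q ⊛ W) n))) ⟩
      F n ⊕ ζ ⊗ X· (F ⊛ (Q ⊛ W)) n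
        ≈⟨ +-congˡ (*-congˡ (X·-cong (λ k → ≈-trans (⊛-cong {F} (λ _ → ≈-refl) (⊛-comm Q W) k) (≈-sym (⊛-assoc F W Q k))) n)) ⟩
      F n ⊕ ζ ⊗ X· ((F ⊛ W) ⊛ Q) n ∎

    -- The coefficients of F Q agree with those of the sum of F (ζXW)^j. The series `F` is arbitrary
    -- because each step of the induction moves one factor `W` into it.
    star-powers : ∀ {ζ Q} → IsStar ζ Q → ∀ n F → sumL (upTo (suc n)) (λ j → pow ζ j ⊗ (F ⊛ powS W j) (n ∸ j)) ≈ (F ⊛ Q) n
    star-powers {ζ} {Q} s zero F = begin
      1# ⊗ (F ⊛ oneS) 0 ⊕ 0#                   ≈⟨ ≈-trans (+-identityʳ _) (≈-trans (*-identityˡ _) (⊛-oneʳ F 0)) ⟩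
      F 0                                      ≈⟨ ≈-trans (+-congˡ (zeroʳ ζ)) (+-identityʳ _) ⟨
      F 0 ⊕ ζ ⊗ 0#                             ≈⟨ ⊛-star s F 0 ⟨
      (F ⊛ Q) 0 ∎
    star-powers {ζ} {Q} s (suc n) F = begin
      sumL (upTo (suc (suc n))) (λ j → pow ζ j ⊗ (F ⊛ powS W j) (suc n ∸ j))
        ≈⟨ sumL-upTo-suc (λ j → pow ζ j ⊗ (F ⊛ powS W j) (suc n ∸ j)) (suc n) ⟩
      1# ⊗ (F ⊛ oneS) (suc n) ⊕ sumL (upTo (suc n)) (λ j → ζ ⊗ pow ζ j ⊗ (F ⊛ (W ⊛ powS W j)) (n ∸ j))
        ≈⟨ +-cong (≈-trans (*-identityˡ _) (⊛-oneʳ F (suc n)))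
             (≈-trans (sumL-cong (upTo (suc n)) (λ {j} _ → ≈-trans (*-assoc _ _ _) (*-congˡ (*-congˡ (≈-sym (⊛-assoc F W (powS W j) (n ∸ j)))))))
                      (≈-sym (sumL-⊗ˡ ζ _ (upTo (suc n))))) ⟩
      F (suc n) ⊕ ζ ⊗ sumL (upTo (suc n)) (λ j → pow ζ j ⊗ ((F ⊛ W) ⊛ powS W j) (n ∸ j))
        ≈⟨ +-congˡ (*-congˡ (star-powers s n (F ⊛ W))) ⟩
      F (suc n) ⊕ ζ ⊗ ((F ⊛ W) ⊛ Q) n
        ≈⟨ ⊛-star s F (suc n) ⟨
      (F ⊛ Q) (suc n) ∎

    -- For T = X W the series K = X W Q and M = X W Q′ are K = T / (1 - ζ T) and M = T / (1 - (1 + ζ) T).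
    star-shift : ∀ {ζ Q Q′} → IsStar ζ Q → IsStar (1# ⊕ ζ) Q′ → W ⊛ Q′ ≗ W ⊛ Q ⊞ X· ((W ⊛ Q′) ⊛ (W ⊛ Q))
    star-shift {ζ} {Q} {Q′} s s′ n = go n (<-wellFounded n)
      where
      K′ M′ N : PS
      K′ = W ⊛ Q
      M′ = W ⊛ Q′
      N = K′ ⊞ X· (M′ ⊛ K′)
      expand : ∀ {ζ Q} → IsStar ζ Q → W ⊛ Q ≗ W ⊞ ζ · X· (W ⊛ (W ⊛ Q))
      expand {ζ} {Q} s n = ≈-trans (⊛-star s W n) (+-congˡ (*-congˡ (X·-cong (⊛-assoc W W Q) n)))
      M′K′ : M′ ⊛ K′ ≗ W ⊛ M′ ⊞ ζ · (W ⊛ X· (M′ ⊛ K′))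
      M′K′ n = begin
        (M′ ⊛ K′) n
          ≈⟨ ⊛-cong {M′} (λ _ → ≈-refl) (expand s) n ⟩
        (M′ ⊛ (W ⊞ ζ · X· (W ⊛ K′))) n
          ≈⟨ ⊛-⊞ʳ M′ W (ζ · X· (W ⊛ K′)) n ⟩
        (M′ ⊛ W) n ⊕ (M′ ⊛ (ζ · X· (W ⊛ K′))) n
          ≈⟨ +-cong (⊛-comm M′ W n) (⊛-·ʳ M′ ζ (X· (W ⊛ K′)) n) ⟩
        (W ⊛ M′) n ⊕ ζ ⊗ (M′ ⊛ X· (W ⊛ K′)) n
          ≈⟨ +-congˡ (*-congˡ (≈-trans (⊛-X·ʳ M′ (W ⊛ K′) n) (≈-trans (X·-cong rearrange n) (≈-sym (⊛-X·ʳ W (M′ ⊛ K′) n))))) ⟩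
        (W ⊛ M′) n ⊕ ζ ⊗ (W ⊛ X· (M′ ⊛ K′)) n ∎
        where
        rearrange : M′ ⊛ (W ⊛ K′) ≗ W ⊛ (M′ ⊛ K′)
        rearrange k = ≈-trans (≈-sym (⊛-assoc M′ W K′ k)) (≈-trans (⊛-cong {g = K′} (⊛-comm M′ W) (λ _ → ≈-refl) k) (⊛-assoc W M′ K′ k))
      -- `M′` satisfies M′ = W + (1 + ζ) X W M′. In the ζ part the lower coefficients of `M′` are
      -- replaced by those of `N` by induction; the other part stays and matches the first summand
      -- of `M′K′`.
      go : ∀ n → Acc _<_ n → M′ n ≈ N n
      go zero    _        = begin
        M′ 0                     ≈⟨ expand s′ 0 ⟩
        W 0 ⊕ (1# ⊕ ζ) ⊗ 0#      ≈⟨ +-congˡ (≈-trans (zeroʳ _) (≈-sym (zeroʳ ζ))) ⟩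
        W 0 ⊕ ζ ⊗ 0#             ≈⟨ expand s 0 ⟨
        K′ 0                     ≈⟨ +-identityʳ _ ⟨
        K′ 0 ⊕ 0# ∎
      go (suc n) (acc rs) = begin
        M′ (suc n)
          ≈⟨ expand s′ (suc n) ⟩
        W (suc n) ⊕ (1# ⊕ ζ) ⊗ (W ⊛ M′) n
          ≈⟨ +-congˡ (≈-trans (distribʳ _ _ _) (+-cong (*-identityˡ _) (*-congˡ (≈-trans (⊛-cong-≤ W n (λ {i} h → go i (rs (s≤s h)))) (⊛-⊞ʳ W K′ (X· (M′ ⊛ K′)) n))))) ⟩
        W (suc n) ⊕ ((W ⊛ M′) n ⊕ ζ ⊗ ((W ⊛ K′) n ⊕ (W ⊛ X· (M′ ⊛ K′)) n))
          ≈⟨ solve 5 (λ w x z p q → w :+ (x :+ z :* (p :+ q)) := (w :+ z :* p) :+ (x :+ z :* q)) ≈-refl _ _ _ _ _ ⟩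
        (W (suc n) ⊕ ζ ⊗ (W ⊛ K′) n) ⊕ ((W ⊛ M′) n ⊕ ζ ⊗ (W ⊛ X· (M′ ⊛ K′)) n)
          ≈⟨ +-cong (expand s (suc n)) (M′K′ n) ⟨
        K′ (suc n) ⊕ (M′ ⊛ K′) n ∎

-- Weights of pairs of a non-crossing partition and a set S

module Weights {c ℓ} (R : CommutativeRing c ℓ) (y yi a b : CommutativeRing.Carrier R)
               (y⊗yi≈1 : CommutativeRing._≈_ R (CommutativeRing._*_ R y yi) (CommutativeRing.1# R)) where

  open Sums R y yi a b public

  -- Weights of an element, by membership in S: factor₁ sums over all S, factor₀ over those avoiding the block.
  factor₁ factor₀ : Bool → Carrier
  factor₁ s = if s then 1# else a ⊗ y
  factor₀ s = if s then 0# else a ⊗ y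

  -- A block with s elements, k of them in S, has weight A^(s-k) Y^(s-k+1) for k ≥ 1 and A^s Y^(s-1)
  -- for k = 0, the latter being Y (AY)^s + (Y⁻¹ - Y) (AY)^s. In blockWeight the last element is left out.
  weight      : Tree → (ℕ → Bool) → Carrier
  blockWeight : (Bool → Carrier) → Tree → (ℕ → Bool) → Carrier
  fullWeight  : Tree → (ℕ → Bool) → Carrier
  weight leaf       S = 1#
  weight (node L R) S = weight L S ⊗ fullWeight R (λ i → S (size L + i))
  blockWeight z leaf       S = 1#
  blockWeight z (node L R) S = blockWeight z L S ⊗ (z (S (size L)) ⊗ weight R (λ i → S (size L + suc i)))
  fullWeight R S = y ⊗ (blockWeight factor₁ R S ⊗ factor₁ (S (size R)))
                 ⊕ (yi ⊕ - y) ⊗ (blockWeight factor₀ R S ⊗ factor₀ (S (size R)))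

  weight-cong      : ∀ t {S S′} → (∀ {i} → i < size t → S i ≡ S′ i) → weight t S ≡ weight t S′
  blockWeight-cong : ∀ z t {S S′} → (∀ {i} → i < size t → S i ≡ S′ i) → blockWeight z t S ≡ blockWeight z t S′
  fullWeight-cong  : ∀ t {S S′} → (∀ {i} → i < suc (size t) → S i ≡ S′ i) → fullWeight t S ≡ fullWeight t S′
  weight-cong leaf       h = refl
  weight-cong (node L R) h = cong₂ _⊗_ (weight-cong L (λ l → h (<-left (size R) l)))
    (fullWeight-cong R (λ {i} l → h (subst (_≤ suc (size L + size R)) (ℕ.+-suc (size L) i)
      (ℕ.≤-trans (ℕ.+-monoʳ-≤ (size L) l) (ℕ.≤-reflexive (ℕ.+-suc (size L) (size R)))))))
  blockWeight-cong z leaf       h = refl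
  blockWeight-cong z (node L R) h = cong₂ _⊗_ (blockWeight-cong z L (λ l → h (<-left (size R) l)))
    (cong₂ _⊗_ (cong z (h (s≤s (ℕ.m≤m+n (size L) (size R))))) (weight-cong R (λ l → h (<-right (size L) l))))
  fullWeight-cong R h = cong₂ _⊕_
    (cong (y ⊗_) (cong₂ _⊗_ (blockWeight-cong factor₁ R (λ l → h (ℕ.m<n⇒m<1+n l))) (cong factor₁ (h (ℕ.n<1+n _)))))
    (cong ((yi ⊕ - y) ⊗_) (cong₂ _⊗_ (blockWeight-cong factor₀ R (λ l → h (ℕ.m<n⇒m<1+n l))) (cong factor₀ (h (ℕ.n<1+n _)))))

  weight-⧺ : ∀ X Y S → weight (X ⧺ Y) S ≈ weight X S ⊗ weight Y (λ i → S (size X + i))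
  weight-⧺ X leaf       S = ≈-sym (*-identityʳ _)
  weight-⧺ X (node L R) S = begin
    weight (X ⧺ L) S ⊗ fullWeight R (λ i → S (size (X ⧺ L) + i))
      ≈⟨ *-cong (weight-⧺ X L S) (≈-reflexive (fullWeight-cong R (λ {i} _ → cong S (trans (cong (_+ i) (size-⧺ X L)) (ℕ.+-assoc (size X) (size L) i))))) ⟩
    weight X S ⊗ weight L (λ i → S (size X + i)) ⊗ fullWeight R (λ i → S (size X + (size L + i)))
      ≈⟨ *-assoc _ _ _ ⟩
    weight X S ⊗ (weight L (λ i → S (size X + i)) ⊗ fullWeight R (λ i → S (size X + (size L + i)))) ∎

  blockWeight-⧺ : ∀ z X Y S → blockWeight z (X ⧺ Y) S ≈ blockWeight z X S ⊗ blockWeight z Y (λ i → S (size X + i))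
  blockWeight-⧺ z X leaf       S = ≈-sym (*-identityʳ _)
  blockWeight-⧺ z X (node L R) S = begin
    blockWeight z (X ⧺ L) S ⊗ (z (S (size (X ⧺ L))) ⊗ weight R (λ i → S (size (X ⧺ L) + suc i)))
      ≈⟨ *-cong (blockWeight-⧺ z X L S) (*-cong (≈-reflexive (cong (z ∘ S) (size-⧺ X L)))
           (≈-reflexive (weight-cong R (λ {i} _ → cong S (trans (cong (_+ suc i) (size-⧺ X L)) (ℕ.+-assoc (size X) (size L) (suc i))))))) ⟩
    blockWeight z X S ⊗ blockWeight z L (λ i → S (size X + i)) ⊗ (z (S (size X + size L)) ⊗ weight R (λ i → S (size X + (size L + suc i))))
      ≈⟨ *-assoc _ _ _ ⟩
    blockWeight z X S ⊗ (blockWeight z L (λ i → S (size X + i)) ⊗ (z (S (size X + size L)) ⊗ weight R (λ i → S (size X + (size L + suc i))))) ∎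

  -- An element of `S` makes the `factor₀` product vanish, and with it the correction term.
  fullWeight-true : ∀ R S → S (size R) ≡ true → fullWeight R S ≈ y ⊗ blockWeight factor₁ R S
  fullWeight-true R S h rewrite h = ≈-trans (+-cong (*-congˡ (*-identityʳ _)) (≈-trans (*-congˡ (zeroʳ _)) (zeroʳ _))) (+-identityʳ _)

  y⊗[yi-y] : y ⊕ (yi ⊕ - y) ≈ yi
  y⊗[yi-y] = begin
    y ⊕ (yi ⊕ - y)   ≈⟨ solve 3 (λ p q r → p :+ (q :+ r) := q :+ (p :+ r)) ≈-refl y yi (- y) ⟩
    yi ⊕ (y ⊕ - y)   ≈⟨ +-congˡ (-‿inverseʳ y) ⟩
    yi ⊕ 0#          ≈⟨ +-identityʳ yi ⟩
    yi ∎

  -- Off `S` both products are equal, so their coefficients add up to `yi`, which cancels the `y` of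
  -- the single element.
  fullWeight-false-leaf : ∀ S → S 0 ≡ false → fullWeight leaf S ≈ a
  fullWeight-false-leaf S h rewrite h = begin
    y ⊗ (1# ⊗ (a ⊗ y)) ⊕ (yi ⊕ - y) ⊗ (1# ⊗ (a ⊗ y))
      ≈⟨ solve 3 (λ y d a → y :* (con 1 :* (a :* y)) :+ d :* (con 1 :* (a :* y)) := (y :+ d) :* y :* a) ≈-refl y (yi ⊕ - y) a ⟩
    (y ⊕ (yi ⊕ - y)) ⊗ y ⊗ a
      ≈⟨ *-congʳ (≈-trans (*-congʳ y⊗[yi-y]) (≈-trans (*-comm _ _) y⊗yi≈1)) ⟩
    1# ⊗ a
      ≈⟨ *-identityˡ a ⟩
    a ∎

  -- An element outside `S` contributes `a ⊗ y` to both products, so it can be factored out. What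
  -- remains is a shorter block, followed by its former last gap.
  fullWeight-false-node : ∀ L R S → S (suc (size L + size R)) ≡ false →
    fullWeight (node L R) S ≈ a ⊗ y ⊗ (fullWeight L S ⊗ weight R (λ i → S (size L + suc i)))
  fullWeight-false-node L R S h rewrite h = solve 9
    (λ y d q₁ f₁ q₀ f₀ w a e → y :* (q₁ :* (f₁ :* w) :* (a :* e)) :+ d :* (q₀ :* (f₀ :* w) :* (a :* e))
       := a :* e :* ((y :* (q₁ :* f₁) :+ d :* (q₀ :* f₀)) :* w)) ≈-refl
    y (yi ⊕ - y) (blockWeight factor₁ L S) (factor₁ (S (size L))) (blockWeight factor₀ L S) (factor₀ (S (size L)))
    (weight R (λ i → S (size L + suc i))) a y

  weight-true : ∀ L R S → S (size L + size R) ≡ true →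
                weight (node L R) S ≈ y ⊗ (weight L S ⊗ blockWeight factor₁ R (λ i → S (size L + i)))
  weight-true L R S h = ≈-trans (*-congˡ (fullWeight-true R _ h)) (solve 3 (λ w y q → w :* (y :* q) := y :* (w :* q)) ≈-refl _ _ _)

  weight-false-leaf : ∀ L S → S (size L + 0) ≡ false → weight (node L leaf) S ≈ a ⊗ weight L S
  weight-false-leaf L S h = ≈-trans (*-congˡ (fullWeight-false-leaf (λ i → S (size L + i)) h)) (*-comm _ _)

  weight-false-node : ∀ L r₁ r₂ S → S (size L + suc (size r₁ + size r₂)) ≡ false →
                      weight (node L (node r₁ r₂)) S ≈ a ⊗ y ⊗ weight (node L r₁ ⧺ r₂) S
  weight-false-node L r₁ r₂ S h = begin
    weight L S ⊗ fullWeight (node r₁ r₂) (λ i → S (size L + i))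
      ≈⟨ *-congˡ (fullWeight-false-node r₁ r₂ _ h) ⟩
    weight L S ⊗ (a ⊗ y ⊗ (fullWeight r₁ (λ i → S (size L + i)) ⊗ weight r₂ (λ i → S (size L + (size r₁ + suc i)))))
      ≈⟨ solve 4 (λ w c f x → w :* (c :* (f :* x)) := c :* (w :* f :* x)) ≈-refl _ _ _ _ ⟩
    a ⊗ y ⊗ (weight (node L r₁) S ⊗ weight r₂ (λ i → S (size L + (size r₁ + suc i))))
      ≈⟨ *-congˡ (*-congˡ (≈-reflexive (weight-cong r₂ (λ {i} _ → cong S
           (trans (sym (ℕ.+-assoc (size L) (size r₁) (suc i))) (ℕ.+-suc (size L + size r₁) i)))))) ⟩
    a ⊗ y ⊗ (weight (node L r₁) S ⊗ weight r₂ (λ i → S (suc (size L + size r₁) + i)))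
      ≈⟨ *-congˡ (weight-⧺ (node L r₁) r₂ S) ⟨
    a ⊗ y ⊗ weight (node L r₁ ⧺ r₂) S ∎

  meanderWeight : Tree → (ℕ → Bool) → ℕ → Carrier
  meanderWeight t S m = pow y (∥meander∥ t S m) ⊗ pow a (countFalse S m)

  meanderWeight-true : ∀ t {S m} → size t ≡ suc (suc m) → S m ≡ true →
    meanderWeight t S (suc m) ≈ pow y (𝟙 (not (deleteFixed t))) ⊗ meanderWeight (delete t) S m
  meanderWeight-true t {S} {m} e h = begin
    pow y (∥meander∥ t S (suc m)) ⊗ pow a (countFalse S (suc m))
      ≈⟨ ≈-reflexive (cong₂ (λ i j → pow y i ⊗ pow a j) (∥meander∥-delete t {S} e h)
           (trans (cong (λ s → countFalse S m + 𝟙 (not s)) h) (ℕ.+-identityʳ (countFalse S m)))) ⟩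
    pow y (k + l) ⊗ pow a (countFalse S m)
      ≈⟨ *-congʳ (pow-+ y k l) ⟩
    pow y k ⊗ pow y l ⊗ pow a (countFalse S m)
      ≈⟨ *-assoc _ _ _ ⟩
    pow y k ⊗ (pow y l ⊗ pow a (countFalse S m)) ∎
    where
    k l : ℕ
    k = 𝟙 (not (deleteFixed t))
    l = ∥meander∥ (delete t) S m

  meanderWeight-false : ∀ t {S m} → size t ≡ suc (suc m) → S m ≡ false →
    meanderWeight t S (suc m) ≈ a ⊗ pow y (𝟙 (not (mergeFixed t))) ⊗ meanderWeight (merge t) S m
  meanderWeight-false t {S} {m} e h = begin
    pow y (∥meander∥ t S (suc m)) ⊗ pow a (countFalse S (suc m))
      ≈⟨ ≈-reflexive (cong₂ (λ i j → pow y i ⊗ pow a j) (∥meander∥-merge t {S} e h)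
           (trans (cong (λ s → countFalse S m + 𝟙 (not s)) h) (ℕ.+-comm (countFalse S m) 1))) ⟩
    pow y (k + l) ⊗ (a ⊗ pow a (countFalse S m))
      ≈⟨ *-congʳ (pow-+ y k l) ⟩
    pow y k ⊗ pow y l ⊗ (a ⊗ pow a (countFalse S m))
      ≈⟨ solve 4 (λ p q a r → p :* q :* (a :* r) := a :* p :* (q :* r)) ≈-refl (pow y k) (pow y l) a (pow a (countFalse S m)) ⟩
    a ⊗ pow y k ⊗ (pow y l ⊗ pow a (countFalse S m)) ∎
    where
    k l : ℕ
    k = 𝟙 (not (mergeFixed t))
    l = ∥meander∥ (merge t) S m

  private
    shiftS : (ℕ → Bool) → ℕ → ℕ → Bool
    shiftS S k i = S (k + i)

  private
    -- The removal seen from `node u v`, where `m` is the point before the last. For `m` in `S`, the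
    -- block of `m` is joined to that of the last point and one point disappears; otherwise `m` is
    -- only deleted from its block. So `delete` and `merge` on `cons u v` exchange their roles on
    -- the complement. The cases tell whether `m` ends `u`, lies in the last block, or ends the last
    -- gap.
    module Step (S : ℕ → Bool) (m : ℕ)
      (IH : ∀ u v → size u + size v ≡ m → meanderWeight (cons u v) S m ≈ weight u S ⊗ blockWeight factor₁ v (shiftS S (size u))) where

      Goal : Tree → Tree → Set ℓ
      Goal u v = size u + size v ≡ suc m → meanderWeight (cons u v) S (suc m) ≈ weight u S ⊗ blockWeight factor₁ v (shiftS S (size u))

      step-true : S m ≡ true → ∀ u v → Goal u v
      -- The last point is a singleton; joined to it, the block of `m` becomes the new last block,
      -- at the cost of the factor `y` in its full weight.
      step-true h (node u r) leaf e = begin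
        meanderWeight (cons (node u r) leaf) S (suc m)
          ≈⟨ meanderWeight-true (cons (node u r) leaf) (cong suc (trans (sym (ℕ.+-identityʳ _)) e)) h ⟩
        y ⊗ 1# ⊗ meanderWeight (node leaf u ⧺ r) S m
          ≈⟨ *-cong (*-identityʳ y) (≈-trans (≈-reflexive (cong (λ t → meanderWeight t S m) (trans (cons-⧺ u leaf r) (cong (cons u) (leaf-⧺ r)))))
               (IH u r m≡)) ⟩
        y ⊗ (weight u S ⊗ blockWeight factor₁ r (shiftS S (size u)))
          ≈⟨ weight-true u r S (trans (cong S m≡) h) ⟨
        weight (node u r) S
          ≈⟨ *-identityʳ _ ⟨
        weight (node u r) S ⊗ 1# ∎
        where
        m≡ : size u + size r ≡ m
        m≡ = ℕ.suc-injective (trans (sym (ℕ.+-identityʳ _)) e)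
      step-true h u (node v leaf) e = begin
        meanderWeight (node (cons u v) leaf) S (suc m)
          ≈⟨ meanderWeight-true (node (cons u v) leaf) (trans (size-cons u (node v leaf)) (cong suc e)) h ⟩
        1# ⊗ meanderWeight (cons u v) S m
          ≈⟨ ≈-trans (*-identityˡ _) (IH u v m≡) ⟩
        weight u S ⊗ blockWeight factor₁ v S′
          ≈⟨ *-congˡ (≈-trans (*-congˡ (≈-trans (*-congʳ (≈-reflexive (cong factor₁ (trans (cong S m≡) h)))) (*-identityʳ _))) (*-identityʳ _)) ⟨
        weight u S ⊗ (blockWeight factor₁ v S′ ⊗ (factor₁ (S (size u + size v)) ⊗ 1#)) ∎
        where
        S′ : ℕ → Bool
        S′ = shiftS S (size u)
        m≡ : size u + size v ≡ m
        m≡ = ℕ.suc-injective (trans (sym (ℕ.+-suc (size u) _)) (trans (cong (λ z → size u + suc z) (sym (ℕ.+-identityʳ (size v)))) e))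
      -- The block `r` of `m` lies in the last gap and is absorbed by the last block: `R` remains as
      -- a gap, and the gaps of `r` follow.
      step-true h u (node v (node R r)) e = begin
        meanderWeight (node (cons u v) (node R r)) S (suc m)
          ≈⟨ meanderWeight-true (node (cons u v) (node R r)) (trans (size-cons u (node v (node R r))) (cong suc e)) h ⟩
        y ⊗ 1# ⊗ meanderWeight (cons u (node v R) ⧺ r) S m
          ≈⟨ *-cong (*-identityʳ y) (≈-trans (≈-reflexive (cong (λ t → meanderWeight t S m) (cons-⧺ u (node v R) r)))
               (IH u (node v R ⧺ r) size≡)) ⟩
        y ⊗ (weight u S ⊗ blockWeight factor₁ (node v R ⧺ r) S′)
          ≈⟨ *-congˡ (*-congˡ (blockWeight-⧺ factor₁ (node v R) r S′)) ⟩
        y ⊗ (weight u S ⊗ (blockWeight factor₁ (node v R) S′ ⊗ blockWeight factor₁ r (shiftS S′ (size (node v R)))))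
          ≈⟨ solve 6 (λ y w q f x z → y :* (w :* (q :* (f :* x) :* z)) := w :* (q :* (f :* (y :* (x :* z))))) ≈-refl _ _ _ _ _ _ ⟩
        weight u S ⊗ (blockWeight factor₁ v S′ ⊗ (factor₁ (S′ (size v)) ⊗ (y ⊗ (weight R S″ ⊗ blockWeight factor₁ r (shiftS S′ (size (node v R)))))))
          ≈⟨ *-congˡ (*-congˡ (*-congˡ (≈-trans (weight-true R r S″ (trans (cong S index) h))
               (*-congˡ (*-congˡ (≈-reflexive (blockWeight-cong factor₁ r (λ {i} _ → cong S′ (trans (ℕ.+-suc (size v) _) (cong suc (sym (ℕ.+-assoc (size v) (size R) i)))))))))))) ⟨
        weight u S ⊗ (blockWeight factor₁ v S′ ⊗ (factor₁ (S′ (size v)) ⊗ weight (node R r) S″)) ∎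
        where
        S′ S″ : ℕ → Bool
        S′ = shiftS S (size u)
        S″ i = S′ (size v + suc i)
        e′ : size u + (size v + suc (size R + size r)) ≡ m
        e′ = ℕ.suc-injective (trans (sym (ℕ.+-suc (size u) _)) e)
        index : size u + (size v + suc (size R + size r)) ≡ m
        index = e′
        size≡ : size u + size (node v R ⧺ r) ≡ m
        size≡ = trans (cong (size u +_) (trans (size-⧺ (node v R) r) (trans (cong suc (ℕ.+-assoc (size v) _ _)) (sym (ℕ.+-suc (size v) _))))) e′

      step-false : S m ≡ false → ∀ u v → Goal u v
      step-false h (node u leaf) leaf e = begin
        meanderWeight (cons (node u leaf) leaf) S (suc m)
          ≈⟨ meanderWeight-false (cons (node u leaf) leaf) (cong suc (trans (sym (ℕ.+-identityʳ _)) e)) h ⟩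
        a ⊗ 1# ⊗ meanderWeight (cons u leaf) S m
          ≈⟨ *-cong (*-identityʳ a) (≈-trans (IH u leaf m≡) (*-identityʳ _)) ⟩
        a ⊗ weight u S
          ≈⟨ weight-false-leaf u S (trans (cong S m≡) h) ⟨
        weight (node u leaf) S
          ≈⟨ *-identityʳ _ ⟨
        weight (node u leaf) S ⊗ 1# ∎
        where
        m≡ : size u + 0 ≡ m
        m≡ = ℕ.suc-injective (trans (sym (ℕ.+-identityʳ _)) e)
      step-false h (node u (node r₁ r₂)) leaf e = begin
        meanderWeight (cons (node u (node r₁ r₂)) leaf) S (suc m)
          ≈⟨ meanderWeight-false (cons (node u (node r₁ r₂)) leaf) (cong suc (trans (sym (ℕ.+-identityʳ _)) e)) h ⟩
        a ⊗ (y ⊗ 1#) ⊗ meanderWeight (cons (node u r₁ ⧺ r₂) leaf) S m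
          ≈⟨ *-cong (*-congˡ (*-identityʳ y)) (≈-trans (IH (node u r₁ ⧺ r₂) leaf size≡) (*-identityʳ _)) ⟩
        a ⊗ y ⊗ weight (node u r₁ ⧺ r₂) S
          ≈⟨ weight-false-node u r₁ r₂ S (trans (cong S m≡) h) ⟨
        weight (node u (node r₁ r₂)) S
          ≈⟨ *-identityʳ _ ⟨
        weight (node u (node r₁ r₂)) S ⊗ 1# ∎
        where
        m≡ : size u + suc (size r₁ + size r₂) ≡ m
        m≡ = ℕ.suc-injective (trans (sym (ℕ.+-identityʳ _)) e)
        size≡ : size (node u r₁ ⧺ r₂) + 0 ≡ m
        size≡ = trans (ℕ.+-identityʳ _) (trans (trans (size-⧺ (node u r₁) r₂) (trans (cong suc (ℕ.+-assoc (size u) _ _)) (sym (ℕ.+-suc (size u) _)))) m≡)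
      -- The point `m` lies in the last block itself, where an element outside `S` has weight
      -- `a ⊗ y`.
      step-false h u (node v leaf) e = begin
        meanderWeight (node (cons u v) leaf) S (suc m)
          ≈⟨ meanderWeight-false (node (cons u v) leaf) (trans (size-cons u (node v leaf)) (cong suc e)) h ⟩
        a ⊗ (y ⊗ 1#) ⊗ meanderWeight (cons u v) S m
          ≈⟨ *-cong (*-congˡ (*-identityʳ y)) (IH u v m≡) ⟩
        a ⊗ y ⊗ (weight u S ⊗ blockWeight factor₁ v S′)
          ≈⟨ solve 3 (λ c w q → c :* (w :* q) := w :* (q :* (c :* con 1))) ≈-refl _ _ _ ⟩
        weight u S ⊗ (blockWeight factor₁ v S′ ⊗ (a ⊗ y ⊗ 1#))
          ≈⟨ *-congˡ (*-congˡ (*-congʳ (≈-reflexive (cong factor₁ (sym (trans (cong S m≡) h)))))) ⟩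
        weight u S ⊗ (blockWeight factor₁ v S′ ⊗ (factor₁ (S (size u + size v)) ⊗ 1#)) ∎
        where
        S′ : ℕ → Bool
        S′ = shiftS S (size u)
        m≡ : size u + size v ≡ m
        m≡ = ℕ.suc-injective (trans (sym (ℕ.+-suc (size u) _)) (trans (cong (λ z → size u + suc z) (sym (ℕ.+-identityʳ (size v)))) e))
      step-false h u (node v (node R leaf)) e = begin
        meanderWeight (node (cons u v) (node R leaf)) S (suc m)
          ≈⟨ meanderWeight-false (node (cons u v) (node R leaf)) (trans (size-cons u (node v (node R leaf))) (cong suc e)) h ⟩
        a ⊗ 1# ⊗ meanderWeight (cons u (node v R)) S m
          ≈⟨ *-cong (*-identityʳ a) (IH u (node v R) size≡) ⟩
        a ⊗ (weight u S ⊗ (blockWeight factor₁ v S′ ⊗ (factor₁ (S′ (size v)) ⊗ weight R S″)))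
          ≈⟨ solve 5 (λ a w q f x → a :* (w :* (q :* (f :* x))) := w :* (q :* (f :* (a :* x)))) ≈-refl _ _ _ _ _ ⟩
        weight u S ⊗ (blockWeight factor₁ v S′ ⊗ (factor₁ (S′ (size v)) ⊗ (a ⊗ weight R S″)))
          ≈⟨ *-congˡ (*-congˡ (*-congˡ (weight-false-leaf R S″ (trans (cong S e′) h)))) ⟨
        weight u S ⊗ (blockWeight factor₁ v S′ ⊗ (factor₁ (S′ (size v)) ⊗ weight (node R leaf) S″)) ∎
        where
        S′ S″ : ℕ → Bool
        S′ = shiftS S (size u)
        S″ i = S′ (size v + suc i)
        e′ : size u + (size v + suc (size R + 0)) ≡ m
        e′ = ℕ.suc-injective (trans (sym (ℕ.+-suc (size u) _)) e)
        size≡ : size u + suc (size v + size R) ≡ m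
        size≡ = trans (cong (size u +_) (trans (sym (ℕ.+-suc (size v) (size R))) (cong (λ z → size v + suc z) (sym (ℕ.+-identityʳ (size R)))))) e′
      step-false h u (node v (node R (node r₁ r₂))) e = begin
        meanderWeight (node (cons u v) (node R (node r₁ r₂))) S (suc m)
          ≈⟨ meanderWeight-false (node (cons u v) (node R (node r₁ r₂))) (trans (size-cons u (node v (node R (node r₁ r₂)))) (cong suc e)) h ⟩
        a ⊗ (y ⊗ 1#) ⊗ meanderWeight (cons u (node v (node R r₁ ⧺ r₂))) S m
          ≈⟨ *-cong (*-congˡ (*-identityʳ y)) (IH u (node v (node R r₁ ⧺ r₂)) size≡) ⟩
        a ⊗ y ⊗ (weight u S ⊗ (blockWeight factor₁ v S′ ⊗ (factor₁ (S′ (size v)) ⊗ weight (node R r₁ ⧺ r₂) S″)))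
          ≈⟨ solve 5 (λ c w q f x → c :* (w :* (q :* (f :* x))) := w :* (q :* (f :* (c :* x)))) ≈-refl _ _ _ _ _ ⟩
        weight u S ⊗ (blockWeight factor₁ v S′ ⊗ (factor₁ (S′ (size v)) ⊗ (a ⊗ y ⊗ weight (node R r₁ ⧺ r₂) S″)))
          ≈⟨ *-congˡ (*-congˡ (*-congˡ (weight-false-node R r₁ r₂ S″ (trans (cong S e′) h)))) ⟨
        weight u S ⊗ (blockWeight factor₁ v S′ ⊗ (factor₁ (S′ (size v)) ⊗ weight (node R (node r₁ r₂)) S″)) ∎
        where
        S′ S″ : ℕ → Bool
        S′ = shiftS S (size u)
        S″ i = S′ (size v + suc i)
        e′ : size u + (size v + suc (size R + suc (size r₁ + size r₂))) ≡ m
        e′ = ℕ.suc-injective (trans (sym (ℕ.+-suc (size u) _)) e)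
        size≡ : size u + suc (size v + size (node R r₁ ⧺ r₂)) ≡ m
        size≡ = trans (cong (size u +_) (trans (sym (ℕ.+-suc (size v) _)) (cong (λ z → size v + suc z)
          (trans (size-⧺ (node R r₁) r₂) (trans (cong suc (ℕ.+-assoc (size R) _ _)) (sym (ℕ.+-suc (size R) _))))))) e′

      step : ∀ s → S m ≡ s → ∀ u v → Goal u v
      step true  = step-true
      step false = step-false

  -- The tree of the Kreweras complement of cons u v is node u v, and S the set of its elements that are
  -- ends of blocks of the interval partition; both sides are reduced by removing the last element.
  meanderWeight-node : ∀ S m u v → size u + size v ≡ m →
    meanderWeight (cons u v) S m ≈ weight u S ⊗ blockWeight factor₁ v (shiftS S (size u))
  meanderWeight-node S zero    leaf leaf e = ≈-refl
  meanderWeight-node S (suc m) = Step.step S m (meanderWeight-node S m) (S m) refl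

-- Sets avoiding the last block

avoids : Tree → (ℕ → Bool) → Bool
avoids leaf       S = true
avoids (node L R) S = avoids L S ∧ not (S (size L))

private
  block-left : ∀ L R {j} → j ≤ size L → at (block (node L R)) j ≡ at (block L) j
  block-left L R h = at-++ˡ (block L) (ℕ.≤-trans (s≤s h) (ℕ.≤-reflexive (sym (length-block L))))

  block-gap : ∀ L R {j} → j < size R → at (block (node L R)) (size L + suc j) ≢ 0
  block-gap L R {j} h = at-gap L R (ℕ.m<m+n (size L) z<s) (<-right (size L) h)

avoids⁻ : ∀ t {S} → avoids t S ≡ true → ∀ {j} → j < size t → at (block t) j ≡ 0 → S j ≡ false
avoids⁻ (node L R) {S} h l q with viewFirst (size L) (size R) l
... | inLeft l′  = avoids⁻ L (proj₁ (∧-true⁻ {avoids L S} h)) l′ (trans (sym (block-left L R (ℕ.<⇒≤ l′))) q)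
... | isFirst    = not-true⁻ (proj₂ (∧-true⁻ {avoids L S} h))
... | inRight l′ = ⊥-elim (block-gap L R l′ q)

avoids⁺ : ∀ t {S} → (∀ {j} → j < size t → at (block t) j ≡ 0 → S j ≡ false) → avoids t S ≡ true
avoids⁺ leaf       h = refl
avoids⁺ (node L R) h = ∧-true⁺
  (avoids⁺ L (λ l q → h (<-left (size R) l) (trans (block-left L R (ℕ.<⇒≤ l)) q)))
  (not-true⁺ (h (s≤s (ℕ.m≤m+n (size L) (size R))) (trans (block-left L R ℕ.≤-refl) (block-size L))))

-- The block of the last point has label `blocks u`, which exceeds all labels of `u`; only points of
-- `v` can share it.
free-avoids : ∀ S u v → free S (node u v) (size u + size v) ≡ avoids v (λ i → S (size u + i))
free-avoids S u v = bool-iff to from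
  where
  m : ℕ
  m = size u + size v
  lab : ℕ → ℕ
  lab = at (labels (node u v))
  lab-right : ∀ {j} → j < suc (size v) → lab (size u + j) ≡ blocks u + at (block v) j
  lab-right {j} l = trans (cong (λ z → lab (z + j)) (sym (length-labels u))) (trans (at-++ʳ (labels u) j)
    (at-map (blocks u +_) (block v) (subst (j <_) (sym (length-block v)) l)))
  lab-last : lab m ≡ blocks u + 0
  lab-last = trans (lab-right (ℕ.n<1+n (size v))) (cong (blocks u +_) (block-size v))
  lab-left : ∀ {i} → i < size u → lab i ≢ lab m
  lab-left {i} l q = ℕ.<⇒≢ (subst (_< blocks u) (sym (at-++ˡ (labels u) l′)) (at-All (grow-bounded (grow-labels u)) l′))
    (trans q (trans lab-last (ℕ.+-identityʳ _)))
    where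
    l′ : i < length (labels u)
    l′ = subst (i <_) (sym (length-labels u)) l
  to : free S (node u v) m ≡ true → avoids v (λ i → S (size u + i)) ≡ true
  to h = avoids⁺ v λ {j} l q → ¬true⇒false λ s → true≢false
    (∧-true⁺ s (≡ᵇ⁺ {lab (size u + j)} {lab m} (trans (lab-right (ℕ.m<n⇒m<1+n l)) (trans (cong (blocks u +_) q) (sym lab-last)))))
    (not-true⁻ (allUpTo⁻ {n = m} h (ℕ.+-monoʳ-< (size u) l)))
  from : avoids v (λ i → S (size u + i)) ≡ true → free S (node u v) m ≡ true
  from h = allUpTo⁺ {n = m} λ {i} l → not-true⁺ (¬true⇒false λ q → let s , e = ∧-true⁻ {S i} q in hit l s (≡ᵇ⁻ {lab i} e))
    where
    hit : ∀ {i} → i < m → S i ≡ true → lab i ≡ lab m → ⊥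
    hit l s q with viewLast (size u) (size v) (ℕ.m<n⇒m<1+n l)
    ... | inLeft l′  = lab-left l′ q
    ... | isLast     = ℕ.<-irrefl refl l
    ... | inRight l′ = true≢false s (avoids⁻ v h l′ (ℕ.+-cancelˡ-≡ (blocks u) _ _
      (trans (sym (lab-right (ℕ.m<n⇒m<1+n l′))) (trans q lab-last))))

-- Lengths of the permutations in the statement

-- `kreweras` describes `node u v` as a complement. To find the complement of `node u v` itself, the
-- tree has to be written as a `cons`.
uncons : ∀ u v → ∃ λ u′ → ∃ λ v′ → cons u′ v′ ≡ node u v
uncons leaf       R = R , leaf , refl
uncons (node L r) R with uncons L r
... | u′ , v′ , e = u′ , node v′ R , cong (λ z → node z R) e

-- The identity #β + #β^Kr = n + 1 for the partition of `cons u v`, with one block of `node u v`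
-- cancelled against the 1.
blocks-kreweras : ∀ u v → blocks (cons u v) + (blocks u + inner v) ≡ suc (size u + size v)
blocks-kreweras u v = begin
  blocks (cons u v) + (blocks u + inner v)              ≡⟨ cong (_+ (blocks u + inner v)) (blocks-cons u v) ⟩
  suc ((inner u + blocks v) + (blocks u + inner v))     ≡⟨ cong suc (ℕ.+-assoc (inner u) (blocks v) _) ⟩
  suc (inner u + (blocks v + (blocks u + inner v)))     ≡⟨ cong (λ z → suc (inner u + z)) (ℕ.+-assoc (blocks v) (blocks u) _) ⟨
  suc (inner u + ((blocks v + blocks u) + inner v))     ≡⟨ cong (λ z → suc (inner u + (z + inner v))) (ℕ.+-comm (blocks v) (blocks u)) ⟩
  suc (inner u + ((blocks u + blocks v) + inner v))     ≡⟨ cong (λ z → suc (inner u + z)) (ℕ.+-assoc (blocks u) (blocks v) _) ⟩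
  suc (inner u + (blocks u + (blocks v + inner v)))     ≡⟨ cong suc (ℕ.+-assoc (inner u) (blocks u) _) ⟨
  suc ((inner u + blocks u) + (blocks v + inner v))     ≡⟨ cong suc (cong₂ _+_ (trans (ℕ.+-comm (inner u) _) (blocks+inner u)) (blocks+inner v)) ⟩
  suc (size u + size v) ∎
  where open ≡-Reasoning

∸-unique : ∀ i {j n} → i + j ≡ n → n ∸ i ≡ j
∸-unique i {j} refl = ℕ.m+n∸m≡n i j

∥ι∥ : ∀ S m → ∥ ι S m ∥[ suc m ] ≡ countFalse S m
∥ι∥ S m = ∸-unique (#cyc (suc m) (ι S m)) (trans (cong (_+ countFalse S m) (begin
  #cyc (suc m) (ι S m)                                ≡⟨ cong (λ z → #cyc z (ι S m)) (size-interval S m) ⟨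
  #cyc (size t) (ι S m)                               ≡⟨ #cyc-inverse (IsPerm-inverse t) (IsPerm-perm t) (perm-inverse t) ⟩
  #cyc (size t) (at (perm t))                         ≡⟨ #cyc-perm t ⟩
  blocks t ∎)) (blocks-interval S m))
  where
  open ≡-Reasoning
  t : Tree
  t = interval S m

toPerm-perm : ∀ t {n i} → size t ≡ n → i < n → toPerm n (labels t) i ≡ at (perm t) i
toPerm-perm t refl l = toPerm-labels t l

IsPerm-toPerm : ∀ t {n} → size t ≡ n → IsPerm n (toPerm n (labels t))
IsPerm-toPerm t refl = IsPerm-cong (λ l → sym (toPerm-labels t l)) (IsPerm-perm t)

-- Here β is the partition of node u v, α the complement of the interval partition of S.
module KLengths (S : ℕ → Bool) (u v : Tree) {α β : ℕ → ℕ}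
                (α-ι : ∀ {i} → i < suc (size u + size v) → α i ≡ ι S (size u + size v) (γ (suc (size u + size v)) i))
                (β-perm : ∀ {i} → i < suc (size u + size v) → β i ≡ at (perm (node u v)) i) where

  private
    m n : ℕ
    m = size u + size v
    n = suc m

    open KrInterval S m α α-ι using () renaming (IsPerm-κ to IsPerm-α)

    IsPerm-β : IsPerm n β
    IsPerm-β = IsPerm-cong (λ l → sym (β-perm l)) (IsPerm-perm (node u v))

    α⁻¹ : ℕ → ℕ
    α⁻¹ = inv n α

    IsPerm-α⁻¹ : IsPerm n α⁻¹
    IsPerm-α⁻¹ = IsPerm-inv IsPerm-α

    ιγα⁻¹ : ∀ {i} → i < n → ι S m (γ n (α⁻¹ i)) ≡ i
    ιγα⁻¹ l = trans (sym (α-ι (bounded IsPerm-α⁻¹ l))) (inv-rightInverse IsPerm-α l)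

  -- Since α = ι γ, while β is the inverse of `perm (cons u v)` times γ, the product α⁻¹β is
  -- conjugate by γ to the inverse of the meander.
  ∥α⁻¹β∥ : ∥ inv (suc (size u + size v)) α ∘ₚ β ∥[ suc (size u + size v) ] ≡ ∥meander∥ (cons u v) S (size u + size v)
  ∥α⁻¹β∥ = cong (n ∸_) (#cyc-conjugate-inverse (IsPerm-∘ IsPerm-α⁻¹ IsPerm-β) (IsPerm-meander (cons u v) S (size-cons u v)) (IsPerm-γ m)
    (λ l → trans (cong (at (perm (cons u v))) (trans (ιγα⁻¹ (bounded IsPerm-β l)) (β-perm l))) (kreweras u v l)))

  ∥α⁻¹γ∥ : ∥ inv (suc (size u + size v)) α ∘ₚ γ (suc (size u + size v)) ∥[ suc (size u + size v) ] ≡ countFalse S (size u + size v)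
  ∥α⁻¹γ∥ = trans (cong (n ∸_) (#cyc-conjugate-inverse (IsPerm-∘ IsPerm-α⁻¹ (IsPerm-γ m)) (IsPerm-ι S m) (IsPerm-γ m)
    (λ l → ιγα⁻¹ (bounded (IsPerm-γ m) l)))) (∥ι∥ S m)

  -- By #β + #β^Kr = n + 1, the length of the complement is one less than the number of blocks of
  -- `node u v`: the last block is not counted.
  ∥β⁻¹γ∥ : ∥ inv (suc (size u + size v)) β ∘ₚ γ (suc (size u + size v)) ∥[ suc (size u + size v) ] ≡ blocks u + inner v
  ∥β⁻¹γ∥ with uncons u v
  ... | u′ , v′ , e = ∸-unique (#cyc n (inv n β ∘ₚ γ n)) (trans (cong (_+ (blocks u + inner v)) #blocks) (ℕ.suc-injective blocks≡))
    where
    size≡ : size (node u′ v′) ≡ n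
    size≡ = trans (sym (size-cons u′ v′)) (cong size e)
    complement : ∀ {i} → i < n → at (perm (node u′ v′)) i ≡ inv n β (γ n i)
    complement {i} l = trans (sym (inv-leftInverse IsPerm-β x<n)) (cong (inv n β)
      (trans (β-perm x<n) (trans (cong (λ z → at (perm z) x) (sym e)) (trans (kreweras u′ v′ (subst (i <_) (sym size≡) l)) (cong (λ z → γ z i) size≡)))))
      where
      x : ℕ
      x = at (perm (node u′ v′)) i
      x<n : x < n
      x<n = subst (x <_) size≡ (perm-bounded (node u′ v′) (subst (i <_) (sym size≡) l))
    #blocks : #cyc n (inv n β ∘ₚ γ n) ≡ blocks (node u′ v′)
    #blocks = trans (sym (#cyc-cong (subst (λ z → IsPerm z (at (perm (node u′ v′)))) size≡ (IsPerm-perm (node u′ v′))) complement))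
      (trans (cong (λ z → #cyc z (at (perm (node u′ v′)))) (sym size≡)) (#cyc-perm (node u′ v′)))
    blocks≡ : suc (blocks (node u′ v′) + (blocks u + inner v)) ≡ suc n
    blocks≡ = begin
      suc (blocks (node u′ v′) + (blocks u + inner v))  ≡⟨ ℕ.+-suc (blocks (node u′ v′)) _ ⟨
      blocks (node u′ v′) + suc (blocks u + inner v)    ≡⟨ cong (blocks (node u′ v′) +_) (ℕ.+-suc (blocks u) (inner v)) ⟨
      blocks (node u′ v′) + blocks (node u v)           ≡⟨ cong (λ z → blocks (node u′ v′) + blocks z) e ⟨
      blocks (node u′ v′) + blocks (cons u′ v′)         ≡⟨ cong (_+ blocks (cons u′ v′)) (ℕ.+-suc (blocks u′) (inner v′)) ⟩
      suc ((blocks u′ + inner v′) + blocks (cons u′ v′)) ≡⟨ cong suc (trans (ℕ.+-comm (blocks u′ + inner v′) _) (blocks-kreweras u′ v′)) ⟩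
      suc (size (node u′ v′))                           ≡⟨ cong suc size≡ ⟩
      suc n ∎
      where open ≡-Reasoning

-- Here β is the partition of cons u v, α the interval partition of S.
module MLengths (S : ℕ → Bool) (u v : Tree) where

  private
    m n : ℕ
    m = size u + size v
    n = suc m
    α β : ℕ → ℕ
    α = intervalPerm S m
    β = toPerm n (labels (cons u v))

  ∥α∥ : ∥ intervalPerm S (size u + size v) ∥[ suc (size u + size v) ] ≡ countFalse S (size u + size v)
  ∥α∥ = trans (cong (n ∸_) (#cyc-inverse (IsPerm-intervalPerm S m) (IsPerm-ι S m)
    (λ l → trans (sym (inv-intervalPerm S m (bounded (IsPerm-intervalPerm S m) l))) (inv-leftInverse (IsPerm-intervalPerm S m) l)))) (∥ι∥ S m)

  ∥β∥ : ∥ toPerm (suc (size u + size v)) (labels (cons u v)) ∥[ suc (size u + size v) ] ≡ blocks u + inner v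
  ∥β∥ = ∸-unique (#cyc n β) (trans (cong (_+ (blocks u + inner v)) (begin
    #cyc n β                                 ≡⟨ #cyc-cong (IsPerm-toPerm (cons u v) (size-cons u v)) (toPerm-perm (cons u v) (size-cons u v)) ⟩
    #cyc n (at (perm (cons u v)))            ≡⟨ cong (λ z → #cyc z (at (perm (cons u v)))) (size-cons u v) ⟨
    #cyc (size (cons u v)) (at (perm (cons u v))) ≡⟨ #cyc-perm (cons u v) ⟩
    blocks (cons u v) ∎)) (blocks-kreweras u v))
    where open ≡-Reasoning

  -- Here α⁻¹β is ι β, and conjugation by β turns it into β ι, the meander.
  ∥α⁻¹β∥ : ∥ inv (suc (size u + size v)) (intervalPerm S (size u + size v)) ∘ₚ toPerm (suc (size u + size v)) (labels (cons u v)) ∥[ suc (size u + size v) ]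
           ≡ ∥meander∥ (cons u v) S (size u + size v)
  ∥α⁻¹β∥ = cong (n ∸_) (#cyc-conjugate (IsPerm-∘ (IsPerm-inv (IsPerm-intervalPerm S m)) P) (IsPerm-meander (cons u v) S (size-cons u v)) P
    (λ l → trans (sym (toPerm-perm (cons u v) (size-cons u v) (bounded (IsPerm-ι S m) (bounded P l))))
                 (cong β (sym (inv-intervalPerm S m (bounded P l))))))
    where
    P : IsPerm n β
    P = IsPerm-toPerm (cons u v) (size-cons u v)

-- Generating functions

module Generating {c ℓ} (R : CommutativeRing c ℓ) (y yi a b : CommutativeRing.Carrier R)
                  (y⊗yi≈1 : CommutativeRing._≈_ R (CommutativeRing._*_ R y yi) (CommutativeRing.1# R)) where

  open Weights R y yi a b y⊗yi≈1

  -- Sums over subsets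

  sumS : ℕ → ((ℕ → Bool) → Carrier) → Carrier
  sumS m F = sumL (bits m) (F ∘ fn)

  -- Sets arising from different bit lists agree only pointwise in a range. Summands that depend on
  -- this range alone can be exchanged.
  Local : ℕ → ((ℕ → Bool) → Carrier) → Set c
  Local m F = ∀ {S S′} → (∀ {i} → i < m → S i ≡ S′ i) → F S ≡ F S′

  private
    push : Bool → (ℕ → Bool) → ℕ → Bool
    push s S zero    = s
    push s S (suc i) = S i

    push-cong : ∀ {m s S S′} → (∀ {i} → i < m → S i ≡ S′ i) → ∀ {i} → i < suc m → push s S i ≡ push s S′ i
    push-cong h {zero}  l       = refl
    push-cong h {suc i} (s≤s l) = h l

    fn-push : ∀ {m} s bs {i} → i < m → fn (s ∷ bs) i ≡ push s (fn bs) i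
    fn-push s bs {zero}  l = refl
    fn-push s bs {suc i} l = refl

  sumS-suc : ∀ m F → Local (suc m) F → sumS (suc m) F ≈ sumS m (F ∘ push false) ⊕ sumS m (F ∘ push true)
  sumS-suc m F loc = ≈-trans (sumL-++ (F ∘ fn) (map (false ∷_) (bits m)) _) (+-cong (part false) (part true))
    where
    part : ∀ s → sumL (map (s ∷_) (bits m)) (F ∘ fn) ≈ sumS m (F ∘ push s)
    part s = ≈-trans (≈-reflexive (sumL-map (s ∷_) (F ∘ fn) (bits m)))
      (sumL-cong (bits m) (λ {bs} _ → ≈-reflexive (loc (fn-push s bs))))

  sumS-split : ∀ m k (F G : (ℕ → Bool) → Carrier) → Local m F →
               sumL (bits (m + k)) (λ bs → F (fn bs) ⊗ G (λ i → fn bs (m + i))) ≈ sumS m F ⊗ sumS k G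
  sumS-split zero    k F G loc = begin
    sumL (bits k) (λ bs → F (fn bs) ⊗ G (fn bs))
      ≈⟨ sumL-cong (bits k) (λ {bs} _ → *-congʳ (≈-reflexive (loc {fn bs} {fn []} (λ ())))) ⟩
    sumL (bits k) (λ bs → F (fn []) ⊗ G (fn bs))
      ≈⟨ sumL-⊗ˡ (F (fn [])) (G ∘ fn) (bits k) ⟨
    F (fn []) ⊗ sumS k G
      ≈⟨ *-congʳ (+-identityʳ _) ⟨
    (F (fn []) ⊕ 0#) ⊗ sumS k G ∎
  sumS-split (suc m) k F G loc = begin
    sumL (bits (suc m + k)) H
      ≈⟨ sumL-++ H (map (false ∷_) (bits (m + k))) _ ⟩
    sumL (map (false ∷_) (bits (m + k))) H ⊕ sumL (map (true ∷_) (bits (m + k))) H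
      ≈⟨ +-cong (part false) (part true) ⟩
    sumS m (F ∘ push false) ⊗ sumS k G ⊕ sumS m (F ∘ push true) ⊗ sumS k G
      ≈⟨ distribʳ _ _ _ ⟨
    (sumS m (F ∘ push false) ⊕ sumS m (F ∘ push true)) ⊗ sumS k G
      ≈⟨ *-congʳ (sumS-suc m F loc) ⟨
    sumS (suc m) F ⊗ sumS k G ∎
    where
    H : List Bool → Carrier
    H bs = F (fn bs) ⊗ G (λ i → fn bs (suc m + i))
    part : ∀ s → sumL (map (s ∷_) (bits (m + k))) H ≈ sumS m (F ∘ push s) ⊗ sumS k G
    part s = ≈-trans (≈-reflexive (sumL-map (s ∷_) H (bits (m + k))))
      (≈-trans (sumL-cong (bits (m + k)) (λ {bs} _ → *-congʳ (≈-reflexive (loc (fn-push s bs)))))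
        (sumS-split m k (F ∘ push s) G (λ h → loc (push-cong h))))

  -- The sum over both choices for one element: 1 + AY for `factor₁` and AY for `factor₀`, the two
  -- bases of powers in `g`.
  total : (Bool → Carrier) → Carrier
  total z = z true ⊕ z false

  sumS-1 : ∀ z → sumS 1 (λ S → z (S 0)) ≈ total z
  sumS-1 z = solve 2 (λ p q → p :+ (q :+ con 0) := q :+ p) ≈-refl (z false) (z true)

  sumS-block-last : ∀ z t → sumS (suc (size t)) (λ S → blockWeight z t S ⊗ z (S (size t))) ≈ sumS (size t) (blockWeight z t) ⊗ total z
  sumS-block-last z t = begin
    sumS (suc (size t)) (λ S → blockWeight z t S ⊗ z (S (size t)))
      ≈⟨ ≈-reflexive (cong (λ k → sumS k (λ S → blockWeight z t S ⊗ z (S (size t)))) (ℕ.+-comm 1 (size t))) ⟩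
    sumS (size t + 1) (λ S → blockWeight z t S ⊗ z (S (size t)))
      ≈⟨ sumL-cong (bits (size t + 1)) (λ {bs} _ → *-congˡ (≈-reflexive (cong (z ∘ fn bs) (sym (ℕ.+-identityʳ (size t)))))) ⟩
    sumL (bits (size t + 1)) (λ bs → blockWeight z t (fn bs) ⊗ z (fn bs (size t + 0)))
      ≈⟨ sumS-split (size t) 1 (blockWeight z t) (λ S → z (S 0)) (blockWeight-cong z t) ⟩
    sumS (size t) (blockWeight z t) ⊗ sumS 1 (λ S → z (S 0))
      ≈⟨ *-congˡ (sumS-1 z) ⟩
    sumS (size t) (blockWeight z t) ⊗ total z ∎

  sumS-full : ∀ t → sumS (suc (size t)) (fullWeight t) ≈
    y ⊗ (sumS (size t) (blockWeight factor₁ t) ⊗ total factor₁) ⊕ (yi ⊕ - y) ⊗ (sumS (size t) (blockWeight factor₀ t) ⊗ total factor₀)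
  sumS-full t = ≈-trans (sumL-⊕ _ _ (bits (suc (size t))))
    (+-cong (≈-trans (≈-sym (sumL-⊗ˡ y _ (bits (suc (size t))))) (*-congˡ (sumS-block-last factor₁ t)))
            (≈-trans (≈-sym (sumL-⊗ˡ (yi ⊕ - y) _ (bits (suc (size t))))) (*-congˡ (sumS-block-last factor₀ t))))

  sumS-weight : ∀ L R → sumS (size (node L R)) (weight (node L R)) ≈ sumS (size L) (weight L) ⊗ sumS (suc (size R)) (fullWeight R)
  sumS-weight L R = ≈-trans (≈-reflexive (cong (λ k → sumS k (weight (node L R))) (sym (ℕ.+-suc (size L) (size R)))))
    (sumS-split (size L) (suc (size R)) (weight L) (fullWeight R) (weight-cong L))

  sumS-block : ∀ z L R → sumS (size (node L R)) (blockWeight z (node L R)) ≈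
                         sumS (size L) (blockWeight z L) ⊗ (total z ⊗ sumS (size R) (weight R))
  sumS-block z L R = begin
    sumS (suc (size L + size R)) (blockWeight z (node L R))
      ≈⟨ ≈-reflexive (cong (λ k → sumS k (blockWeight z (node L R))) (sym (ℕ.+-suc (size L) (size R)))) ⟩
    sumS (size L + suc (size R)) (blockWeight z (node L R))
      ≈⟨ sumL-cong (bits (size L + suc (size R))) (λ {bs} _ → *-congˡ (*-congʳ (≈-reflexive (cong (z ∘ fn bs) (sym (ℕ.+-identityʳ (size L))))))) ⟩
    sumL (bits (size L + suc (size R))) (λ bs → blockWeight z L (fn bs) ⊗ rest (λ i → fn bs (size L + i)))
      ≈⟨ sumS-split (size L) (suc (size R)) (blockWeight z L) rest (blockWeight-cong z L) ⟩
    sumS (size L) (blockWeight z L) ⊗ sumS (suc (size R)) rest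
      ≈⟨ *-congˡ (sumS-split 1 (size R) (λ S → z (S 0)) (weight R) (λ h → cong z (h z<s))) ⟩
    sumS (size L) (blockWeight z L) ⊗ (sumS 1 (λ S → z (S 0)) ⊗ sumS (size R) (weight R))
      ≈⟨ *-congˡ (*-congʳ (sumS-1 z)) ⟩
    sumS (size L) (blockWeight z L) ⊗ (total z ⊗ sumS (size R) (weight R)) ∎
    where
    rest : (ℕ → Bool) → Carrier
    rest S = z (S 0) ⊗ weight R (λ i → S (suc i))

  -- The product of `g` over all blocks. In `gaps` the enclosing block is left out; it has
  -- `suc (len t)` elements, one more than gaps.
  treeWeight : Tree → Carrier
  len        : Tree → ℕ
  gaps       : Tree → Carrier
  treeWeight leaf       = 1#
  treeWeight (node L R) = treeWeight L ⊗ (g (suc (len R)) ⊗ gaps R)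
  len leaf       = 0
  len (node L R) = suc (len L)
  gaps leaf       = 1#
  gaps (node L R) = gaps L ⊗ treeWeight R

  pow-cong : ∀ {x x′} n → x ≈ x′ → pow x n ≈ pow x′ n
  pow-cong zero    h = ≈-refl
  pow-cong (suc n) h = *-cong h (pow-cong n h)

  private
    -- The two products of `fullWeight`, summed over `S`, combine to `g` because `yi ⊕ - y` equals y
    -- (yi² - 1).
    g-split : ∀ n G → b ⊗ (y ⊗ (pow (1# ⊕ a ⊗ y) n ⊗ G ⊗ (1# ⊕ a ⊗ y)) ⊕ (yi ⊕ - y) ⊗ (pow (a ⊗ y) n ⊗ G ⊗ (a ⊗ y))) ≈ g (suc n) ⊗ G
    g-split n G = begin
      b ⊗ (y ⊗ (p ⊗ G ⊗ (1# ⊕ a ⊗ y)) ⊕ (yi ⊕ - y) ⊗ (q ⊗ G ⊗ (a ⊗ y)))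
        ≈⟨ *-congˡ (+-congˡ (*-congʳ d≈)) ⟩
      b ⊗ (y ⊗ (p ⊗ G ⊗ (1# ⊕ a ⊗ y)) ⊕ y ⊗ (yi ⊗ yi ⊕ - 1#) ⊗ (q ⊗ G ⊗ (a ⊗ y)))
        ≈⟨ solve 8 (λ b y p G s q t d → b :* (y :* (p :* G :* s) :+ y :* d :* (q :* G :* t)) := b :* y :* (s :* p :+ t :* q :* d) :* G) ≈-refl
             b y p G (1# ⊕ a ⊗ y) q (a ⊗ y) (yi ⊗ yi ⊕ - 1#) ⟩
      b ⊗ y ⊗ ((1# ⊕ a ⊗ y) ⊗ p ⊕ a ⊗ y ⊗ q ⊗ (yi ⊗ yi ⊕ - 1#)) ⊗ G ∎
      where
      p q : Carrier
      p = pow (1# ⊕ a ⊗ y) n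
      q = pow (a ⊗ y) n
      d≈ : yi ⊕ - y ≈ y ⊗ (yi ⊗ yi ⊕ - 1#)
      d≈ = ≈-sym (≈-trans (distribˡ _ _ _) (+-cong
        (≈-trans (≈-sym (*-assoc _ _ _)) (≈-trans (*-congʳ y⊗yi≈1) (*-identityˡ yi)))
        (≈-trans (≈-sym (Algebra.Properties.Ring.-‿distribʳ-* (CommutativeRing.ring R) y 1#)) (-‿cong (*-identityʳ y)))))

  total₀ : total factor₀ ≈ a ⊗ y
  total₀ = +-identityˡ _

  -- Disjoint blocks see independent parts of `S`, so the sum factors over the blocks, and a block
  -- becomes a power of `total` per product. Each block takes one `b`; in `sumS-gaps` the enclosing
  -- block and its `b` are left to the caller.
  sumS-treeWeight : ∀ t → pow b (blocks t) ⊗ sumS (size t) (weight t) ≈ treeWeight t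
  sumS-gaps : ∀ z t → pow b (inner t) ⊗ sumS (size t) (blockWeight z t) ≈ pow (total z) (len t) ⊗ gaps t
  sumS-treeWeight leaf       = ≈-trans (*-identityˡ _) (+-identityʳ _)
  sumS-treeWeight (node L R) = begin
    pow b (blocks L + suc (inner R)) ⊗ sumS (size (node L R)) (weight (node L R))
      ≈⟨ *-cong (pow-+ b (blocks L) (suc (inner R))) (≈-trans (sumS-weight L R) (*-congˡ (sumS-full R))) ⟩
    pow b (blocks L) ⊗ (b ⊗ p) ⊗ (sumS (size L) (weight L) ⊗ (y ⊗ (s₁ ⊗ total factor₁) ⊕ (yi ⊕ - y) ⊗ (s₀ ⊗ total factor₀)))
      ≈⟨ solve 10 (λ P b p w y s₁ t₁ d s₀ t₀ → P :* (b :* p) :* (w :* (y :* (s₁ :* t₁) :+ d :* (s₀ :* t₀)))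
           := P :* w :* (b :* (y :* (p :* s₁ :* t₁) :+ d :* (p :* s₀ :* t₀)))) ≈-refl
           (pow b (blocks L)) b p (sumS (size L) (weight L)) y s₁ (total factor₁) (yi ⊕ - y) s₀ (total factor₀) ⟩
    pow b (blocks L) ⊗ sumS (size L) (weight L) ⊗ (b ⊗ (y ⊗ (p ⊗ s₁ ⊗ total factor₁) ⊕ (yi ⊕ - y) ⊗ (p ⊗ s₀ ⊗ total factor₀)))
      ≈⟨ *-cong (sumS-treeWeight L) (≈-trans (*-congˡ (+-cong (*-congˡ (*-congʳ (sumS-gaps factor₁ R)))
           (*-congˡ (*-cong (≈-trans (sumS-gaps factor₀ R) (*-congʳ (pow-cong (len R) total₀))) total₀)))) (g-split (len R) (gaps R))) ⟩
    treeWeight L ⊗ (g (suc (len R)) ⊗ gaps R) ∎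
    where
    p s₁ s₀ : Carrier
    p = pow b (inner R)
    s₁ = sumS (size R) (blockWeight factor₁ R)
    s₀ = sumS (size R) (blockWeight factor₀ R)
  sumS-gaps z leaf       = *-congˡ (+-identityʳ _)
  sumS-gaps z (node L R) = begin
    pow b (inner L + blocks R) ⊗ sumS (size (node L R)) (blockWeight z (node L R))
      ≈⟨ *-cong (pow-+ b (inner L) (blocks R)) (sumS-block z L R) ⟩
    pow b (inner L) ⊗ pow b (blocks R) ⊗ (sumS (size L) (blockWeight z L) ⊗ (total z ⊗ sumS (size R) (weight R)))
      ≈⟨ solve 5 (λ p q s t w → p :* q :* (s :* (t :* w)) := t :* (p :* s) :* (q :* w)) ≈-refl _ _ _ _ _ ⟩
    total z ⊗ (pow b (inner L) ⊗ sumS (size L) (blockWeight z L)) ⊗ (pow b (blocks R) ⊗ sumS (size R) (weight R))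
      ≈⟨ *-cong (*-congˡ (sumS-gaps z L)) (sumS-treeWeight R) ⟩
    total z ⊗ (pow (total z) (len L) ⊗ gaps L) ⊗ treeWeight R
      ≈⟨ solve 4 (λ t p q w → t :* (p :* q) :* w := t :* p :* (q :* w)) ≈-refl _ _ _ _ ⟩
    total z ⊗ pow (total z) (len L) ⊗ (gaps L ⊗ treeWeight R) ∎

  occurrences-block-0 : ∀ t → occurrences 0 (block t) ≡ suc (len t)
  occurrences-block-0 leaf       = refl
  occurrences-block-0 (node L R) = trans (countB-++ (_≡ᵇ 0) (block L) _) (trans (cong₂ _+_ (occurrences-block-0 L)
    (trans (countB-++ (_≡ᵇ 0) (gap L R) [ 0 ]) (cong (_+ 1) (occurrences-∉ 0 (gap L R) (0∉gap (inner L) (labels R))))))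
    (ℕ.+-comm (suc (len L)) 1))

  private
    <⇒∉map : ∀ {l k} xs → l < k → l ∉ map (k +_) xs
    <⇒∉map {l} {k} xs h m with ∈-map⁻ (k +_) m
    ... | x , _ , refl = ℕ.<⇒≱ h (ℕ.m≤m+n k x)

    ≥⇒∉ : ∀ {l k xs} → All (_< k) xs → k ≤ l → l ∉ xs
    ≥⇒∉ h k≤l m = ℕ.<⇒≱ (All.lookup h m) k≤l

  prodL-labels : ∀ t → prodL (upTo (blocks t)) (λ l → g (occurrences l (labels t))) ≈ treeWeight t
  prodL-block  : ∀ t → prodL (upTo (inner t)) (λ l → g (occurrences (suc l) (block t))) ≈ gaps t
  prodL-labels leaf       = ≈-refl
  prodL-labels (node L R) = begin
    prodL (upTo (blocks L + suc (inner R))) (λ l → g (occurrences l (labels (node L R))))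
      ≈⟨ prodL-upTo-+ (λ l → g (occurrences l (labels (node L R)))) (blocks L) (suc (inner R)) ⟩
    prodL (upTo (blocks L)) (λ l → g (occurrences l (labels (node L R)))) ⊗
    prodL (upTo (suc (inner R))) (λ l → g (occurrences (blocks L + l) (labels (node L R))))
      ≈⟨ *-cong (prodL-cong (upTo (blocks L)) (λ {l} l∈ → ≈-reflexive (cong g (left (∈-upTo⁻ l∈)))))
                (prodL-cong (upTo (suc (inner R))) (λ {l} _ → ≈-reflexive (cong g (right l)))) ⟩
    prodL (upTo (blocks L)) (λ l → g (occurrences l (labels L))) ⊗ prodL (upTo (suc (inner R))) (λ l → g (occurrences l (block R)))
      ≈⟨ *-cong (prodL-labels L) (≈-trans (prodL-upTo-suc (λ l → g (occurrences l (block R))) (inner R))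
           (*-cong (≈-reflexive (cong g (occurrences-block-0 R))) (prodL-block R))) ⟩
    treeWeight L ⊗ (g (suc (len R)) ⊗ gaps R) ∎
    where
    left : ∀ {l} → l < blocks L → occurrences l (labels (node L R)) ≡ occurrences l (labels L)
    left {l} h = trans (countB-++ (_≡ᵇ l) (labels L) _)
      (trans (cong (occurrences l (labels L) +_) (occurrences-∉ l _ (<⇒∉map (block R) h))) (ℕ.+-identityʳ _))
    right : ∀ l → occurrences (blocks L + l) (labels (node L R)) ≡ occurrences l (block R)
    right l = trans (countB-++ (_≡ᵇ (blocks L + l)) (labels L) _)
      (cong₂ _+_ (occurrences-∉ (blocks L + l) (labels L) (≥⇒∉ (grow-bounded (grow-labels L)) (ℕ.m≤m+n _ l)))
                 (occurrences-map-≥ (blocks L) l (block R)))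
  prodL-block leaf       = ≈-refl
  prodL-block (node L R) = begin
    prodL (upTo (inner L + blocks R)) (λ l → g (occurrences (suc l) (block (node L R))))
      ≈⟨ prodL-upTo-+ (λ l → g (occurrences (suc l) (block (node L R)))) (inner L) (blocks R) ⟩
    prodL (upTo (inner L)) (λ l → g (occurrences (suc l) (block (node L R)))) ⊗
    prodL (upTo (blocks R)) (λ l → g (occurrences (suc (inner L + l)) (block (node L R))))
      ≈⟨ *-cong (prodL-cong (upTo (inner L)) (λ {l} l∈ → ≈-reflexive (cong g (left (∈-upTo⁻ l∈)))))
                (prodL-cong (upTo (blocks R)) (λ {l} _ → ≈-reflexive (cong g (right l)))) ⟩
    prodL (upTo (inner L)) (λ l → g (occurrences (suc l) (block L))) ⊗ prodL (upTo (blocks R)) (λ l → g (occurrences l (labels R)))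
      ≈⟨ *-cong (prodL-block L) (prodL-labels R) ⟩
    gaps L ⊗ treeWeight R ∎
    where
    split : ∀ l → occurrences (suc l) (block (node L R)) ≡ occurrences (suc l) (block L) + occurrences (suc l) (gap L R)
    split l = trans (countB-++ (_≡ᵇ suc l) (block L) _) (cong (occurrences (suc l) (block L) +_)
      (trans (countB-++ (_≡ᵇ suc l) (gap L R) [ 0 ]) (ℕ.+-identityʳ _)))
    left : ∀ {l} → l < inner L → occurrences (suc l) (block (node L R)) ≡ occurrences (suc l) (block L)
    left {l} h = trans (split l) (trans (cong (occurrences (suc l) (block L) +_) (occurrences-∉ (suc l) _ (<⇒∉map (labels R) (s≤s h)))) (ℕ.+-identityʳ _))
    right : ∀ l → occurrences (suc (inner L + l)) (block (node L R)) ≡ occurrences l (labels R)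
    right l = trans (split (inner L + l)) (cong₂ _+_
      (occurrences-∉ (suc (inner L + l)) (block L) (≥⇒∉ (grow-bounded (grow-block L)) (ℕ.m≤m+n (suc (inner L)) l)))
      (occurrences-map-≥ (suc (inner L)) l (labels R)))

  -- Sums over trees as power series

  treeSum : (Tree → Carrier) → PS
  treeSum f n = sumL (trees n) f

  treeSum-node : ∀ (F f h : Tree → Carrier) → (∀ L R → F (node L R) ≈ f L ⊗ h R) → ∀ n → treeSum F (suc n) ≈ (treeSum f ⊛ treeSum h) n
  treeSum-node F f h e n = begin
    treeSum F (suc n)
      ≈⟨ sumL-concatMap (λ l → cartesianProductWith node (treesBelow n l) (treesBelow n (n ∸ l))) F (upTo (suc n)) ⟩
    sumL (upTo (suc n)) (λ l → sumL (cartesianProductWith node (treesBelow n l) (treesBelow n (n ∸ l))) F)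
      ≈⟨ sumL-cong (upTo (suc n)) (λ {l} l∈ → begin
           sumL (cartesianProductWith node (treesBelow n l) (treesBelow n (n ∸ l))) F
             ≈⟨ sumL-cartesianProductWith node F (treesBelow n l) (treesBelow n (n ∸ l)) ⟩
           sumL (treesBelow n l) (λ L → sumL (treesBelow n (n ∸ l)) (λ R → F (node L R)))
             ≈⟨ sumL-cong (treesBelow n l) (λ {L} _ → sumL-cong (treesBelow n (n ∸ l)) (λ {R} _ → e L R)) ⟩
           sumL (treesBelow n l) (λ L → sumL (treesBelow n (n ∸ l)) (λ R → f L ⊗ h R))
             ≈⟨ sumL-product f h (treesBelow n l) (treesBelow n (n ∸ l)) ⟨
           sumL (treesBelow n l) f ⊗ sumL (treesBelow n (n ∸ l)) h
             -- Subtrees are listed with the depth bound `n` of the whole tree; a larger bound than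
             -- the size yields the same trees.
             ≈⟨ *-cong (sumL-bijection f (treesBelow↭trees (ℕ.≤-pred (∈-upTo⁻ l∈)))) (sumL-bijection h (treesBelow↭trees (ℕ.m∸n≤m n l))) ⟨
           treeSum f l ⊗ treeSum h (n ∸ l) ∎) ⟩
    (treeSum f ⊛ treeSum h) n ∎

  ĝ-trees : ∀ n → ĝ n ≈ treeSum treeWeight n
  ĝ-trees n = ≈-trans (sumL-bijection _ (trees↭NC n)) (sumL-cong (trees n) (λ {t} t∈ → blocks-product t (treesBelow⁻ n n t∈)))
    where
    blocks-product : ∀ t {n} → size t ≡ n → prodL (blockLabels n (labels t)) (λ l → g (blockSize n (labels t) l)) ≈ treeWeight t
    blocks-product t refl = begin
      prodL (blockLabels (size t) (labels t)) (λ l → g (blockSize (size t) (labels t) l))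
        ≈⟨ ≈-reflexive (cong (λ ls → prodL ls (λ l → g (blockSize (size t) (labels t) l))) (blockLabels-labels t)) ⟩
      prodL (upTo (blocks t)) (λ l → g (blockSize (size t) (labels t) l))
        ≈⟨ prodL-cong (upTo (blocks t)) (λ {l} _ → ≈-reflexive (cong g (trans (cong (λ k → blockSize k (labels t) l) (sym (length-labels t))) (blockSize-occurrences (labels t) l)))) ⟩
      prodL (upTo (blocks t)) (λ l → g (occurrences l (labels t)))
        ≈⟨ prodL-labels t ⟩
      treeWeight t ∎

  W : PS
  W = treeSum treeWeight

  W≗ : W ≗ onePlusĝ
  W≗ zero    = +-identityʳ _
  W≗ (suc n) = ≈-sym (ĝ-trees (suc n))

  blockSeries : Carrier → PS
  blockSeries ζ = treeSum (λ t → pow ζ (len t) ⊗ gaps t)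

  -- A block is a single element, or a shorter block followed by a gap and one more element: weight
  -- ζ for the new element, X for its size, `W` for the gap.
  blockSeries-star : ∀ ζ → IsStar W ζ (blockSeries ζ)
  blockSeries-star ζ zero    = ≈-trans (+-identityʳ _) (≈-trans (*-identityˡ _) (≈-sym (≈-trans (+-congˡ (zeroʳ ζ)) (+-identityʳ _))))
  blockSeries-star ζ (suc n) = begin
    treeSum (λ t → pow ζ (len t) ⊗ gaps t) (suc n)
      ≈⟨ treeSum-node _ (λ L → ζ ⊗ (pow ζ (len L) ⊗ gaps L)) treeWeight
           (λ L R → solve 4 (λ z p q w → z :* p :* (q :* w) := z :* (p :* q) :* w) ≈-refl ζ (pow ζ (len L)) (gaps L) (treeWeight R)) n ⟩
    (treeSum (λ L → ζ ⊗ (pow ζ (len L) ⊗ gaps L)) ⊛ W) n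
      ≈⟨ ⊛-cong {g = W} (λ k → ≈-sym (sumL-⊗ˡ ζ _ (trees k))) (λ _ → ≈-refl) n ⟩
    ((ζ · blockSeries ζ) ⊛ W) n
      ≈⟨ ⊛-·ˡ ζ (blockSeries ζ) W n ⟩
    ζ ⊗ (blockSeries ζ ⊛ W) n
      ≈⟨ +-identityˡ _ ⟨
    0# ⊕ ζ ⊗ (blockSeries ζ ⊛ W) n ∎

  -- The last point is an end for every `S`, so it is not summed over, and the last block
  -- contributes the power `len v` and no factor `b`.
  sumS-node : ∀ z u v → sumS (size u + size v) (λ S → pow b (blocks u + inner v) ⊗ (weight u S ⊗ blockWeight z v (λ i → S (size u + i))))
                        ≈ treeWeight u ⊗ (pow (total z) (len v) ⊗ gaps v)
  sumS-node z u v = begin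
    sumS (size u + size v) (λ S → pow b (blocks u + inner v) ⊗ (weight u S ⊗ blockWeight z v (λ i → S (size u + i))))
      ≈⟨ sumL-⊗ˡ _ _ (bits (size u + size v)) ⟨
    pow b (blocks u + inner v) ⊗ sumS (size u + size v) (λ S → weight u S ⊗ blockWeight z v (λ i → S (size u + i)))
      ≈⟨ *-cong (pow-+ b (blocks u) (inner v)) (sumS-split (size u) (size v) (weight u) (blockWeight z v) (weight-cong u)) ⟩
    pow b (blocks u) ⊗ pow b (inner v) ⊗ (sumS (size u) (weight u) ⊗ sumS (size v) (blockWeight z v))
      ≈⟨ solve 4 (λ p q r s → p :* q :* (r :* s) := p :* r :* (q :* s)) ≈-refl _ _ _ _ ⟩
    pow b (blocks u) ⊗ sumS (size u) (weight u) ⊗ (pow b (inner v) ⊗ sumS (size v) (blockWeight z v))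
      ≈⟨ *-cong (sumS-treeWeight u) (sumS-gaps z v) ⟩
    treeWeight u ⊗ (pow (total z) (len v) ⊗ gaps v) ∎

  -- `factor₀` is `factor₁` set to zero on `S`, so the meet condition turns into vanishing factors
  -- of the same product.
  blockWeight-avoids : ∀ t S → (if avoids t S then blockWeight factor₁ t S else 0#) ≈ blockWeight factor₀ t S
  blockWeight-avoids leaf       S = ≈-refl
  blockWeight-avoids (node L R) S with avoids L S | S (size L) | blockWeight-avoids L S
  ... | true  | true  | h = ≈-sym (≈-trans (*-congˡ (zeroˡ _)) (zeroʳ _))
  ... | true  | false | h = *-congʳ h
  ... | false | s     | h = ≈-sym (≈-trans (*-congʳ (≈-sym h)) (zeroˡ _))

  kSummand : ℕ → (ℕ → ℕ) → (ℕ → ℕ) → Carrier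
  kSummand n α β = if meetKrIntIsZero n α β
    then pow y ∥ inv n α ∘ₚ β ∥[ n ] ⊗ pow a ∥ inv n α ∘ₚ γ n ∥[ n ] ⊗ pow b ∥ inv n β ∘ₚ γ n ∥[ n ]
    else 0#

  mSummand : ℕ → (ℕ → ℕ) → (ℕ → ℕ) → Carrier
  mSummand n α β = pow y ∥ inv n α ∘ₚ β ∥[ n ] ⊗ pow a ∥ α ∥[ n ] ⊗ pow b ∥ β ∥[ n ]

  if-cong : ∀ {s s′ x x′} → s ≡ s′ → x ≈ x′ → (if s then x else 0#) ≈ (if s′ then x′ else 0#)
  if-cong {true}  refl h = h
  if-cong {false} refl h = ≈-refl

  if-⊗ : ∀ s k x → (if s then k ⊗ x else 0#) ≈ k ⊗ (if s then x else 0#)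
  if-⊗ true  k x = ≈-refl
  if-⊗ false k x = ≈-sym (zeroʳ k)

  private
    exponents : ∀ {i i′ j j′ k k′} → i ≡ i′ → j ≡ j′ → k ≡ k′ → pow y i ⊗ pow a j ⊗ pow b k ≈ pow b k′ ⊗ (pow y i′ ⊗ pow a j′)
    exponents refl refl refl = *-comm _ _

  kSummand-node : ∀ S u v → let m = size u + size v in
    kSummand (suc m) (krPerm S m) (toPerm (suc m) (labels (node u v))) ≈
    pow b (blocks u + inner v) ⊗ (weight u S ⊗ blockWeight factor₀ v (λ i → S (size u + i)))
  kSummand-node S u v = begin
    kSummand (suc m) (krPerm S m) (toPerm (suc m) (labels (node u v)))
      ≈⟨ if-cong (trans meet-free (free-avoids S u v)) (≈-trans (exponents ∥α⁻¹β∥ ∥α⁻¹γ∥ ∥β⁻¹γ∥) (*-congˡ (meanderWeight-node S m u v refl))) ⟩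
    (if avoids v S′ then pow b (blocks u + inner v) ⊗ (weight u S ⊗ blockWeight factor₁ v S′) else 0#)
      ≈⟨ ≈-trans (if-⊗ (avoids v S′) _ _) (*-congˡ (if-⊗ (avoids v S′) _ _)) ⟩
    pow b (blocks u + inner v) ⊗ (weight u S ⊗ (if avoids v S′ then blockWeight factor₁ v S′ else 0#))
      ≈⟨ *-congˡ (*-congˡ (blockWeight-avoids v S′)) ⟩
    pow b (blocks u + inner v) ⊗ (weight u S ⊗ blockWeight factor₀ v S′) ∎
    where
    m : ℕ
    m = size u + size v
    S′ : ℕ → Bool
    S′ i = S (size u + i)
    open KLengths S u v (krPerm-ι S m) (toPerm-perm (node u v) refl)
    open Meet S (node u v) m refl (krPerm-ι S m) (toPerm-perm (node u v) refl)

  mSummand-cons : ∀ S u v → let m = size u + size v in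
    mSummand (suc m) (intervalPerm S m) (toPerm (suc m) (labels (cons u v))) ≈
    pow b (blocks u + inner v) ⊗ (weight u S ⊗ blockWeight factor₁ v (λ i → S (size u + i)))
  mSummand-cons S u v = ≈-trans (exponents (MLengths.∥α⁻¹β∥ S u v) (MLengths.∥α∥ S u v) (MLengths.∥β∥ S u v))
    (*-congˡ (meanderWeight-node S (size u + size v) u v refl))

  nodeWeight : (Bool → Carrier) → Tree → Carrier
  nodeWeight z leaf       = 0#
  nodeWeight z (node u v) = treeWeight u ⊗ (pow (total z) (len v) ⊗ gaps v)

  private
    Int×NC : ∀ (f : ℕ → List ℕ → ℕ → ℕ) (k : ℕ → (ℕ → ℕ) → (ℕ → ℕ) → Carrier) m →
      sumL (Int (suc m)) (λ p → sumL (NC (suc m)) (λ q → k (suc m) (f (suc m) p) (toPerm (suc m) q))) ≈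
      sumL (trees (suc m)) (λ t → sumL (bits m) (λ bs → k (suc m) (f (suc m) (labels (interval (fn bs) m))) (toPerm (suc m) (labels t))))
    Int×NC f k m = ≈-trans (sumL-bijection _ (bits↭Int m)) (≈-trans
      (sumL-cong (bits m) (λ _ → sumL-bijection _ (trees↭NC (suc m))))
      (sumL-swap (λ bs t → k (suc m) (f (suc m) (labels (interval (fn bs) m))) (toPerm (suc m) (labels t))) (bits m) (trees (suc m))))

  K-trees : ∀ m → K (suc m) ≈ treeSum (nodeWeight factor₀) (suc m)
  K-trees m = begin
    sumL (map (λ p → Kr (suc m) (toPerm (suc m) p)) (Int (suc m))) (λ α → sumL (NC (suc m)) (λ q → kSummand (suc m) α (toPerm (suc m) q)))
      ≈⟨ ≈-reflexive (sumL-map (λ p → Kr (suc m) (toPerm (suc m) p)) _ (Int (suc m))) ⟩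
    sumL (Int (suc m)) (λ p → sumL (NC (suc m)) (λ q → kSummand (suc m) (Kr (suc m) (toPerm (suc m) p)) (toPerm (suc m) q)))
      ≈⟨ Int×NC (λ n p → Kr n (toPerm n p)) kSummand m ⟩
    sumL (trees (suc m)) (λ t → sumL (bits m) (λ bs → kSummand (suc m) (krPerm (fn bs) m) (toPerm (suc m) (labels t))))
      ≈⟨ sumL-cong (trees (suc m)) (λ {t} t∈ → at-tree t m (treesBelow⁻ (suc m) (suc m) t∈)) ⟩
    treeSum (nodeWeight factor₀) (suc m) ∎
    where
    at-tree : ∀ t m → size t ≡ suc m → sumL (bits m) (λ bs → kSummand (suc m) (krPerm (fn bs) m) (toPerm (suc m) (labels t))) ≈ nodeWeight factor₀ t
    at-tree (node u v) m refl = ≈-trans (sumL-cong (bits m) (λ {bs} _ → kSummand-node (fn bs) u v)) (sumS-node factor₀ u v)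

  M-trees : ∀ m → M (suc m) ≈ treeSum (nodeWeight factor₁) (suc m)
  M-trees m = begin
    sumL (Int (suc m)) (λ p → sumL (NC (suc m)) (λ q → mSummand (suc m) (toPerm (suc m) p) (toPerm (suc m) q)))
      ≈⟨ Int×NC toPerm mSummand m ⟩
    sumL (trees (suc m)) (λ t → sumL (bits m) (λ bs → mSummand (suc m) (intervalPerm (fn bs) m) (toPerm (suc m) (labels t))))
      -- After rotation β runs through the trees `cons u v`, the form in which `meanderWeight-node`
      -- evaluates the summand.
      ≈⟨ sumL-bijection _ (rotate↭ (suc m)) ⟩
    sumL (trees (suc m)) (λ t → sumL (bits m) (λ bs → mSummand (suc m) (intervalPerm (fn bs) m) (toPerm (suc m) (labels (rotate t)))))
      ≈⟨ sumL-cong (trees (suc m)) (λ {t} t∈ → at-tree t m (treesBelow⁻ (suc m) (suc m) t∈)) ⟩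
    treeSum (nodeWeight factor₁) (suc m) ∎
    where
    at-tree : ∀ t m → size t ≡ suc m →
      sumL (bits m) (λ bs → mSummand (suc m) (intervalPerm (fn bs) m) (toPerm (suc m) (labels (rotate t)))) ≈ nodeWeight factor₁ t
    at-tree (node u v) m refl = ≈-trans (sumL-cong (bits m) (λ {bs} _ → mSummand-cons (fn bs) u v)) (sumS-node factor₁ u v)

  Q₀ Q₁ : PS
  Q₀ = blockSeries (a ⊗ y)
  Q₁ = blockSeries (1# ⊕ a ⊗ y)

  K≗ : K ≗ X· (W ⊛ Q₀)
  K≗ zero    = ≈-refl
  K≗ (suc m) = ≈-trans (K-trees m) (treeSum-node (nodeWeight factor₀) treeWeight (λ t → pow (a ⊗ y) (len t) ⊗ gaps t)
    (λ L R → *-congˡ (*-congʳ (pow-cong (len R) total₀))) m)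

  M≗ : M ≗ X· (W ⊛ Q₁)
  M≗ zero    = ≈-refl
  M≗ (suc m) = ≈-trans (M-trees m) (treeSum-node (nodeWeight factor₁) treeWeight (λ t → pow (1# ⊕ a ⊗ y) (len t) ⊗ gaps t) (λ L R → ≈-refl) m)

  powS-cong : ∀ {f f′} → f ≗ f′ → ∀ k → powS f k ≗ powS f′ k
  powS-cong h zero    n = ≈-refl
  powS-cong h (suc k) n = ⊛-cong h (powS-cong h k) n

  K≗hComp : K ≗ hComp
  K≗hComp zero    = ≈-refl
  K≗hComp (suc m) = begin
    K (suc m)
      ≈⟨ K≗ (suc m) ⟩
    (W ⊛ Q₀) m
      -- Taking F = W supplies the missing factor: the `j`-th term has (AY)^j = h_(j+1) and W^(j+1),
      -- and the leading X accounts for the shift of the index.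
      ≈⟨ star-powers W (blockSeries-star (a ⊗ y)) m W ⟨
    sumL (upTo (suc m)) (λ j → pow (a ⊗ y) j ⊗ powS W (suc j) (m ∸ j))
      ≈⟨ sumL-cong (upTo (suc m)) (λ {j} _ → *-congˡ (powS-cong W≗ (suc j) (m ∸ j))) ⟩
    hComp (suc m) ∎

  M≗K+MK : M ≗ K ⊞ M ⊛ K
  M≗K+MK n = begin
    M n
      ≈⟨ M≗ n ⟩
    X· (W ⊛ Q₁) n
      ≈⟨ X·-cong (star-shift W (blockSeries-star (a ⊗ y)) (blockSeries-star (1# ⊕ a ⊗ y))) n ⟩
    X· (W ⊛ Q₀ ⊞ X· ((W ⊛ Q₁) ⊛ (W ⊛ Q₀))) n
      ≈⟨ X·-⊞ (W ⊛ Q₀) _ n ⟩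
    X· (W ⊛ Q₀) n ⊕ X· (X· ((W ⊛ Q₁) ⊛ (W ⊛ Q₀))) n
      ≈⟨ +-cong (K≗ n) (begin
           (M ⊛ K) n
             ≈⟨ ⊛-cong M≗ K≗ n ⟩
           (X· (W ⊛ Q₁) ⊛ X· (W ⊛ Q₀)) n
             ≈⟨ ⊛-X·ʳ (X· (W ⊛ Q₁)) (W ⊛ Q₀) n ⟩
           X· (X· (W ⊛ Q₁) ⊛ (W ⊛ Q₀)) n
             ≈⟨ X·-cong (λ k → ≈-trans (⊛-comm (X· (W ⊛ Q₁)) (W ⊛ Q₀) k) (≈-trans (⊛-X·ʳ (W ⊛ Q₀) (W ⊛ Q₁) k) (X·-cong (⊛-comm (W ⊛ Q₀) (W ⊛ Q₁)) k))) n ⟩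
           X· (X· ((W ⊛ Q₁) ⊛ (W ⊛ Q₀))) n ∎) ⟨
    K n ⊕ (M ⊛ K) n ∎
    where
    X·-⊞ : ∀ f h → X· (f ⊞ h) ≗ X· f ⊞ X· h
    X·-⊞ f h zero    = ≈-sym (+-identityʳ _)
    X·-⊞ f h (suc n) = ≈-refl

  M[1-K]≗K : M ⊛ oneMinusK ≗ K
  -- Adding M K to both sides gives M = K + M K, so the negated series never has to be expanded.
  M[1-K]≗K n = Algebra.Properties.Ring.+-cancelʳ (CommutativeRing.ring R) ((M ⊛ K) n) ((M ⊛ oneMinusK) n) (K n) (begin
    (M ⊛ oneMinusK) n ⊕ (M ⊛ K) n
      ≈⟨ ⊛-⊞ʳ M oneMinusK K n ⟨
    (M ⊛ (oneMinusK ⊞ K)) n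
      ≈⟨ ⊛-cong {M} {g′ = oneS} (λ _ → ≈-refl) (λ k → ≈-trans (+-assoc _ _ _) (≈-trans (+-congˡ (-‿inverseˡ (K k))) (+-identityʳ _))) n ⟩
    (M ⊛ oneS) n
      ≈⟨ ⊛-oneʳ M n ⟩
    M n
      ≈⟨ M≗K+MK n ⟩
    K n ⊕ (M ⊛ K) n ∎)

theorem5p1 : ∀ {c ℓ} (R : CommutativeRing c ℓ) (y yi a b : CommutativeRing.Carrier R) →
    CommutativeRing._≈_ R (CommutativeRing._*_ R y yi) (CommutativeRing.1# R) →
    ((n : ℕ) → CommutativeRing._≈_ R (Series.K R y yi a b n) (Series.hComp R y yi a b n))
    × ((n : ℕ) → CommutativeRing._≈_ R (Series._⊛_ R y yi a b (Series.M R y yi a b) (Series.oneMinusK R y yi a b) n) (Series.K R y yi a b n))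
theorem5p1 R y yi a b h = K≗hComp , M[1-K]≗K
  where open Generating R y yi a b h
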